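{- Let $G$ be a connected graph on $n$ vertices with $e$ edges and diameter $d$, where $n\ge 5$ and $d\ge 2$. If $k$ is an integer with $$\binom{\binom{k}{2}+d-1}{d-1} < n-2k+2,$$ then $h(G)\ge \max\{k,\ d/2,\ \sqrt{2e/n}\}$. In particular, if $n\ge d^{2d-2}$, then $$h(G)\ge \max\{0.5\,n^{1/(2d-2)},\ d/2,\ \sqrt{2e/n}\}.$$
   Context: $d_G(u,v)$ denotes the shortest-path distance in $G$. For $S\subseteq V(G)$, the distance multiset $D(S)$ is the multiset of distances $d_G(u,v)$ over all unordered pairs of distinct vertices $u,v\in S$. Two vertex sets $S_1,S_2$ are homometric if $D(S_1)=D(S_2)$. $h(G)$ is the largest integer $h$ such that $G$ contains two disjoint homometric sets $S_1,S_2$ with $|S_1|=|S_2|=h$. -}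

module Defs where

open import Data.Nat using (ℕ; zero; suc; _+_; _*_; _<_; _≤_)
open import Data.Fin as F using (Fin)
open import Data.Bool using (Bool; true; false; _∧_; if_then_else_)
open import Data.List using (List; map; allFin; cartesianProduct)
open import Data.Nat.ListAction using (sum)
open import Data.Product using (Σ; _×_; _,_; proj₁; proj₂; ∃; ∃-syntax)
open import Relation.Nullary using (¬_; does)
open import Relation.Binary.PropositionalEquality using (_≡_; _≢_)
open import Function.Bundles using (_↔_; Inverse; _⇔_)
open import Function.Definitions using (Injective)

record Graph (n : ℕ) : Set where
  field
    adj    : Fin n → Fin n → Bool
    symm   : ∀ i j → adj i j ≡ adj j i
    irrefl : ∀ i → adj i i ≡ false
open Graph public

module _ {n : ℕ} (G : Graph n) where

  data Walk : Fin n → Fin n → ℕ → Set where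
    here : ∀ {u} → Walk u u 0
    step : ∀ {u v w k} → adj G u v ≡ true → Walk v w k → Walk u w (suc k)

  Dist : Fin n → Fin n → ℕ → Set
  Dist u v t = Walk u v t × (∀ m → m < t → ¬ Walk u v m)

  Connected : Set
  Connected = ∀ u v → ∃[ t ] Walk u v t

  Diameter : ℕ → Set
  Diameter d = (∀ u v t → Dist u v t → t ≤ d) × (∃[ u ] ∃[ v ] Dist u v d)

  edgeCount : ℕ
  edgeCount = sum (map (λ p → if does (proj₁ p F.<? proj₂ p) ∧ adj G (proj₁ p) (proj₂ p)
                                then 1 else 0)
                       (cartesianProduct (allFin n) (allFin n)))

  Pair : ℕ → Set
  Pair h = Σ (Fin h × Fin h) (λ p → proj₁ p F.< proj₂ p)

  -- two h-element vertex sets (given by injective enumerations) are homometric: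
  -- there is a bijection between their unordered pairs preserving distance,
  -- i.e. their distance multisets coincide.
  Homometric : {h : ℕ} → (Fin h → Fin n) → (Fin h → Fin n) → Set
  Homometric {h} S₁ S₂ =
    Σ (Pair h ↔ Pair h) λ π → ∀ p t →
      let q = Inverse.to π p in
      (Dist (S₁ (proj₁ (proj₁ p))) (S₁ (proj₂ (proj₁ p))) t
        ⇔ Dist (S₂ (proj₁ (proj₁ q))) (S₂ (proj₂ (proj₁ q))) t)

  HasHomPair : ℕ → Set
  HasHomPair h =
    Σ (Fin h → Fin n) λ S₁ → Σ (Fin h → Fin n) λ S₂ →
      Injective _≡_ _≡_ S₁ × Injective _≡_ _≡_ S₂ ×
      (∀ i j → S₁ i ≢ S₂ j) × Homometric S₁ S₂

{-# OPTIONS --safe #-}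
-- A homometric pair is found for each of the three bounds separately, and the largest one is taken.
--
-- For the bound k, colour every k-set by its distance multiset. By the Lovász–Kneser theorem fewer
-- than n − 2k + 2 colours force two disjoint k-sets of one colour. Kneser's theorem follows from
-- Tucker's lemma on sign vectors, which holds by a parity argument: pairing Ky Fan's cochain (labels
-- alternating in sign) with hemispheres of increasing dimension, built by a prism operator, always
-- gives an odd number. For d/2, cut a geodesic into halves.
--
-- For the square root of 2e/n, take the least k with 2e ≤ k²n. Some closed neighbourhood has more
-- than (k − 1)² + 1 vertices, and as distances in it are at most 2, only numbers of edges matter. For
-- k ≥ 6 Kneser's theorem suffices. For k = 4, 5 label large sign vectors by the number of sign changes
-- in the word that tells, for each possible number of edges, which side has such a k-set; this loses
-- less, and the remaining words are excluded by exchange arguments and a small search. For k = 3 pass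
-- to an induced subgraph of minimum degree 3 with more than twice as many edges as vertices, and
-- match cherries with cherries or triangles with triangles.
module Submission where

open import Defs
open import Data.Bool.Base using (Bool; T; _xor_; _∧_; _∨_; false; if_then_else_; not; true)
open import Data.Bool.Properties as Bool using (not-involutive; not-¬; xor-assoc; xor-comm; xor-identityʳ; xor-same; ¬-not; ∧-conicalʳ; ∧-conicalˡ)
open import Data.Bool.Solver using (module xor-∧-Solver)
open import Data.Empty using (⊥; ⊥-elim)
open import Data.Fin.Base as Fin using (Fin; suc; toℕ; zero)
open import Data.Fin.Permutation as Fin using (cast-id)
open import Data.Fin.Properties as Fin using (any?; suc-injective; toℕ-injective; toℕ<n)
open import Data.Fin.Subset as Subset using (Subset; _∪_; _⊆_; inside; outside; ⁅_⁆; ∁; ∣_∣) renaming (_∈_ to _∈ₛ_)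
open import Data.Fin.Subset.Properties as Subset using (_⊆?_; anySubset?; in⊆in; out⊆; x∈∁p⇒x∉p)
open import Data.List.Base as List using (List; []; _++_; _∷_; allFin; cartesianProduct; concatMap; length; lookup; map; replicate; tabulate)
import Data.List.Membership.DecPropositional as DecMembership
open import Data.List.Membership.Propositional as List using (_∈_; _∉_) renaming (find to locate)
open import Data.List.Membership.Propositional.Properties using (∈-++⁺ʳ; ∈-++⁺ˡ; ∈-++⁻; ∈-allFin; ∈-lookup; ∈-map⁺; ∈-map⁻; ∈-tabulate⁺; ∈-∃++)
open import Data.List.Membership.Propositional.Properties.WithK using (unique∧set⇒bag)
open import Data.List.Properties using (length-++; length-map; length-tabulate; map-++; map-cong; map-cong-local; map-id; map-id-local; map-tabulate; map-∘; tabulate-lookup)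
open import Data.List.Relation.Binary.BagAndSetEquality using (∼bag⇒↭)
import Data.List.Relation.Binary.Permutation.Homogeneous as Homogeneous
open import Data.List.Relation.Binary.Permutation.Propositional as Perm using (_↭_; prep; refl; swap; ↭-refl; ↭-reflexive; ↭-sym; ↭-trans; ↭⇒↭ₛ) renaming (trans to ↭trans)
open import Data.List.Relation.Binary.Permutation.Propositional.Properties as Perm using (++⁺; ++⁺ʳ; ++⁺ˡ; All-resp-↭; map⁺; shift; ↭-length; ∈-resp-↭)
import Data.List.Relation.Binary.Permutation.Setoid.Properties as SetoidPerm
open import Data.List.Relation.Binary.Pointwise as List using (Pointwise-≡⇒≡; []; _∷_)
open import Data.List.Relation.Binary.Sublist.Propositional using ([]; _∷_; _∷ʳ_; ⊆-refl) renaming (_⊆_ to _⊆ₗ_)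
open import Data.List.Relation.Binary.Sublist.Propositional.Properties using (All-resp-⊆)
open import Data.List.Relation.Unary.All as All using (All; []; _∷_)
open import Data.List.Relation.Unary.All.Properties as All using ()
open import Data.List.Relation.Unary.AllPairs as AllPairs using (AllPairs; []; _∷_)
open import Data.List.Relation.Unary.AllPairs.Properties as AllPairs using ()
open import Data.List.Relation.Unary.Any as Any using (Any; here; index; there)
open import Data.List.Relation.Unary.Any.Properties as Any using (lookup-index)
open import Data.List.Relation.Unary.Sorted.TotalOrder.Properties using (AllPairs⇒Sorted; Sorted⇒AllPairs; ↗↭↗⇒≋)
open import Data.List.Relation.Unary.Unique.DecPropositional using (unique?)
open import Data.List.Relation.Unary.Unique.Propositional using (Unique)
open import Data.List.Relation.Unary.Unique.Propositional.Properties as Unique using ()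
open import Data.Maybe.Base as Maybe using (Maybe; just; maybe′; nothing)
open import Data.Maybe.Properties using (just-injective; ≡-dec)
open import Data.Nat.Base
open import Data.Nat.Combinatorics using (_C_; nC1≡n; nCk+nC[k+1]≡[n+1]C[k+1]; nCn≡1)
open import Data.Nat.DivMod using (_%_; _/_)
open import Data.Nat.ListAction using (sum)
open import Data.Nat.ListAction.Properties using (sum-++; sum-↭)
open import Data.Nat.Properties as ℕ using (<⇒≢; ≤-antisym; ≤-decTotalOrder; ≤-refl; ≤-totalOrder; ≤-trans; ≤∧≢⇒<; ⌊n/2⌋-mono)
open import Data.Nat.Solver using (module +-*-Solver)
open import Data.Product.Base as Product using (_,_; _×_; proj₁; proj₂; uncurry; ∃; ∃-syntax)
open import Data.Sum.Base as Sum using (_⊎_; inj₁; inj₂)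
open import Data.Unit.Base using (tt; ⊤)
open import Data.Vec.Base as Vec using (Vec; []; _∷_; here; there)
open import Data.Vec.Relation.Binary.Pointwise.Inductive as Pointwise using (Pointwise; []; _∷_)
open import Function.Base using (_∘_; case_of_; const; id)
open import Function.Bundles using (Inverse; _↔_; mk↔ₛ′; mk⇔)
open import Function.Construct.Composition using (_↔-∘_)
open import Function.Construct.Identity using (↔-id)
open import Function.Construct.Symmetry using (↔-sym)
open import Relation.Binary.Definitions using (tri<; tri>; tri≈)
open import Relation.Binary.PropositionalEquality
open import Relation.Nullary using (Dec; does; no; yes; ¬_)
open import Relation.Nullary.Decidable using (True; _×-dec_; _⊎-dec_; dec-false; dec-true; decidable-stable; from-yes; map′; toWitness; ¬?; ⌊_⌋)

-- Why the values k = 3, 4, 5 are special: colouring k-sets by their number of edges takes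
-- binom(k,2) + 1 colours, so Kneser's theorem needs binom(k,2) + 2k vertices, while the closed
-- neighbourhood provides (k - 1)² + 2. This is 27 of 27 for k = 6, but 20 of 18 for k = 5 and 14 of
-- 11 for k = 4. The deficit is made up by bounding blocks of equal sign in a word instead of
-- colours: at most 9 rather than 11 for k = 5, and 4 rather than 7 for k = 4. For k = 3 no argument
-- inside the neighbourhood can work: in a star with five leaves the triple containing the centre
-- spans two edges and the other triple none. There the density of the whole graph has to supply
-- edges outside the star.

private variable
  A B : Set

open import Data.List.Sort ≤-decTotalOrder using (sort; sort-↭; sort-↗)

-- Tucker's lemma for the octahedral sphere

-- Cochains modulo 2 on ordered simplices, and their coboundary.
δ : (List A → Bool) → List A → Bool
δ φ []       = false
δ φ (x ∷ xs) = φ xs xor δ (φ ∘ (x ∷_)) xs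

xor-interchange : ∀ a b c d → (a xor b) xor (c xor d) ≡ (a xor c) xor (b xor d)
xor-interchange = solve 4 (λ a b c d → (a :+ b) :+ (c :+ d) := (a :+ c) :+ (b :+ d)) refl
  where open xor-∧-Solver

xor-cancelˡ : ∀ a b → a xor (a xor b) ≡ b
xor-cancelˡ false b = refl
xor-cancelˡ true  b = not-involutive b

δ-cong-⊆ : {φ ψ : List A → Bool} (xs : List A) → (∀ {zs} → zs ⊆ₗ xs → φ zs ≡ ψ zs) → δ φ xs ≡ δ ψ xs
δ-cong-⊆ []       h = refl
δ-cong-⊆ (x ∷ xs) h = cong₂ _xor_ (h (x ∷ʳ ⊆-refl)) (δ-cong-⊆ xs λ s → h (refl ∷ s))

δ-cong : {φ ψ : List A → Bool} → φ ≗ ψ → δ φ ≗ δ ψ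
δ-cong h xs = δ-cong-⊆ xs λ _ → h _

δ-xor : (φ ψ : List A → Bool) → ∀ xs → δ (λ zs → φ zs xor ψ zs) xs ≡ δ φ xs xor δ ψ xs
δ-xor φ ψ []       = refl
δ-xor φ ψ (x ∷ xs) = trans (cong ((φ xs xor ψ xs) xor_) (δ-xor (φ ∘ (x ∷_)) (ψ ∘ (x ∷_)) xs))
                           (xor-interchange (φ xs) (ψ xs) _ _)

δ-map : (f : A → B) (φ : List B → Bool) → ∀ xs → δ φ (map f xs) ≡ δ (φ ∘ map f) xs
δ-map f φ []       = refl
δ-map f φ (x ∷ xs) = cong (φ (map f xs) xor_) (δ-map f (φ ∘ (f x ∷_)) xs)

δ-false : (xs : List A) → δ (const false) xs ≡ false
δ-false []       = refl
δ-false (x ∷ xs) = δ-false xs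

-- Modulo 2 the faces carry no orientation sign, so permuting a simplex merely permutes its faces.
δ-resp-↭ : {φ : List A → Bool} → (∀ {xs ys} → xs ↭ ys → φ xs ≡ φ ys) →
           ∀ {xs ys} → xs ↭ ys → δ φ xs ≡ δ φ ys
δ-resp-↭ h refl = refl
δ-resp-↭ h (prep x p) = cong₂ _xor_ (h p) (δ-resp-↭ (λ q → h (prep x q)) p)
δ-resp-↭ {φ = φ} h (swap {xs} {ys} x y p) =
  trans (cong₂ (λ a b → a xor (b xor δ (φ ∘ (x ∷_) ∘ (y ∷_)) xs)) (h (prep y p)) (h (prep x p)))
 (trans (cong (λ a → φ (y ∷ ys) xor (φ (x ∷ ys) xor a))
          (trans (δ-cong (λ zs → h (swap x y refl)) xs) (δ-resp-↭ (λ q → h (prep y (prep x q))) p)))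
   (solve 3 (λ a b c → a :+ (b :+ c) := b :+ (a :+ c)) refl (φ (y ∷ ys)) (φ (x ∷ ys)) _))
  where open xor-∧-Solver
δ-resp-↭ h (↭trans p q) = trans (δ-resp-↭ h p) (δ-resp-↭ h q)

-- A label ±(i+1) is coded by one of the two numbers with half i; the parity is its sign.
sgn : ℕ → Bool
sgn 0             = true
sgn 1             = false
sgn (suc (suc c)) = sgn c

-- Negation of labels: it exchanges the codes 2i and 2i + 1.
ν : ℕ → ℕ
ν 0             = 1
ν 1             = 0
ν (suc (suc c)) = suc (suc (ν c))

sgn-ν : ∀ c → sgn (ν c) ≡ not (sgn c)
sgn-ν 0 = refl
sgn-ν 1 = refl
sgn-ν (suc (suc c)) = sgn-ν c

ν-involutive : ∀ c → ν (ν c) ≡ c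
ν-involutive 0 = refl
ν-involutive 1 = refl
ν-involutive (suc (suc c)) = cong 2+ (ν-involutive c)

half-ν : ∀ c → ⌊ ν c /2⌋ ≡ ⌊ c /2⌋
half-ν 0 = refl
half-ν 1 = refl
half-ν (suc (suc c)) = cong suc (half-ν c)

half-sgn-injective : ∀ b c → ⌊ b /2⌋ ≡ ⌊ c /2⌋ → sgn b ≡ sgn c → b ≡ c
half-sgn-injective 0 0 _ _ = refl
half-sgn-injective 0 1 _ ()
half-sgn-injective 0 (suc (suc _)) ()
half-sgn-injective 1 0 _ ()
half-sgn-injective 1 1 _ _ = refl
half-sgn-injective 1 (suc (suc _)) ()
half-sgn-injective (suc (suc _)) 0 ()
half-sgn-injective (suc (suc _)) 1 ()
half-sgn-injective (suc (suc b)) (suc (suc c)) p q = cong 2+ (half-sgn-injective b c (ℕ.suc-injective p) q)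

half≡⇒≡ν : ∀ b c → ⌊ b /2⌋ ≡ ⌊ c /2⌋ → sgn b ≢ sgn c → b ≡ ν c
half≡⇒≡ν b c p q = half-sgn-injective b (ν c) (trans p (sym (half-ν c)))
  (trans (¬-not q) (sym (sgn-ν c)))

-- The order of codes refines that of absolute values, and `ν` can reverse it only between the two
-- codes of one absolute value. These are complementary, hence excluded.
ν-mono : ∀ {b c} → b ≤ c → b ≢ ν c → ν b ≤ ν c
ν-mono {b} {c} b≤c b≢νc with ⌊ b /2⌋ ℕ.≟ ⌊ c /2⌋
... | yes p with sgn b Bool.≟ sgn c
...   | yes q = ℕ.≤-reflexive (cong ν (half-sgn-injective b c p q))
...   | no q = ⊥-elim (b≢νc (half≡⇒≡ν b c p q))
ν-mono {b} {c} b≤c b≢νc | no p with ℕ.≤-total (ν b) (ν c)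
... | inj₁ le = le
... | inj₂ ge = ⊥-elim (p (ℕ.≤-antisym (⌊n/2⌋-mono b≤c) (subst₂ _≤_ (half-ν c) (half-ν b) (⌊n/2⌋-mono ge))))

-- Alternating sign sequences and Ky Fan's cochain

alternating : Bool → List Bool → Bool
alternating b []           = true
alternating b     (true  ∷ ss) = b ∧ alternating (not b) ss
alternating b (false ∷ ss) = not b ∧ alternating (not b) ss

-- A list with one pair of equal neighbours becomes alternating by deleting either of them, and the
-- two deletions cancel. A non-empty list alternating from `b` contributes by deleting its last
-- entry, one alternating from `not b` by deleting its first.
δ-alternating : ∀ b ss → δ (alternating b) ss ≡ alternating b ss xor alternating (not b) ss
δ-alternating b     []           = refl
δ-alternating true  (true  ∷ ss) = trans (cong (alternating true ss xor_) (δ-alternating false ss))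
  (trans (cong (alternating true ss xor_) (xor-comm (alternating false ss) _))
  (trans (xor-cancelˡ (alternating true ss) _) (sym (xor-identityʳ _))))
δ-alternating true  (false ∷ ss) = trans (cong (alternating true ss xor_) (δ-false ss)) (xor-identityʳ _)
δ-alternating false (true  ∷ ss) = trans (cong (alternating false ss xor_) (δ-false ss)) (xor-identityʳ _)
δ-alternating false (false ∷ ss) = trans (cong (alternating false ss xor_) (δ-alternating true ss))
  (trans (cong (alternating false ss xor_) (xor-comm (alternating true ss) _))
  (trans (xor-cancelˡ (alternating false ss) _) (sym (xor-identityʳ _))))

alternating-not : ∀ b ss → alternating b (map not ss) ≡ alternating (not b) ss
alternating-not b [] = refl
alternating-not b (true ∷ ss) = cong (not b ∧_) (alternating-not (not b) ss)
alternating-not b (false ∷ ss) rewrite not-involutive b = cong (b ∧_) (trans (alternating-not (not b) ss) (cong (λ c → alternating c ss) (not-involutive b)))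

sort-resp-↭ : ∀ {xs ys} → xs ↭ ys → sort xs ≡ sort ys
sort-resp-↭ {xs} {ys} p = Pointwise-≡⇒≡ (↗↭↗⇒≋ ≤-totalOrder (sort-↗ xs) (sort-↗ ys)
  (↭⇒↭ₛ (↭-trans (sort-↭ xs) (↭-trans p (↭-sym (sort-↭ ys))))))

sorted⇒sort≡ : ∀ {xs} → AllPairs _≤_ xs → sort xs ≡ xs
sorted⇒sort≡ {xs} s = Pointwise-≡⇒≡ (↗↭↗⇒≋ ≤-totalOrder (sort-↗ xs) (AllPairs⇒Sorted ≤-totalOrder s) (↭⇒↭ₛ (sort-↭ xs)))

AllPairs-resp-⊆ : ∀ {R : A → A → Set} {xs ys} → xs ⊆ₗ ys → AllPairs R ys → AllPairs R xs
AllPairs-resp-⊆ []         _        = []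
AllPairs-resp-⊆ (_ ∷ʳ s)   (_ ∷ ps) = AllPairs-resp-⊆ s ps
AllPairs-resp-⊆ (refl ∷ s) (p ∷ ps) = All-resp-⊆ s p ∷ AllPairs-resp-⊆ s ps

AllPairs-resp-↭ : ∀ {R : A → A → Set} → (∀ {x y} → R x y → R y x) → ∀ {xs ys} → xs ↭ ys → AllPairs R xs → AllPairs R ys
AllPairs-resp-↭ {A = A} {R = R} sy p = SetoidPerm.AllPairs-resp-↭ (setoid A) sy (resp₂ R) (↭⇒↭ₛ p)

-- Ky Fan's cochain: the labels, sorted by absolute value, alternate in sign starting with +.
fan : List ℕ → Bool
fan ls = alternating true (map sgn (sort ls))

NonCompl : List ℕ → Set
NonCompl = AllPairs (λ b c → b ≢ ν c)

NonCompl-sym : ∀ {b c} → b ≢ ν c → c ≢ ν b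
NonCompl-sym {b} p q = p (trans (sym (ν-involutive b)) (cong ν (sym q)))

sort-map-ν : ∀ {ls} → NonCompl ls → sort (map ν ls) ≡ map ν (sort ls)
sort-map-ν {ls} nc = trans (sort-resp-↭ (map⁺ ν (↭-sym (sort-↭ ls))))
  (sorted⇒sort≡ (AllPairs.map⁺ (AllPairs.zipWith (λ (p , q) → ν-mono p q)
     (Sorted⇒AllPairs ≤-totalOrder (sort-↗ ls) , nc′))))
  where
  nc′ : NonCompl (sort ls)
  nc′ = AllPairs-resp-↭ NonCompl-sym (↭-sym (sort-↭ ls)) nc

-- The second term of `δ-alternating`, alternation from minus, is `fan` at the opposite labels,
-- because without complementary pairs negation commutes with sorting.
fan-coboundary : ∀ {ls} → NonCompl ls → δ fan ls ≡ fan ls xor fan (map ν ls)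
fan-coboundary {ls} nc = begin
  δ fan ls                                       ≡⟨ δ-resp-↭ (cong (alternating true ∘ map sgn) ∘ sort-resp-↭) (sort-↭ ls) ⟨
  δ fan (sort ls)                                ≡⟨ δ-cong-⊆ (sort ls) (λ s → cong (alternating true ∘ map sgn) (sorted⇒sort≡ (AllPairs-resp-⊆ s sorted))) ⟩
  δ (alternating true ∘ map sgn) (sort ls)       ≡⟨ δ-map sgn (alternating true) (sort ls) ⟨
  δ (alternating true) (map sgn (sort ls))       ≡⟨ δ-alternating true (map sgn (sort ls)) ⟩
  fan ls xor alternating false (map sgn (sort ls)) ≡⟨ cong (fan ls xor_) (sym (trans (cong (alternating true) eq) (alternating-not true (map sgn (sort ls))))) ⟩
  fan ls xor fan (map ν ls)                      ∎
  where
  open ≡-Reasoning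
  sorted = Sorted⇒AllPairs ≤-totalOrder (sort-↗ ls)
  eq : map sgn (sort (map ν ls)) ≡ map not (map sgn (sort ls))
  eq = trans (cong (map sgn) (sort-map-ν nc)) (trans (sym (map-∘ (sort ls)))
        (trans (map-cong sgn-ν (sort ls)) (map-∘ (sort ls))))

-- Neighbours of opposite sign in the sorted list differ in absolute value, as they would be
-- complementary otherwise. So the absolute values increase strictly, from `lo` on and below `m`.
alternating⇒short : ∀ {m} b lo ls → All (λ c → lo ≤ ⌊ c /2⌋) ls → All (λ c → ⌊ c /2⌋ < m) ls →
  AllPairs _≤_ ls → NonCompl ls → lo ≤ m → alternating b (map sgn ls) ≡ true → lo + length ls ≤ m
alternating⇒short b lo [] _ _ _ _ lo≤m _ = ℕ.≤-trans (ℕ.≤-reflexive (ℕ.+-identityʳ lo)) lo≤m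
alternating⇒short b lo (c ∷ ls) (l ∷ _) (u ∷ us) (s ∷ ss) (n ∷ ns) lo≤m alt =
  ℕ.≤-trans (ℕ.≤-reflexive (ℕ.+-suc lo (length ls)))
  (ℕ.≤-trans (s≤s (ℕ.+-monoˡ-≤ (length ls) l))
   (alternating⇒short (not b) (suc ⌊ c /2⌋) ls (next b ls s n ss alt) us ss ns u (tail b (sgn c) alt)))
  where
  tail : ∀ b s {ss} → alternating b (s ∷ ss) ≡ true → alternating (not b) ss ≡ true
  tail true true p = p
  tail false false p = p
  head : ∀ b s {ss} → alternating b (s ∷ ss) ≡ true → s ≡ b
  head true true p = refl
  head false false p = refl
  jump : ∀ {c′} → c ≤ c′ → c ≢ ν c′ → sgn c ≢ sgn c′ → suc ⌊ c /2⌋ ≤ ⌊ c′ /2⌋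
  jump p q r = ≤∧≢⇒< (⌊n/2⌋-mono p) (λ e → q (half≡⇒≡ν c _ e r))
  next : ∀ b ls → All (c ≤_) ls → All (λ c′ → c ≢ ν c′) ls → AllPairs _≤_ ls → alternating b (map sgn (c ∷ ls)) ≡ true → All (λ c′ → suc ⌊ c /2⌋ ≤ ⌊ c′ /2⌋) ls
  next b [] _ _ _ _ = []
  next b (c′ ∷ ls) (s ∷ _) (n ∷ _) (ps ∷ _) alt = first ∷ All.map (λ p → ≤-trans first (⌊n/2⌋-mono p)) ps
    where
    first : suc ⌊ c /2⌋ ≤ ⌊ c′ /2⌋
    first = jump s n λ e → not-¬ refl (trans (trans (sym (head b _ alt)) e) (head (not b) _ (tail b (sgn c) alt)))

-- Sign vectors and chains of the octahedral sphere

data Trit : Set where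
  neg zer pos : Trit

data _≼_ : Trit → Trit → Set where
  zer≼ : ∀ {t} → zer ≼ t
  refl : ∀ {t} → t ≼ t

flip : Trit → Trit
flip neg = pos
flip zer = zer
flip pos = neg

flip-involutive : ∀ t → flip (flip t) ≡ t
flip-involutive neg = refl
flip-involutive zer = refl
flip-involutive pos = refl

flip-mono : ∀ {s t} → s ≼ t → flip s ≼ flip t
flip-mono zer≼ = zer≼
flip-mono refl = refl

≼-trans : ∀ {s t u} → s ≼ t → t ≼ u → s ≼ u
≼-trans zer≼ _ = zer≼
≼-trans refl q = q

-- The non-zero sign vectors are the faces of the octahedral sphere and `⊑` is inclusion of faces;
-- chains are the simplices of its barycentric subdivision.
SignVec : ℕ → Set
SignVec = Vec Trit

_⊑_ : ∀ {n} → SignVec n → SignVec n → Set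
_⊑_ = Pointwise _≼_

infix 4 _≼_ _⊑_

⊑-refl : ∀ {n} {X : SignVec n} → X ⊑ X
⊑-refl = Pointwise.refl refl

⊑-trans : ∀ {n} {X Y Z : SignVec n} → X ⊑ Y → Y ⊑ Z → X ⊑ Z
⊑-trans = Pointwise.trans ≼-trans

−_ : ∀ {n} → SignVec n → SignVec n
−_ = Vec.map flip

−-involutive : ∀ {n} (X : SignVec n) → − (− X) ≡ X
−-involutive [] = refl
−-involutive (t ∷ X) = cong₂ _∷_ (flip-involutive t) (−-involutive X)

−-mono : ∀ {n} {X Y : SignVec n} → X ⊑ Y → (− X) ⊑ (− Y)
−-mono = Pointwise.map⁺ flip-mono

𝟎 : ∀ {n} → SignVec n
𝟎 = Vec.replicate _ zer

𝟎⊑ : ∀ {n} (X : SignVec n) → 𝟎 ⊑ X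
𝟎⊑ [] = []
𝟎⊑ (t ∷ X) = zer≼ ∷ 𝟎⊑ X

-𝟎 : ∀ {n} → − (𝟎 {n}) ≡ 𝟎
-𝟎 {zero} = refl
-𝟎 {suc n} = cong (zer ∷_) -𝟎

map−-involutive : ∀ {n} (zs : List (SignVec n)) → map −_ (map −_ zs) ≡ zs
map−-involutive zs = trans (sym (map-∘ zs)) (trans (map-cong −-involutive zs) (map-id zs))

-- The sum of φ over the chains 0x₁ ≤ … ≤ 0xᵢ ≤ +xᵢ ≤ … ≤ +xₗ for 0 ≤ i ≤ l, where x₀ = y and the entry 0x₀ is omitted.
prism : ∀ {n} → (List (SignVec (suc n)) → Bool) → SignVec n → List (SignVec n) → Bool
prism φ y []       = φ ((pos ∷ y) ∷ [])
prism φ y (x ∷ xs) = φ ((pos ∷ y) ∷ map (pos ∷_) (x ∷ xs)) xor prism (φ ∘ ((zer ∷ x) ∷_)) x xs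

prism-cong : ∀ {n} {φ ψ : List (SignVec (suc n)) → Bool} → φ ≗ ψ → ∀ y xs → prism φ y xs ≡ prism ψ y xs
prism-cong h y []       = h _
prism-cong h y (x ∷ xs) = cong₂ _xor_ (h _) (prism-cong (λ _ → h _) x xs)

prism-xor : ∀ {n} (φ ψ : List (SignVec (suc n)) → Bool) → ∀ y xs →
  prism (λ zs → φ zs xor ψ zs) y xs ≡ prism φ y xs xor prism ψ y xs
prism-xor φ ψ y []       = refl
prism-xor φ ψ y (x ∷ xs) = trans (cong ((φ _ xor ψ _) xor_) (prism-xor (φ ∘ ((zer ∷ x) ∷_)) (ψ ∘ ((zer ∷ x) ∷_)) x xs))
  (xor-interchange (φ _) (ψ _) _ _)

-- The base point enters the first summand only, and adding that summand cancels it. This repairs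
-- the change of base from `y` to `x` in the recursion of `prism`.
prism-base : ∀ {n} (φ : List (SignVec (suc n)) → Bool) y y′ xs →
  prism φ y xs xor φ ((pos ∷ y) ∷ map (pos ∷_) xs) ≡ prism φ y′ xs xor φ ((pos ∷ y′) ∷ map (pos ∷_) xs)
prism-base φ y y′ [] = trans (xor-same (φ _)) (sym (xor-same (φ _)))
prism-base φ y y′ (x ∷ xs) = trans (cancel (φ _) _) (sym (cancel (φ _) _))
  where
  cancel : ∀ a b → (a xor b) xor a ≡ b
  cancel a b = trans (cong (_xor a) (xor-comm a b)) (trans (xor-assoc b a a) (trans (cong (b xor_) (xor-same a)) (xor-identityʳ b)))

-- The prism operator is a chain homotopy from 0x₁ ≤ … ≤ 0xₗ to the empty chain.
δ-prism : ∀ {n} (φ : List (SignVec (suc n)) → Bool) y xs →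
  prism (δ φ) y xs ≡ φ (map (zer ∷_) xs) xor δ (prism φ y) xs
δ-prism φ y []       = refl
δ-prism φ y (x ∷ xs) = begin
  (φ p₁ xor (φ p₂ xor δ φ₂ px)) xor prism (λ zs → φ zs xor δ φx zs) x xs
    ≡⟨ cong ((φ p₁ xor (φ p₂ xor δ φ₂ px)) xor_) (trans (prism-xor φ (δ φx) x xs) (cong (prism φ x xs xor_) (δ-prism φx x xs))) ⟩
  (φ p₁ xor (φ p₂ xor δ φ₂ px)) xor (prism φ x xs xor (φ₀ xor q))
    ≡⟨ shuffle (φ p₁) (φ p₂) (δ φ₂ px) (prism φ x xs) φ₀ q ⟩
  φ₀ xor (((prism φ x xs xor φ p₁) xor φ p₂) xor (δ φ₂ px xor q))
    ≡⟨ cong (λ a → φ₀ xor ((a xor φ p₂) xor (δ φ₂ px xor q))) (prism-base φ x y xs) ⟩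
  φ₀ xor (((prism φ y xs xor φ p₂) xor φ p₂) xor (δ φ₂ px xor q))
    ≡⟨ cong (φ₀ xor_) (cancel (prism φ y xs) (φ p₂) (δ φ₂ px xor q)) ⟩
  φ₀ xor (prism φ y xs xor (δ φ₂ px xor q))
    ≡⟨ cong (λ a → φ₀ xor (prism φ y xs xor a)) (sym (trans (δ-xor _ _ xs) (cong (_xor q) (sym (δ-map (pos ∷_) φ₂ xs))))) ⟩
  φ₀ xor (prism φ y xs xor δ (λ zs → prism φ y (x ∷ zs)) xs) ∎
  where
  open ≡-Reasoning
  px = map (pos ∷_) xs
  p₁ = (pos ∷ x) ∷ px
  p₂ = (pos ∷ y) ∷ px
  φ₂ = φ ∘ ((pos ∷ y) ∷_) ∘ ((pos ∷ x) ∷_)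
  φx = φ ∘ ((zer ∷ x) ∷_)
  φ₀ = φ (map (zer ∷_) (x ∷ xs))
  q = δ (prism φx x) xs
  shuffle : ∀ a b c d e f → (a xor (b xor c)) xor (d xor (e xor f)) ≡ e xor (((d xor a) xor b) xor (c xor f))
  shuffle a b c d e f = solve 6 (λ a b c d e f → (a :+ (b :+ c)) :+ (d :+ (e :+ f)) := e :+ (((d :+ a) :+ b) :+ (c :+ f))) refl a b c d e f
    where open xor-∧-Solver
  cancel : ∀ a b c → ((a xor b) xor b) xor c ≡ a xor c
  cancel a b c = cong (_xor c) (trans (xor-assoc a b b) (trans (cong (a xor_) (xor-same b)) (xor-identityʳ a)))

-- The sum of φ over the maximal chains of non-zero sign vectors.
∑-sphere : ∀ n → (List (SignVec n) → Bool) → Bool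
∑-sphere zero    φ = φ []
∑-sphere (suc n) φ = ∑-sphere n (prism φ 𝟎) xor ∑-sphere n (prism (φ ∘ map −_) 𝟎)

∑-sphere-cong : ∀ n {φ ψ} → φ ≗ ψ → ∑-sphere n φ ≡ ∑-sphere n ψ
∑-sphere-cong zero    h = h []
∑-sphere-cong (suc n) h = cong₂ _xor_ (∑-sphere-cong n (prism-cong h 𝟎)) (∑-sphere-cong n (prism-cong (λ _ → h _) 𝟎))

∑-sphere-xor : ∀ n φ ψ → ∑-sphere n (λ zs → φ zs xor ψ zs) ≡ ∑-sphere n φ xor ∑-sphere n ψ
∑-sphere-xor zero    φ ψ = refl
∑-sphere-xor (suc n) φ ψ = trans (cong₂ _xor_
   (trans (∑-sphere-cong n (prism-xor φ ψ 𝟎)) (∑-sphere-xor n _ _))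
   (trans (∑-sphere-cong n (prism-xor _ _ 𝟎)) (∑-sphere-xor n _ _)))
  (xor-interchange (∑-sphere n (prism φ 𝟎)) _ _ _)

∑-sphere-− : ∀ n φ → ∑-sphere n (φ ∘ map −_) ≡ ∑-sphere n φ
∑-sphere-− zero    φ = refl
∑-sphere-− (suc n) φ = trans (xor-comm (∑-sphere n _) _)
  (cong (_xor ∑-sphere n (prism (φ ∘ map −_) 𝟎)) (∑-sphere-cong n (prism-cong (cong φ ∘ map−-involutive) 𝟎)))

-- The sphere is a cycle: both hemispheres are bounded by the equator, which the antipodal map
-- preserves. In `∑-prism-δ` the remaining term of the homotopy vanishes because the equator, a
-- sphere of lower dimension, is itself a cycle.
∑-sphere-δ : ∀ n φ → ∑-sphere n (δ φ) ≡ false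
∑-prism-δ : ∀ n φ → ∑-sphere n (prism (δ φ) 𝟎) ≡ ∑-sphere n (φ ∘ map (zer ∷_))

∑-prism-δ n φ = trans (trans (∑-sphere-cong n (δ-prism φ 𝟎)) (∑-sphere-xor n _ _))
  (trans (cong (∑-sphere n (φ ∘ map (zer ∷_)) xor_) (∑-sphere-δ n (prism φ 𝟎))) (xor-identityʳ _))

∑-sphere-δ zero    φ = refl
∑-sphere-δ (suc n) φ = begin
  ∑-sphere n (prism (δ φ) 𝟎) xor ∑-sphere n (prism (δ φ ∘ map −_) 𝟎)
    ≡⟨ cong₂ _xor_ (∑-prism-δ n φ) (trans (∑-sphere-cong n (prism-cong (δ-map −_ φ) 𝟎)) (∑-prism-δ n (φ ∘ map −_))) ⟩
  ∑-sphere n (φ ∘ map (zer ∷_)) xor ∑-sphere n (φ ∘ map −_ ∘ map (zer ∷_))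
    ≡⟨ cong (∑-sphere n (φ ∘ map (zer ∷_)) xor_) (trans (∑-sphere-cong n (λ zs → cong φ (trans (sym (map-∘ zs)) (map-∘ zs)))) (∑-sphere-− n (φ ∘ map (zer ∷_)))) ⟩
  ∑-sphere n (φ ∘ map (zer ∷_)) xor ∑-sphere n (φ ∘ map (zer ∷_))
    ≡⟨ xor-same (∑-sphere n (φ ∘ map (zer ∷_))) ⟩
  false ∎
  where open ≡-Reasoning

record Flag {n} (xs : List (SignVec n)) : Set where
  constructor flag
  field
    full    : length xs ≡ n
    chain   : AllPairs _⊑_ xs
    nonzero : All (_≢ 𝟎) xs

Flag-− : ∀ {n} {xs : List (SignVec n)} → Flag xs → Flag (map −_ xs)
Flag-− {xs = xs} (flag l c z) = flag (trans (length-map −_ xs) l)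
  (AllPairs.map⁺ (AllPairs.map −-mono c))
  (All.map⁺ (All.map (λ {X} X≢𝟎 e → X≢𝟎 (trans (sym (−-involutive X)) (trans (cong −_ e) -𝟎))) z))

-- The identities for labels hold only on chains of non-zero vectors. The chain is kept above
-- `zer ∷ y` so that the induction can put the entry `zer ∷ x` back in front.
prism-cong-chain : ∀ {n} {φ ψ : List (SignVec (suc n)) → Bool} y xs →
  All (y ⊑_) xs → AllPairs _⊑_ xs → All (_≢ 𝟎) xs →
  (∀ zs → length zs ≡ suc (length xs) → AllPairs _⊑_ ((zer ∷ y) ∷ zs) → All (_≢ 𝟎) zs → φ zs ≡ ψ zs) →
  prism φ y xs ≡ prism ψ y xs
prism-cong-chain y [] _ _ _ h = h _ refl (((zer≼ ∷ ⊑-refl) ∷ []) ∷ [] ∷ []) ((λ ()) ∷ [])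
prism-cong-chain y (x ∷ xs) (y⊑x ∷ y⊑xs) (x⊑xs ∷ c) (x≢𝟎 ∷ z) h = cong₂ _xor_
  (h _ (cong suc (length-map (pos ∷_) (x ∷ xs)))
     (((zer≼ ∷ ⊑-refl) ∷ All.map⁺ (All.map (zer≼ ∷_) (y⊑x ∷ y⊑xs)))
       ∷ All.map⁺ (All.map (refl ∷_) (y⊑x ∷ y⊑xs))
       ∷ AllPairs.map⁺ (AllPairs.map (refl ∷_) (x⊑xs ∷ c)))
     ((λ ()) ∷ All.map⁺ (All.universal (λ _ ()) (x ∷ xs))))
  (prism-cong-chain x xs x⊑xs c z λ zs l c′ z′ →
    h _ (cong suc l) (((zer≼ ∷ y⊑x) ∷ All.map (⊑-trans (zer≼ ∷ y⊑x)) (AllPairs.head c′)) ∷ c′)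
      ((λ e → x≢𝟎 (cong Vec.tail e)) ∷ z′))

∑-sphere-cong-flag : ∀ n {φ ψ : List (SignVec n) → Bool} → (∀ {xs} → Flag xs → φ xs ≡ ψ xs) → ∑-sphere n φ ≡ ∑-sphere n ψ
∑-sphere-cong-flag zero    h = h (flag refl [] [])
∑-sphere-cong-flag (suc n) h = cong₂ _xor_ (half h) (half (h ∘ Flag-−))
  where
  half : {φ ψ : List (SignVec (suc n)) → Bool} → (∀ {xs} → Flag xs → φ xs ≡ ψ xs) →
         ∑-sphere n (prism φ 𝟎) ≡ ∑-sphere n (prism ψ 𝟎)
  half h = ∑-sphere-cong-flag n λ {xs} (flag l c z) → prism-cong-chain 𝟎 xs (All.universal 𝟎⊑ xs) c z
    λ zs l′ c′ z′ → h (flag (trans l′ (cong suc l)) (AllPairs.tail c′) z′)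

record IsLabelling {n} (m : ℕ) (ℓ : SignVec n → ℕ) : Set where
  field
    antipodal    : ∀ X → X ≢ 𝟎 → ℓ (− X) ≡ ν (ℓ X)
    bounded      : ∀ X → X ≢ 𝟎 → ⌊ ℓ X /2⌋ < m
    noncomplementary : ∀ {X Y} → X ≢ 𝟎 → X ⊑ Y → ℓ X ≢ ν (ℓ Y)

private module _ {n m} {ℓ : SignVec n → ℕ} (L : IsLabelling m ℓ) where
  open IsLabelling L

  nonCompl : ∀ {xs} → Flag xs → NonCompl (map ℓ xs)
  nonCompl (flag _ c z) = AllPairs.map⁺ (go c z)
    where
    go : ∀ {xs} → AllPairs _⊑_ xs → All (_≢ 𝟎) xs → AllPairs (λ X Y → ℓ X ≢ ν (ℓ Y)) xs
    go [] [] = []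
    go (p ∷ ps) (z ∷ zs) = All.map (noncomplementary z) p ∷ go ps zs

  -- Antipodal chains have opposite labels, so `fan-coboundary` turns the contributions of a flag
  -- and its antipode into a coboundary.
  fan-flag : ∀ {xs} → Flag xs → fan (map ℓ xs) xor fan (map ℓ (map −_ xs)) ≡ δ (fan ∘ map ℓ) xs
  fan-flag {xs} F = trans (cong (λ ls → fan (map ℓ xs) xor fan ls) eq)
    (trans (sym (fan-coboundary (nonCompl F))) (δ-map ℓ fan xs))
    where
    eq : map ℓ (map −_ xs) ≡ map ν (map ℓ xs)
    eq = trans (sym (map-∘ xs)) (trans (map-cong-local (All.map (λ {X} → antipodal X) (Flag.nonzero F))) (map-∘ xs))

restrict : ∀ {n m} {ℓ : SignVec (suc n) → ℕ} → IsLabelling m ℓ → IsLabelling m (ℓ ∘ (zer ∷_))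
restrict L = record
  { antipodal = λ X z → antipodal (zer ∷ X) (z ∘ cong Vec.tail)
  ; bounded = λ X z → bounded (zer ∷ X) (z ∘ cong Vec.tail)
  ; noncomplementary = λ z p → noncomplementary (z ∘ cong Vec.tail) (refl ∷ p)
  }
  where open IsLabelling L

-- Adding antipodal contributions leaves the sum of `δ φ` over one hemisphere, which is the sum of
-- `φ` over the equator, where the restricted labelling takes over. The induction ends with the
-- empty chain, which alternates.
fan-odd : ∀ n {m} {ℓ : SignVec n → ℕ} → IsLabelling m ℓ → ∑-sphere n (fan ∘ map ℓ) ≡ true
fan-odd zero L = cong (alternating true ∘ map sgn) (sorted⇒sort≡ [])
fan-odd (suc n) {ℓ = ℓ} L = begin
  ∑-sphere n (prism φ 𝟎) xor ∑-sphere n (prism (φ ∘ map −_) 𝟎)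
    ≡⟨ ∑-sphere-xor n _ _ ⟨
  ∑-sphere n (λ xs → prism φ 𝟎 xs xor prism (φ ∘ map −_) 𝟎 xs)
    ≡⟨ ∑-sphere-cong n (prism-xor φ (φ ∘ map −_) 𝟎) ⟨
  ∑-sphere n (prism (λ zs → φ zs xor φ (map −_ zs)) 𝟎)
    ≡⟨ ∑-sphere-cong-flag n (λ {xs} (flag l c z) → prism-cong-chain 𝟎 xs (All.universal 𝟎⊑ xs) c z
         λ zs l′ c′ z′ → fan-flag L (flag (trans l′ (cong suc l)) (AllPairs.tail c′) z′)) ⟩
  ∑-sphere n (prism (δ φ) 𝟎)
    ≡⟨ ∑-prism-δ n φ ⟩
  ∑-sphere n (φ ∘ map (zer ∷_))
    ≡⟨ ∑-sphere-cong n (λ zs → cong fan (sym (map-∘ zs))) ⟩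
  ∑-sphere n (fan ∘ map (ℓ ∘ (zer ∷_)))
    ≡⟨ fan-odd n (restrict L) ⟩
  true ∎
  where
  open ≡-Reasoning
  φ = fan ∘ map ℓ

∑-sphere-false : ∀ n → ∑-sphere n (const false) ≡ false
∑-sphere-false n = trans (∑-sphere-cong n (sym ∘ δ-false)) (∑-sphere-δ n (const false))

-- An odd sum needs a flag with alternating labels, and its `n` labels have distinct absolute values
-- below `m`.
tucker : ∀ {n m} {ℓ : SignVec n → ℕ} → IsLabelling m ℓ → n ≤ m
tucker {n} {m} {ℓ} L with n ℕ.≤? m
... | yes n≤m = n≤m
... | no n≰m = ⊥-elim (not-¬ (trans (sym (fan-odd n L)) (trans (∑-sphere-cong-flag n vanish) (∑-sphere-false n))) refl)
  where
  vanish : ∀ {xs} → Flag xs → fan (map ℓ xs) ≡ false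
  vanish {xs} F@(flag l c z) = ¬-not λ alt → n≰m (subst (_≤ m)
    (trans (↭-length (sort-↭ ls)) (trans (length-map ℓ xs) l))
    (alternating⇒short true 0 (sort ls) (All.universal (λ _ → z≤n) _)
      (All-resp-↭ (↭-sym (sort-↭ ls)) (All.map⁺ (All.map (λ {X} → IsLabelling.bounded L X) z)))
      (Sorted⇒AllPairs ≤-totalOrder (sort-↗ ls))
      (AllPairs-resp-↭ NonCompl-sym (↭-sym (sort-↭ ls)) (nonCompl L F)) z≤n alt))
    where ls = map ℓ xs

-- Kneser-type theorems

-- The label with sign `s` and absolute value i + 1.
code : Bool → ℕ → ℕ
code s zero    = if s then 0 else 1
code s (suc i) = suc (suc (code s i))

half-code : ∀ s i → ⌊ code s i /2⌋ ≡ i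
half-code true  zero    = refl
half-code false zero    = refl
half-code s     (suc i) = cong suc (half-code s i)

sgn-code : ∀ s i → sgn (code s i) ≡ s
sgn-code true  zero    = refl
sgn-code false zero    = refl
sgn-code s     (suc i) = sgn-code s i

ν-code : ∀ s i → ν (code s i) ≡ code (not s) i
ν-code true  zero    = refl
ν-code false zero    = refl
ν-code s     (suc i) = cong 2+ (ν-code s i)

code-complementary : ∀ s i t j → code s i ≡ ν (code t j) → i ≡ j × s ≡ not t
code-complementary s i t j e =
    trans (sym (half-code s i)) (trans (cong ⌊_/2⌋ e) (trans (half-ν (code t j)) (half-code t j)))
  , trans (sym (sgn-code s i)) (trans (cong sgn e) (trans (sgn-ν (code t j)) (cong not (sgn-code t j))))

hasSign : Bool → Trit → Bool
hasSign true  pos = true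
hasSign false neg = true
hasSign _     _   = false

part : ∀ {n} → Bool → SignVec n → Subset n
part s = Vec.map (hasSign s)

weight : ∀ {n} → SignVec n → ℕ
weight []        = 0
weight (zer ∷ X) = weight X
weight (neg ∷ X) = suc (weight X)
weight (pos ∷ X) = suc (weight X)

weight≡ : ∀ {n} (X : SignVec n) → weight X ≡ ∣ part true X ∣ + ∣ part false X ∣
weight≡ []        = refl
weight≡ (zer ∷ X) = weight≡ X
weight≡ (neg ∷ X) = trans (cong suc (weight≡ X)) (sym (ℕ.+-suc _ _))
weight≡ (pos ∷ X) = cong suc (weight≡ X)

weight-− : ∀ {n} (X : SignVec n) → weight (− X) ≡ weight X
weight-− []        = refl
weight-− (zer ∷ X) = weight-− X
weight-− (neg ∷ X) = cong suc (weight-− X)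
weight-− (pos ∷ X) = cong suc (weight-− X)

weight-𝟎 : ∀ {n} (X : SignVec n) → X ≢ 𝟎 → 1 ≤ weight X
weight-𝟎 []        z = ⊥-elim (z refl)
weight-𝟎 (zer ∷ X) z = weight-𝟎 X (z ∘ cong (zer ∷_))
weight-𝟎 (neg ∷ X) z = s≤s z≤n
weight-𝟎 (pos ∷ X) z = s≤s z≤n

weight-mono : ∀ {n} {X Y : SignVec n} → X ⊑ Y → weight X ≤ weight Y
weight-mono [] = z≤n
weight-mono (_∷_ {x = zer} {y = zer} _ p) = weight-mono p
weight-mono (_∷_ {x = zer} {y = neg} _ p) = ℕ.m≤n⇒m≤1+n (weight-mono p)
weight-mono (_∷_ {x = zer} {y = pos} _ p) = ℕ.m≤n⇒m≤1+n (weight-mono p)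
weight-mono (_∷_ {x = neg} refl p) = s≤s (weight-mono p)
weight-mono (_∷_ {x = pos} refl p) = s≤s (weight-mono p)

weight-≡ : ∀ {n} {X Y : SignVec n} → X ⊑ Y → weight X ≡ weight Y → X ≡ Y
weight-≡ [] _ = refl
weight-≡ (_∷_ {x = zer} {y = zer} _ p) e = cong (zer ∷_) (weight-≡ p e)
weight-≡ (_∷_ {x = zer} {y = neg} _ p) e = ⊥-elim (ℕ.<⇒≢ (s≤s (weight-mono p)) e)
weight-≡ (_∷_ {x = zer} {y = pos} _ p) e = ⊥-elim (ℕ.<⇒≢ (s≤s (weight-mono p)) e)
weight-≡ (_∷_ {x = neg} refl p) e = cong (neg ∷_) (weight-≡ p (ℕ.suc-injective e))
weight-≡ (_∷_ {x = pos} refl p) e = cong (pos ∷_) (weight-≡ p (ℕ.suc-injective e))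

pred-injective⁺ : ∀ {a b} → 1 ≤ a → 1 ≤ b → pred a ≡ pred b → a ≡ b
pred-injective⁺ (s≤s _) (s≤s _) = cong suc

leading : ∀ {n} → SignVec n → Bool
leading []        = true
leading (zer ∷ X) = leading X
leading (neg ∷ X) = false
leading (pos ∷ X) = true

leading-− : ∀ {n} (X : SignVec n) → X ≢ 𝟎 → leading (− X) ≡ not (leading X)
leading-− []        z = ⊥-elim (z refl)
leading-− (zer ∷ X) z = leading-− X (z ∘ cong (zer ∷_))
leading-− (neg ∷ X) z = refl
leading-− (pos ∷ X) z = refl

part-− : ∀ {n} s (X : SignVec n) → part s (− X) ≡ part (not s) X
part-− s []              = refl
part-− true  (neg ∷ X) = cong (_ ∷_) (part-− true X)
part-− true  (zer ∷ X) = cong (_ ∷_) (part-− true X)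
part-− true  (pos ∷ X) = cong (_ ∷_) (part-− true X)
part-− false (neg ∷ X) = cong (_ ∷_) (part-− false X)
part-− false (zer ∷ X) = cong (_ ∷_) (part-− false X)
part-− false (pos ∷ X) = cong (_ ∷_) (part-− false X)

part-mono : ∀ {n} s {X Y : SignVec n} → X ⊑ Y → part s X ⊆ part s Y
part-mono true  (_∷_ {x = pos} refl p) here = here
part-mono false (_∷_ {x = neg} refl p) here = here
part-mono s (_ ∷ p) (there i) = there (part-mono s p i)

part-disjoint : ∀ {n} s (X : SignVec n) → part s X ⊆ ∁ (part (not s) X)
part-disjoint true  (pos ∷ X) here = here
part-disjoint false (neg ∷ X) here = here
part-disjoint s (_ ∷ X) (there i) = there (part-disjoint s X i)

subset-of-size : ∀ {n} (p : Subset n) k → k ≤ ∣ p ∣ → ∃[ F ] F ⊆ p × ∣ F ∣ ≡ k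
subset-of-size []            zero    _ = [] , (λ z → z) , refl
subset-of-size (outside ∷ p) k       h = let F , s , e = subset-of-size p k h in outside ∷ F , out⊆ s , e
subset-of-size (inside ∷ p)  zero    h = let F , s , e = subset-of-size p zero z≤n in outside ∷ F , out⊆ s , e
subset-of-size (inside ∷ p)  (suc k) (s≤s h) = let F , s , e = subset-of-size p k h in inside ∷ F , in⊆in s , cong suc e

∁-antitone : ∀ {n} {p q : Subset n} → p ⊆ q → ∁ q ⊆ ∁ p
∁-antitone p⊆q x∈∁q = Subset.x∉p⇒x∈∁p (x∈∁p⇒x∉p x∈∁q ∘ p⊆q)

-- Sign changes in words with blanks

alternation : List (Maybe Bool) → Maybe (Bool × ℕ)
alternation []              = nothing
alternation (nothing ∷ w) = alternation w
alternation (just s ∷ w) with alternation w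
... | nothing      = just (s , 0)
... | just (t , i) = if ⌊ s Bool.≟ t ⌋ then just (t , i) else just (s , suc i)

blocks : List (Maybe Bool) → ℕ
blocks w = maybe′ (suc ∘ proj₂) 0 (alternation w)

blocks-∷ : ∀ l w → blocks (l ∷ w) ≤ suc (blocks w)
blocks-∷ nothing  w = ℕ.n≤1+n _
blocks-∷ (just s) w with alternation w
... | nothing      = ≤-refl
... | just (t , i) with s Bool.≟ t
...   | yes _ = ℕ.n≤1+n _
...   | no _  = ≤-refl

blocks≤length : ∀ w → blocks w ≤ length w
blocks≤length []      = z≤n
blocks≤length (l ∷ w) = ≤-trans (blocks-∷ l w) (s≤s (blocks≤length w))

blank-tail : ∀ l w → alternation (l ∷ w) ≡ nothing → alternation w ≡ nothing
blank-tail nothing  w e = e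
blank-tail (just s) w e with alternation w
... | nothing = refl
... | just (t , i) with s Bool.≟ t
...   | yes _ with () ← e
...   | no _  with () ← e

just-nonblank : ∀ s w → alternation (just s ∷ w) ≢ nothing
just-nonblank s w e with alternation w
... | nothing with () ← e
... | just (t , i) with s Bool.≟ t
...   | yes _ with () ← e
...   | no _  with () ← e

alternation-not : ∀ w → alternation (map (Maybe.map not) w) ≡ Maybe.map (Product.map₁ not) (alternation w)
alternation-not []            = refl
alternation-not (nothing ∷ w) = alternation-not w
alternation-not (just s ∷ w) rewrite alternation-not w with alternation w
... | nothing      = refl
... | just (t , i) with s Bool.≟ t | not s Bool.≟ not t
...   | yes _ | yes _ = refl
...   | no _  | no _  = refl
...   | yes p | no ¬q = ⊥-elim (¬q (cong not p))
...   | no ¬p | yes q = ⊥-elim (¬p (Bool.not-injective q))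

data _≤ₗ_ : Maybe Bool → Maybe Bool → Set where
  blank : ∀ {l} → nothing ≤ₗ l
  same  : ∀ {l} → l ≤ₗ l

Refines : List (Maybe Bool) → List (Maybe Bool) → Set
Refines = List.Pointwise _≤ₗ_

data _≼ₐ_ : Maybe (Bool × ℕ) → Maybe (Bool × ℕ) → Set where
  empty : ∀ {b} → nothing ≼ₐ b
  fewer : ∀ {s t i j} → i < j → just (s , i) ≼ₐ just (t , j)
  same  : ∀ {a} → a ≼ₐ a

-- Filling blanks keeps all sign changes. If it reverses the first sign, a new letter stands in
-- front of the old first one and adds a change. This is what keeps the labels of comparable large
-- vectors from being complementary.
alternation-mono : ∀ {v w} → Refines v w → alternation v ≼ₐ alternation w
alternation-mono [] = same
alternation-mono (_∷_ {y = nothing} blank p) = alternation-mono p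
alternation-mono (_∷_ {y = just s} {xs = v} {ys = w} blank p) with alternation v | alternation w | alternation-mono p
... | nothing | _ | _ = empty
... | just a | just (t , j) | q with s Bool.≟ t
...   | yes _ = q
alternation-mono (_∷_ {y = just s} {xs = v} {ys = w} blank p) | just _ | just (t , j) | fewer i<j | no _ = fewer (ℕ.m≤n⇒m≤1+n i<j)
alternation-mono (_∷_ {y = just s} {xs = v} {ys = w} blank p) | just _ | just (t , j) | same | no _ = fewer ≤-refl
alternation-mono (_∷_ {x = nothing} same p) = alternation-mono p
alternation-mono (_∷_ {x = just s} {xs = v} {ys = w} same p) with alternation v | alternation w | alternation-mono p
... | a | .a | same = same
... | nothing | nothing | empty = same
... | nothing | just (t , j) | empty with s Bool.≟ t
...   | no _ = fewer (s≤s z≤n)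
...   | yes refl with j
...     | zero  = same
...     | suc _ = fewer (s≤s z≤n)
alternation-mono (_∷_ {x = just s} {xs = v} {ys = w} same p) | just (t , i) | just (u , j) | fewer i<j with s Bool.≟ t | s Bool.≟ u
... | yes _ | yes _ = fewer i<j
... | yes _ | no _  = fewer (ℕ.m≤n⇒m≤1+n i<j)
... | no _  | no _  = fewer (s≤s i<j)
... | no _  | yes refl with ℕ.m≤n⇒m<n∨m≡n i<j
...   | inj₁ l    = fewer l
...   | inj₂ refl = same

module Zigzag {n : ℕ} (k′ M : ℕ) (c : Subset n → ℕ)
  (c< : ∀ F → ∣ F ∣ ≡ suc k′ → c F < M)
  (proper : ∀ F G → ∣ F ∣ ≡ suc k′ → ∣ G ∣ ≡ suc k′ → F ⊆ ∁ G → c F ≢ c G) where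

  Has : SignVec n → Bool → ℕ → Set
  Has X s a = ∃[ F ] F ⊆ part s X × ∣ F ∣ ≡ suc k′ × c F ≡ a

  has? : ∀ X s a → Dec (Has X s a)
  has? X s a = anySubset? λ F → F ⊆? part s X ×-dec ∣ F ∣ ℕ.≟ suc k′ ×-dec c F ℕ.≟ a

  Has-mono : ∀ {X Y s a} → X ⊑ Y → Has X s a → Has Y s a
  Has-mono {s = s} p (F , F⊆ , e) = F , (λ x → part-mono s p (F⊆ x)) , e

  Has-− : ∀ {X s a} → Has X s a → Has (− X) (not s) a
  Has-− {X} {s} (F , F⊆ , e) = F , subst (F ⊆_) (sym (trans (part-− (not s) X) (cong (λ t → part t X) (not-involutive s)))) F⊆ , e

  -- A colour on both sides would belong to two disjoint k-sets, against properness. Hence each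
  -- letter has a single sign.
  Has-sign : ∀ {X s t a} → Has X s a → Has X t a → s ≡ t
  Has-sign {X} {s} {t} (F , F⊆ , ∣F∣ , refl) (G , G⊆ , ∣G∣ , e) with s Bool.≟ t
  ... | yes p = p
  ... | no s≢t = ⊥-elim (proper F G ∣F∣ ∣G∣ (λ x → ∁-antitone G⊆ (subst (λ r → part s X ⊆ ∁ (part r X)) (sym (¬-not (s≢t ∘ sym))) (part-disjoint s X) (F⊆ x))) (sym e))

  letter : SignVec n → ℕ → Maybe Bool
  letter X a with has? X true a | has? X false a
  ... | yes _ | _     = just true
  ... | no _  | yes _ = just false
  ... | no _  | no _  = nothing

  letter⁻ : ∀ X a {s} → letter X a ≡ just s → Has X s a
  letter⁻ X a e with has? X true a | has? X false a
  letter⁻ X a refl | yes h | _     = h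
  letter⁻ X a refl | no _  | yes h = h

  letter⁺ : ∀ X a {s} → Has X s a → letter X a ≡ just s
  letter⁺ X a {s} h with has? X true a | has? X false a
  ... | yes h′ | _      = cong just (Has-sign h′ h)
  ... | no _   | yes h′ = cong just (Has-sign h′ h)
  letter⁺ X a {true}  h | no ¬h | no _  = ⊥-elim (¬h h)
  letter⁺ X a {false} h | no _  | no ¬h = ⊥-elim (¬h h)

  word : ℕ → SignVec n → List (Maybe Bool)
  word zero    X = []
  word (suc b) X = letter X b ∷ word b X

  word-refines : ∀ b {X Y} → X ⊑ Y → Refines (word b X) (word b Y)
  word-refines zero    p = []
  word-refines (suc b) {X} {Y} p with letter X b in e
  ... | nothing = blank ∷ word-refines b p
  ... | just s  = subst (λ l → just s ≤ₗ l) (sym (letter⁺ Y b (Has-mono p (letter⁻ X b e)))) same ∷ word-refines b p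

  word-− : ∀ b X → word b (− X) ≡ map (Maybe.map not) (word b X)
  word-− zero    X = refl
  word-− (suc b) X = cong₂ _∷_ letter-− (word-− b X)
    where
    letter-− : letter (− X) b ≡ Maybe.map not (letter X b)
    letter-− with letter X b in e
    ... | just s  = letter⁺ (− X) b (Has-− (letter⁻ X b e))
    ... | nothing with letter (− X) b in e′
    ...   | nothing = refl
    ...   | just t with trans (sym e) (letter⁺ X b (subst (λ Y → Has Y (not t) b) (−-involutive X) (Has-− (letter⁻ (− X) b e′))))
    ...     | ()

  word-nonblank : ∀ b X {s a} → a < b → Has X s a → alternation (word b X) ≢ nothing
  word-nonblank (suc b) X {s} {a} a<b h e with ℕ.m≤n⇒m<n∨m≡n (s≤s⁻¹ a<b)
  ... | inj₁ a<b′ = word-nonblank b X a<b′ h (blank-tail (letter X b) (word b X) e)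
  ... | inj₂ refl rewrite letter⁺ X a h = just-nonblank s (word b X) e

  -- With k = k′ + 1, more than 2k - 2 signs put at least k of them on one side.
  found : ∀ X → k′ + k′ < weight X → ∃[ s ] ∃[ a ] a < M × Has X s a
  found X l = split (ℕ.≤-total (suc k′) ∣ part true X ∣)
    where
    witness : ∀ s → suc k′ ≤ ∣ part s X ∣ → ∃[ s ] ∃[ a ] a < M × Has X s a
    witness s q = let F , F⊆ , e = subset-of-size (part s X) (suc k′) q in s , c F , c< F e , F , F⊆ , e , refl
    split : _ ⊎ _ → _
    split (inj₁ q) = witness true q
    split (inj₂ q) with ℕ.m≤n⇒m<n∨m≡n q
    ... | inj₂ e = witness true (ℕ.≤-reflexive (sym e))
    ... | inj₁ (s≤s q′) = witness false (ℕ.+-cancelˡ-≤ k′ _ _ (≤-trans (≤-trans (ℕ.≤-reflexive (ℕ.+-suc k′ k′)) l)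
             (≤-trans (ℕ.≤-reflexive (weight≡ X)) (ℕ.+-monoˡ-≤ _ q′))))

  module _ (L : ℕ) (few : ∀ X → blocks (word M X) ≤ L) where

    large? : ∀ (X : SignVec n) → Dec (k′ + k′ < weight X)
    large? X = k′ + k′ ℕ.<? weight X

    large-alternation : ∀ X → k′ + k′ < weight X → ∃[ a ] alternation (word M X) ≡ just a
    large-alternation X l with alternation (word M X) in e
    ... | just a  = a , refl
    ... | nothing = let _ , _ , a<M , h = found X l in ⊥-elim (word-nonblank M X a<M h e)

    -- Small sign vectors use up 2k − 2 absolute values; a large one is labelled by the number
    -- of sign changes in its word, which can only grow with the sign vector.
    label′ : ∀ (X : SignVec n) → Dec (k′ + k′ < weight X) → Bool × ℕ
    label′ X (yes l) = let (s , i) , _ = large-alternation X l in s , k′ + k′ + i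
    label′ X (no _)  = leading X , pred (weight X)

    signedLabel : SignVec n → Bool × ℕ
    signedLabel X = label′ X (large? X)

    label : SignVec n → ℕ
    label X = let s , i = signedLabel X in code s i

    pred< : ∀ (X : SignVec n) → X ≢ 𝟎 → ¬ (k′ + k′ < weight X) → pred (weight X) < k′ + k′
    pred< X z l with weight X | weight-𝟎 X z
    ... | suc w | _ = ℕ.≮⇒≥ l

    antipodal′ : ∀ X → X ≢ 𝟎 → ∀ d d′ → let s , i = label′ X d in label′ (− X) d′ ≡ (not s , i)
    antipodal′ X z (yes p) (yes q) with large-alternation X p | large-alternation (− X) q
    ... | (s , i) , e | (t , j) , e′ with trans (sym e′) (trans (cong alternation (word-− M X)) (trans (alternation-not (word M X)) (cong (Maybe.map (Product.map₁ not)) e)))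
    ...   | refl = refl
    antipodal′ X z (no p) (no q) = cong₂ _,_ (leading-− X z) (cong pred (weight-− X))
    antipodal′ X z (yes p) (no q) = ⊥-elim (q (subst (k′ + k′ <_) (sym (weight-− X)) p))
    antipodal′ X z (no p) (yes q) = ⊥-elim (p (subst (k′ + k′ <_) (weight-− X) q))

    bounded′ : ∀ X → X ≢ 𝟎 → ∀ d → proj₂ (label′ X d) < k′ + k′ + L
    bounded′ X z (yes p) with large-alternation X p
    ... | (s , i) , e = ℕ.+-monoʳ-< (k′ + k′) (subst (_≤ L) (cong (maybe′ (suc ∘ proj₂) 0) e) (few X))
    bounded′ X z (no p)  = ℕ.≤-trans (pred< X z p) (ℕ.m≤m+n _ L)

    -- Let the absolute values agree. Two small vectors then have the same weight and coincide; a
    -- small and a large one use disjoint ranges of values; for two large ones `alternation-mono`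
    -- forces equal signs.
    noncompl′ : ∀ X Y → X ≢ 𝟎 → X ⊑ Y → ∀ d d′ → let s , i = label′ X d ; t , j = label′ Y d′ in i ≡ j → s ≢ not t
    noncompl′ X Y z p (yes l) (yes l′) e s≡ with large-alternation X l | large-alternation Y l′
    ... | (s , i) , e₁ | (t , j) , e₂ with subst₂ _≼ₐ_ e₁ e₂ (alternation-mono (word-refines M p))
    ...   | fewer i<j = ℕ.<⇒≢ i<j (ℕ.+-cancelˡ-≡ (k′ + k′) _ _ e)
    ...   | same      = not-¬ refl s≡
    noncompl′ X Y z p (no l) (no l′) e s≡ with weight-≡ p (pred-injective⁺ (weight-𝟎 X z) (≤-trans (weight-𝟎 X z) (weight-mono p)) e)
    ... | refl = not-¬ refl s≡
    noncompl′ X Y z p (yes l) (no l′) e _ = l′ (≤-trans l (weight-mono p))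
    noncompl′ X Y z p (no l) (yes l′) e _ = ℕ.<⇒≱ (pred< X z l) (≤-trans (ℕ.m≤m+n _ _) (ℕ.≤-reflexive (sym e)))

    -- Contrapositively, some sign vector has a word with at least n - 2k + 2 blocks, k = k′ + 1.
    -- This is the zig-zag theorem of Simonyi and Tardos.
    zigzag : n ≤ k′ + k′ + L
    zigzag = tucker {ℓ = label} record
      { antipodal = λ X z → trans (cong (λ (s , i) → code s i) (antipodal′ X z (large? X) (large? (− X)))) (sym (ν-code (proj₁ (signedLabel X)) (proj₂ (signedLabel X))))
      ; bounded = λ X z → subst (_< k′ + k′ + L) (sym (half-code (proj₁ (signedLabel X)) _)) (bounded′ X z (large? X))
      ; noncomplementary = λ {X} {Y} z p e → let i≡j , s≡ = code-complementary (proj₁ (signedLabel X)) (proj₂ (signedLabel X)) (proj₁ (signedLabel Y)) (proj₂ (signedLabel Y)) e in noncompl′ X Y z p (large? X) (large? Y) i≡j s≡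
      }

word-length : ∀ {n k′ M c} (c< : ∀ F → ∣ F ∣ ≡ suc k′ → c F < M) proper b X → length (Zigzag.word {n} k′ M c c< proper b X) ≡ b
word-length c< p zero    X = refl
word-length c< p (suc b) X = cong suc (word-length c< p b X)

-- Without such a pair the colouring is proper, so the bound on blocks may presuppose properness.
-- The form `suc (pred k)` is the set size for which `Zigzag` is stated.
zigzag-bound : ∀ {n} k M L (c : Subset n → ℕ) → 1 ≤ k → L + 2 * k ≤ n + 1 →
  ((c< : ∀ F → ∣ F ∣ ≡ suc (pred k) → c F < M)
   (proper : ∀ F G → ∣ F ∣ ≡ suc (pred k) → ∣ G ∣ ≡ suc (pred k) → F ⊆ ∁ G → c F ≢ c G) →
   ∀ X → blocks (Zigzag.word (pred k) M c c< proper M X) ≤ L) →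
  (∀ F → ∣ F ∣ ≡ k → c F < M) →
  ∃[ F ] ∃[ G ] ∣ F ∣ ≡ k × ∣ G ∣ ≡ k × F ⊆ ∁ G × c F ≡ c G
zigzag-bound {n} (suc k′) M L c _ le few c< = decidable-stable
  (anySubset? λ F → anySubset? λ G → ∣ F ∣ ℕ.≟ suc k′ ×-dec ∣ G ∣ ℕ.≟ suc k′ ×-dec F ⊆? ∁ G ×-dec c F ℕ.≟ c G)
  λ none → let proper = proper′ none in ℕ.<⇒≱ bound (Zigzag.zigzag k′ M c c< proper L (few c< proper))
  where
  proper′ : ¬ (∃[ F ] ∃[ G ] ∣ F ∣ ≡ suc k′ × ∣ G ∣ ≡ suc k′ × F ⊆ ∁ G × c F ≡ c G) →
            ∀ F G → ∣ F ∣ ≡ suc k′ → ∣ G ∣ ≡ suc k′ → F ⊆ ∁ G → c F ≢ c G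
  proper′ none F G ∣F∣ ∣G∣ s e = none (F , G , ∣F∣ , ∣G∣ , s , e)
  bound : k′ + k′ + L < n
  bound = s≤s⁻¹ (subst₂ _≤_ (solve 2 (λ L k → L :+ con 2 :* (con 1 :+ k) := con 2 :+ (k :+ k :+ L)) refl L k′) (ℕ.+-comm n 1) le)
    where open +-*-Solver

kneser : ∀ {n} k M (c : Subset n → ℕ) → 1 ≤ k → M + 2 * k ≤ n + 1 → (∀ F → ∣ F ∣ ≡ k → c F < M) →
  ∃[ F ] ∃[ G ] ∣ F ∣ ≡ k × ∣ G ∣ ≡ k × F ⊆ ∁ G × c F ≡ c G
kneser k M c 1≤k le = zigzag-bound k M M c 1≤k le
  λ c< proper X → ≤-trans (blocks≤length (Zigzag.word (pred k) M c c< proper M X)) (ℕ.≤-reflexive (word-length c< proper M X))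

-- Subsets as lists without repetition

elements : ∀ {n} → Subset n → List (Fin n)
elements []            = []
elements (inside ∷ p)  = zero ∷ map suc (elements p)
elements (outside ∷ p) = map suc (elements p)

length-elements : ∀ {n} (p : Subset n) → length (elements p) ≡ ∣ p ∣
length-elements []            = refl
length-elements (inside ∷ p)  = cong suc (trans (length-map Fin.suc (elements p)) (length-elements p))
length-elements (outside ∷ p) = trans (length-map Fin.suc (elements p)) (length-elements p)

unique-elements : ∀ {n} (p : Subset n) → Unique (elements p)
unique-elements []            = []
unique-elements (inside ∷ p)  = All.map⁺ (All.universal (λ _ ()) _) ∷ Unique.map⁺ suc-injective (unique-elements p)
unique-elements (outside ∷ p) = Unique.map⁺ suc-injective (unique-elements p)

∈-elements⁻ : ∀ {n} (p : Subset n) {x} → x ∈ elements p → x ∈ₛ p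
∈-elements⁻ (inside ∷ p)  (here refl) = here
∈-elements⁻ (inside ∷ p)  (there i) with ∈-map⁻ suc i
... | _ , j , refl = there (∈-elements⁻ p j)
∈-elements⁻ (outside ∷ p) i with ∈-map⁻ suc i
... | _ , j , refl = there (∈-elements⁻ p j)

kneser-lists : ∀ {V : Set} {n} (f : Fin n → V) → (∀ {i j} → f i ≡ f j → i ≡ j) →
  ∀ k M (c : List V → ℕ) → 1 ≤ k → M + 2 * k ≤ n + 1 → (∀ A → length A ≡ k → c A < M) →
  ∃[ A ] ∃[ B ] length A ≡ k × length B ≡ k × Unique (A ++ B) × c A ≡ c B
kneser-lists f inj k M c 1≤k le c< =
  let F , G , ∣F∣ , ∣G∣ , F⊆∁G , e = kneser k M (c ∘ tuple) 1≤k le (λ F e → c< _ (length-tuple F e))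
  in tuple F , tuple G , length-tuple F ∣F∣ , length-tuple G ∣G∣
   , subst Unique (map-++ f (elements F) (elements G)) (Unique.map⁺ inj
       (Unique.++⁺ (unique-elements F) (unique-elements G) λ (i , j) → x∈∁p⇒x∉p (F⊆∁G (∈-elements⁻ F i)) (∈-elements⁻ G j)))
   , e
  where
  tuple : Subset _ → List _
  tuple F = map f (elements F)
  length-tuple : ∀ F → ∣ F ∣ ≡ k → length (tuple F) ≡ k
  length-tuple F e = trans (length-map f (elements F)) (trans (length-elements F) e)

-- Distances and homometric pairs

pairsOf : List A → List (A × A)
pairsOf []       = []
pairsOf (x ∷ xs) = map (x ,_) xs ++ pairsOf xs

pairsOf-map : (f : A → B) (xs : List A) → pairsOf (map f xs) ≡ map (λ (x , y) → f x , f y) (pairsOf xs)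
pairsOf-map f []       = refl
pairsOf-map f (x ∷ xs) = trans (cong₂ _++_ (trans (sym (map-∘ xs)) (map-∘ xs)) (pairsOf-map f xs))
  (sym (map-++ _ (map (x ,_) xs) (pairsOf xs)))

All-pairsOf : ∀ {R : A → A → Set} {xs} → AllPairs R xs → All (uncurry R) (pairsOf xs)
All-pairsOf []       = []
All-pairsOf (p ∷ ps) = All.++⁺ (All.map⁺ p) (All-pairsOf ps)

∈-pairsOf₁ : ∀ {x y} (xs : List A) → (x , y) ∈ pairsOf xs → x ∈ xs
∈-pairsOf₁ (z ∷ xs) i with ∈-++⁻ (map (z ,_) xs) i
... | inj₁ j with ∈-map⁻ (z ,_) j
...   | _ , _ , refl = here refl
∈-pairsOf₁ (z ∷ xs) i | inj₂ j = there (∈-pairsOf₁ xs j)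

Unique-pairsOf : ∀ {xs : List A} → Unique xs → Unique (pairsOf xs)
Unique-pairsOf []       = []
Unique-pairsOf {xs = x ∷ xs} (x∉ ∷ u) = Unique.++⁺ (Unique.map⁺ (cong proj₂) u) (Unique-pairsOf u) disjoint
  where
  disjoint : ∀ {p} → ¬ (p ∈ map (x ,_) xs × p ∈ pairsOf xs)
  disjoint (i , j) with ∈-map⁻ (x ,_) i
  ... | _ , _ , refl = All.lookup x∉ (∈-pairsOf₁ xs j) refl

pairsOf-tabulate : ∀ {h} (f : Fin h → A) {i j} → i Fin.< j → (f i , f j) ∈ pairsOf (tabulate f)
pairsOf-tabulate {h = suc h} f {zero}  {suc j} _         = ∈-++⁺ˡ (∈-map⁺ (f zero ,_) (∈-tabulate⁺ j))
pairsOf-tabulate {h = suc h} f {suc i} {suc j} (s≤s i<j) = ∈-++⁺ʳ (map (f zero ,_) (tabulate (f ∘ suc))) (pairsOf-tabulate (f ∘ suc) i<j)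

lookup-injective : ∀ {xs : List A} → Unique xs → ∀ i j → lookup xs i ≡ lookup xs j → i ≡ j
lookup-injective (_ ∷ u) zero    zero    e = refl
lookup-injective (x ∷ u) zero    (suc j) e = ⊥-elim (All.lookup x (∈-lookup j) e)
lookup-injective (x ∷ u) (suc i) zero    e = ⊥-elim (All.lookup x (∈-lookup i) (sym e))
lookup-injective (_ ∷ u) (suc i) (suc j) e = cong suc (lookup-injective u i j e)

lookup-map : (f : A → B) (xs : List A) (i : Fin (length (map f xs))) →
  lookup (map f xs) i ≡ f (lookup xs (Fin.cast (length-map f xs) i))
lookup-map f (x ∷ xs) zero    = refl
lookup-map f (x ∷ xs) (suc i) = lookup-map f xs i

Unique-++⁻ : (xs : List A) {ys : List A} → Unique (xs ++ ys) → Unique xs × Unique ys × All (λ x → All (x ≢_) ys) xs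
Unique-++⁻ []       u       = [] , u , []
Unique-++⁻ (x ∷ xs) (p ∷ u) = let v , w , d = Unique-++⁻ xs u ; q , r = All.++⁻ xs p in q ∷ v , w , r ∷ d

least : {P : ℕ → Set} → (∀ m → Dec (P m)) → ∀ {t} → P t → ∃[ m ] P m × (∀ j → j < m → ¬ P j)
least {P} P? {t} p = go 0 t (λ _ ()) p
  where
  go : ∀ s r → (∀ j → j < s → ¬ P j) → P (s + r) → ∃[ m ] P m × (∀ j → j < m → ¬ P j)
  go s zero    below p = s , subst P (ℕ.+-identityʳ s) p , below
  go s (suc r) below p with P? s
  ... | yes q = s , q , below
  ... | no ¬q = go (suc s) r below′ (subst P (ℕ.+-suc s r) p)
    where
    below′ : ∀ j → j < suc s → ¬ P j
    below′ j j<1+s with ℕ.m≤n⇒m<n∨m≡n (s≤s⁻¹ j<1+s)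
    ... | inj₁ j<s  = below j j<s
    ... | inj₂ refl = ¬q

module _ {n} (G : Graph n) where

  pairList : ∀ h → List (Fin h × Fin h)
  pairList h = pairsOf (allFin h)

  pairList-< : ∀ h → All (uncurry Fin._<_) (pairList h)
  pairList-< h = All-pairsOf (increasing id λ i<j → i<j)
    where
    increasing : ∀ {m} (f : Fin m → Fin h) → (∀ {i j} → i Fin.< j → f i Fin.< f j) → AllPairs Fin._<_ (tabulate f)
    increasing {zero}  f mono = []
    increasing {suc m} f mono = All.tabulate⁺ (λ i → mono z<s) ∷ increasing (f ∘ suc) (mono ∘ s<s)

  -- A permutation of distance lists is a bijection of positions; this carries it over to pairs.
  Pair↔Fin : ∀ h → Pair G h ↔ Fin (length (pairList h))
  Pair↔Fin h = mk↔ₛ′ to from to∘from from∘to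
    where
    to : Pair G h → Fin (length (pairList h))
    to (_ , i<j) = index (pairsOf-tabulate id i<j)
    from : Fin (length (pairList h)) → Pair G h
    from k = lookup (pairList h) k , All.lookup (pairList-< h) (∈-lookup k)
    to∘from : ∀ k → to (from k) ≡ k
    to∘from k = lookup-injective (Unique-pairsOf (Unique.allFin⁺ h)) _ k (sym (lookup-index (pairsOf-tabulate id (proj₂ (from k)))))
    pair-≡ : {p q : Pair G h} → proj₁ p ≡ proj₁ q → p ≡ q
    pair-≡ {_ , r} {_ , s} refl = cong (_ ,_) (ℕ.≤-irrelevant r s)
    from∘to : ∀ p → from (to p) ≡ p
    from∘to (_ , i<j) = pair-≡ (sym (lookup-index (pairsOf-tabulate id i<j)))

  walk? : ∀ m u v → Dec (Walk G u v m)
  walk? zero    u v = map′ (λ { refl → here }) (λ { here → refl }) (u Fin.≟ v)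
  walk? (suc m) u v = map′ (λ (w , a , p) → step a p) (λ { (step {v = w} a p) → w , a , p })
    (any? λ w → adj G u w Bool.≟ true ×-dec walk? m w v)

  Dist-unique : ∀ {u v s t} → Dist G u v s → Dist G u v t → s ≡ t
  Dist-unique {s = s} {t} (p , m) (q , m′) with ℕ.<-cmp s t
  ... | tri< s<t _ _ = ⊥-elim (m′ s s<t p)
  ... | tri≈ _ e _ = e
  ... | tri> _ _ t<s = ⊥-elim (m t t<s q)

  module Metric (connected : Connected G) where

    private
      distance : ∀ u v → ∃ (Dist G u v)
      distance u v = let t , p = connected u v in least (λ m → walk? m u v) p

    dist : Fin n → Fin n → ℕ
    dist u v = proj₁ (distance u v)

    isDist : ∀ u v → Dist G u v (dist u v)
    isDist u v = proj₂ (distance u v)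

    dist-unique : ∀ {u v t} → Dist G u v t → t ≡ dist u v
    dist-unique D = Dist-unique D (isDist _ _)

    distances : List (Fin n) → List ℕ
    distances A = map (uncurry dist) (pairsOf A)

    private
      distances-tabulate : ∀ {h} (S : Fin h → Fin n) → distances (tabulate S) ≡ map (λ (i , j) → dist (S i) (S j)) (pairList h)
      distances-tabulate {h} S = trans (cong (map (uncurry dist))
          (trans (cong pairsOf (sym (map-tabulate id S))) (pairsOf-map S (allFin h))))
        (sym (map-∘ (pairList h)))

      module _ {h} (S₁ S₂ : Fin h → Fin n) (perm : distances (tabulate S₁) ↭ distances (tabulate S₂)) where

        f g : Fin h × Fin h → ℕ
        f (i , j) = dist (S₁ i) (S₁ j)
        g (i , j) = dist (S₂ i) (S₂ j)

        perm′ : map f (pairList h) ↭ map g (pairList h)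
        perm′ = ↭-trans (↭-reflexive (sym (distances-tabulate S₁))) (↭-trans perm (↭-reflexive (distances-tabulate S₂)))

        onIndices = Homogeneous.onIndices (↭⇒↭ₛ perm′)

        cast₁ = cast-id (length-map f (pairList h))
        cast₂ = cast-id (length-map g (pairList h))

        bijection : Pair G h ↔ Pair G h
        bijection = ↔-sym (Pair↔Fin h) ↔-∘ (cast₂ ↔-∘ (onIndices ↔-∘ (↔-sym cast₁ ↔-∘ Pair↔Fin h)))

        preserves : ∀ p → f (proj₁ p) ≡ g (proj₁ (Inverse.to bijection p))
        preserves p = begin
          f (proj₁ p)                       ≡⟨ cong (f ∘ proj₁) (sym (Inverse.strictlyInverseʳ (Pair↔Fin h) p)) ⟩
          f (lookup (pairList h) k)         ≡⟨ cong (f ∘ lookup (pairList h)) (sym (Inverse.strictlyInverseˡ cast₁ k)) ⟩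
          f (lookup (pairList h) (Inverse.to cast₁ k₁)) ≡⟨ sym (lookup-map f (pairList h) k₁) ⟩
          lookup (map f (pairList h)) k₁    ≡⟨ SetoidPerm.onIndices-lookup (setoid ℕ) (↭⇒↭ₛ perm′) k₁ ⟩
          lookup (map g (pairList h)) (Inverse.to onIndices k₁) ≡⟨ lookup-map g (pairList h) _ ⟩
          g (proj₁ (Inverse.to bijection p)) ∎
          where
          open ≡-Reasoning
          k = Inverse.to (Pair↔Fin h) p
          k₁ = Inverse.from cast₁ k

        homometric : Homometric G S₁ S₂
        homometric = bijection , λ p t → mk⇔
          (λ D → subst (Dist G _ _) (sym (trans (dist-unique D) (preserves p))) (isDist _ _))
          (λ D → subst (Dist G _ _) (sym (trans (dist-unique D) (sym (preserves p)))) (isDist _ _))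

      asTabulate : ∀ {h} (A : List (Fin n)) → length A ≡ h → ∃[ S ] A ≡ tabulate {n = h} S
      asTabulate A refl = lookup A , sym (tabulate-lookup A)

      tabulate-injective : ∀ {h} (S : Fin h → Fin n) → Unique (tabulate S) → ∀ {i j} → S i ≡ S j → i ≡ j
      tabulate-injective S u          {zero}  {zero}  e = refl
      tabulate-injective S (x ∷ _) {zero}  {suc j} e = ⊥-elim (All.lookup x (∈-tabulate⁺ j) e)
      tabulate-injective S (x ∷ _) {suc i} {zero}  e = ⊥-elim (All.lookup x (∈-tabulate⁺ i) (sym e))
      tabulate-injective S (_ ∷ u) {suc i} {suc j} e = cong suc (tabulate-injective (S ∘ suc) u e)

    homPair : ∀ {h} (A B : List (Fin n)) → length A ≡ h → length B ≡ h → Unique (A ++ B) →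
              distances A ↭ distances B → HasHomPair G h
    homPair A B ∣A∣ ∣B∣ u p with asTabulate A ∣A∣ | asTabulate B ∣B∣
    ... | S₁ , refl | S₂ , refl =
      let u₁ , u₂ , d = Unique-++⁻ (tabulate S₁) u
      in S₁ , S₂ , tabulate-injective S₁ u₁ , tabulate-injective S₂ u₂
       , (λ i j → All.lookup (All.lookup d (∈-tabulate⁺ i)) (∈-tabulate⁺ j))
       , homometric S₁ S₂ p

-- Distance multisets as colours

length-pairsOf : ∀ {A : Set} (xs : List A) → length (pairsOf xs) ≡ length xs C 2
length-pairsOf []       = refl
length-pairsOf (x ∷ xs) = begin
  length (map (x ,_) xs ++ pairsOf xs)        ≡⟨ length-++ (map (x ,_) xs) ⟩
  length (map (x ,_) xs) + length (pairsOf xs) ≡⟨ cong₂ _+_ (length-map _ xs) (length-pairsOf xs) ⟩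
  length xs + length xs C 2                   ≡⟨ cong (_+ length xs C 2) (nC1≡n (length xs)) ⟨
  length xs C 1 + length xs C 2               ≡⟨ nCk+nC[k+1]≡[n+1]C[k+1] (length xs) 1 ⟩
  suc (length xs) C 2                         ∎
  where open ≡-Reasoning

-- One representative for each multiset of `N` numbers from 0 to `D`. The last clause branches on
-- whether `suc D` occurs, which is Pascal's rule for their number.
multisets : ℕ → ℕ → List (List ℕ)
multisets N       zero    = replicate N 0 ∷ []
multisets zero    (suc D) = [] ∷ []
multisets (suc N) (suc D) = map (suc D ∷_) (multisets N (suc D)) ++ multisets (suc N) D

length-multisets : ∀ N D → length (multisets N D) ≡ (N + D) C D
length-multisets N       zero    = refl
length-multisets zero    (suc D) = sym (nCn≡1 (suc D))
length-multisets (suc N) (suc D) = begin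
  length (map (suc D ∷_) (multisets N (suc D)) ++ multisets (suc N) D) ≡⟨ length-++ (map (suc D ∷_) (multisets N (suc D))) ⟩
  _ + length (multisets (suc N) D)               ≡⟨ cong₂ _+_ (trans (length-map _ (multisets N (suc D))) (length-multisets N (suc D))) (length-multisets (suc N) D) ⟩
  (N + suc D) C suc D + suc (N + D) C D          ≡⟨ cong (λ m → (N + suc D) C suc D + m C D) (ℕ.+-suc N D) ⟨
  (N + suc D) C suc D + (N + suc D) C D          ≡⟨ ℕ.+-comm ((N + suc D) C suc D) _ ⟩
  (N + suc D) C D + (N + suc D) C suc D          ≡⟨ nCk+nC[k+1]≡[n+1]C[k+1] (N + suc D) D ⟩
  suc (N + suc D) C suc D                        ∎
  where open ≡-Reasoning

multisets-complete : ∀ N D w → length w ≡ N → All (_≤ D) w → Any (w ↭_) (multisets N D)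
multisets-complete N zero w refl w≤ = here (↭-reflexive (zeros w≤))
  where
  zeros : ∀ {w} → All (_≤ 0) w → w ≡ replicate (length w) 0
  zeros []        = refl
  zeros (z≤n ∷ p) = cong (0 ∷_) (zeros p)
multisets-complete zero    (suc D) [] refl w≤ = here ↭-refl
multisets-complete (suc N) (suc D) w e w≤ with DecMembership._∈?_ ℕ._≟_ (suc D) w
... | yes i = let xs , ys , w≡ = ∈-∃++ i
                  w↭ = ↭-trans (↭-reflexive w≡) (shift (suc D) xs ys)
              in Any.++⁺ˡ (Any.map⁺ (Any.map (λ p → ↭-trans w↭ (prep (suc D) p))
                   (multisets-complete N (suc D) (xs ++ ys) (ℕ.suc-injective (trans (sym (↭-length w↭)) e)) (All.tail (All-resp-↭ w↭ w≤)))))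
... | no ∉w = Any.++⁺ʳ _ (multisets-complete (suc N) D w e (smaller w≤ ∉w))
  where
  smaller : ∀ {w} → All (_≤ suc D) w → suc D ∉ w → All (_≤ D) w
  smaller []       _  = []
  smaller (p ∷ ps) ∉w = s≤s⁻¹ (ℕ.≤∧≢⇒< p (λ e → ∉w (here (sym e)))) ∷ smaller ps (∉w ∘ there)

module Multiset (D : ℕ) where

  word-rank : ∀ N w → length w ≡ N → All (_≤ D) w → ℕ
  word-rank N w e w≤ = toℕ (index (multisets-complete N D w e w≤))

  word-rank< : ∀ N w e w≤ → word-rank N w e w≤ < (N + D) C D
  word-rank< N w e w≤ = subst (word-rank N w e w≤ <_) (length-multisets N D) (toℕ<n (index (multisets-complete N D w e w≤)))

  word-rank≡⇒↭ : ∀ N {w w′ e e′ w≤ w′≤} → word-rank N w e w≤ ≡ word-rank N w′ e′ w′≤ → w ↭ w′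
  word-rank≡⇒↭ N {w} {w′} {e} {e′} {w≤} {w′≤} r = ↭-trans (lookup-index (multisets-complete N D w e w≤))
    (↭-trans (↭-reflexive (cong (lookup (multisets N D)) (toℕ-injective r)))
             (↭-sym (lookup-index (multisets-complete N D w′ e′ w′≤))))

module _ {n} (G : Graph n) (connected : Connected G) where
  open Metric G connected

  dist≢0 : ∀ {u v} → u ≢ v → 1 ≤ dist u v
  dist≢0 {u} {v} u≢v with dist u v | isDist u v
  ... | zero  | here , _ = ⊥-elim (u≢v refl)
  ... | suc _ | _        = s≤s z≤n

  -- Distances between distinct vertices lie between 1 and `suc D`. Lowered by one they form a
  -- multiset of `k C 2` numbers up to `D`, and the binomial coefficient counts these colours.
  homPair-pigeonhole : ∀ D k → (∀ u v t → Dist G u v t → t ≤ suc D) → 1 ≤ k →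
    ((k C 2) + D) C D + 2 * k < n + 2 → HasHomPair G k
  homPair-pigeonhole D k diam 1≤k le =
    let A , B , ∣A∣ , ∣B∣ , u , e = kneser-lists id id k M colour 1≤k
          (s≤s⁻¹ (subst (M + 2 * k <_) (trans (ℕ.+-suc n 1) refl) le)) colour<
        uA , uB , _ = Unique-++⁻ A u
    in homPair A B ∣A∣ ∣B∣ u (↭-trans (↭-reflexive (suc-word uA))
         (↭-trans (map⁺ suc (same-colour A B ∣A∣ ∣B∣ e)) (↭-reflexive (sym (suc-word uB)))))
    where
    open Multiset D
    M = ((k C 2) + D) C D
    word : List (Fin n) → List ℕ
    word A = map pred (distances A)
    word≤ : ∀ A → All (_≤ D) (word A)
    word≤ A = All.map⁺ (All.map⁺ (All.universal (λ (u , v) → ℕ.pred-mono-≤ (diam u v _ (isDist u v))) (pairsOf A)))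
    length-word : ∀ A → length A ≡ k → length (word A) ≡ k C 2
    length-word A e = trans (length-map pred (distances A)) (trans (length-map (uncurry dist) (pairsOf A)) (trans (length-pairsOf A) (cong (_C 2) e)))
    -- A colour is required for lists of every length, so the size is read off the word;
    -- `colour-rank` later replaces it by `k C 2`.
    colour : List (Fin n) → ℕ
    colour A = word-rank (length (word A)) (word A) refl (word≤ A)
    colour-rank : ∀ A {N} (e : length (word A) ≡ N) → colour A ≡ word-rank N (word A) e (word≤ A)
    colour-rank A refl = refl
    colour< : ∀ A → length A ≡ k → colour A < M
    colour< A e = subst (_< M) (sym (colour-rank A (length-word A e))) (word-rank< _ _ _ _)
    same-colour : ∀ A B → length A ≡ k → length B ≡ k → colour A ≡ colour B → word A ↭ word B
    same-colour A B ∣A∣ ∣B∣ e = word-rank≡⇒↭ (k C 2) (trans (sym (colour-rank A (length-word A ∣A∣))) (trans e (colour-rank B (length-word B ∣B∣))))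
    suc-word : ∀ {A} → Unique A → distances A ≡ map suc (word A)
    suc-word {A} u = sym (trans (sym (map-∘ (distances A))) (map-id-local (All.map⁺ (All.map (λ {p} p≢ → ℕ.suc-pred _ {{>-nonZero (dist≢0 p≢)}}) (All-pairsOf u)))))

  -- Halves of a geodesic

  module Geodesic {u v d} (p : Walk G u v d) (shortest : ∀ m → m < d → ¬ Walk G u v m) where

    private
      concat : ∀ {x y z s t} → Walk G x y s → Walk G y z t → Walk G x z (s + t)
      concat here       q = q
      concat (step a p) q = step a (concat p q)

    vertex : ∀ {u t} → Walk G u v t → ℕ → Fin n
    vertex {u} p          zero    = u
    vertex {u} here       (suc i) = u
    vertex     (step a p) (suc i) = vertex p i

    before : ∀ {u t} (p : Walk G u v t) {i} → i ≤ t → Walk G u (vertex p i) i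
    before p          {zero}  _         = here
    before (step a p) {suc i} (s≤s i≤t) = step a (before p i≤t)

    after : ∀ {u t} (p : Walk G u v t) {i} → i ≤ t → Walk G (vertex p i) v (t ∸ i)
    after p          {zero}  _         = p
    after (step a p) {suc i} (s≤s i≤t) = after p i≤t

    between : ∀ {u t} (p : Walk G u v t) {i j} → i ≤ j → j ≤ t → Walk G (vertex p i) (vertex p j) (j ∸ i)
    between p          {zero}          _         j≤t       = before p j≤t
    between (step a p) {suc i} {suc j} (s≤s i≤j) (s≤s j≤t) = between p i≤j j≤t

    -- A shorter walk between two vertices of the geodesic would shorten the geodesic itself.
    vertex-Dist : ∀ {i j} → i ≤ j → j ≤ d → Dist G (vertex p i) (vertex p j) (j ∸ i)
    vertex-Dist {i} {j} i≤j j≤d = between p i≤j j≤d , λ m m<j∸i q →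
      shortest (i + (m + (d ∸ j))) (bound m m<j∸i) (concat (before p (ℕ.≤-trans i≤j j≤d)) (concat q (after p j≤d)))
      where
      bound : ∀ m → m < j ∸ i → i + (m + (d ∸ j)) < d
      bound m m< = begin-strict
        i + (m + (d ∸ j))       <⟨ ℕ.+-monoʳ-< i (ℕ.+-monoˡ-< (d ∸ j) m<) ⟩
        i + ((j ∸ i) + (d ∸ j)) ≡⟨ ℕ.+-assoc i (j ∸ i) (d ∸ j) ⟨
        i + (j ∸ i) + (d ∸ j)   ≡⟨ cong (_+ (d ∸ j)) (ℕ.m+[n∸m]≡n i≤j) ⟩
        j + (d ∸ j)             ≡⟨ ℕ.m+[n∸m]≡n j≤d ⟩
        d                       ∎
        where open ℕ.≤-Reasoning

    vertex-injective : ∀ {i j} → i ≤ d → j ≤ d → vertex p i ≡ vertex p j → i ≡ j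
    vertex-injective {i} {j} i≤d j≤d e with ℕ.≤-total i j
    ... | inj₁ i≤j = ℕ.≤-antisym i≤j (ℕ.m∸n≡0⇒m≤n (Dist-unique G (vertex-Dist i≤j j≤d) (subst (λ x → Dist G x _ 0) (sym e) (here , λ _ ()))))
    ... | inj₂ j≤i = ℕ.≤-antisym (ℕ.m∸n≡0⇒m≤n (Dist-unique G (vertex-Dist j≤i i≤d) (subst (λ x → Dist G x _ 0) e (here , λ _ ())))) j≤i

    -- The first `h` of the d + 1 vertices and the next `h` are translates of each other. Distances
    -- on a geodesic are differences of indices, so the identity on pairs preserves them.
    homPair-geodesic : ∀ h → 2 * h ≤ suc d → HasHomPair G h
    homPair-geodesic h 2h≤1+d = S₁ , S₂
      , (λ {i} {j} e → toℕ-injective (vertex-injective (i≤d i) (i≤d j) e))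
      , (λ {i} {j} e → toℕ-injective (ℕ.+-cancelˡ-≡ h _ _ (vertex-injective (h+i≤d i) (h+i≤d j) e)))
      , (λ i j e → ℕ.<⇒≢ (ℕ.≤-trans (toℕ<n i) (ℕ.m≤m+n h (toℕ j))) (vertex-injective (i≤d i) (h+i≤d j) e))
      , ↔-id _ , λ ((i , j) , i<j) t →
          let D₁ = vertex-Dist (ℕ.<⇒≤ i<j) (i≤d j)
              D₂ = subst (Dist G (S₂ i) (S₂ j)) (ℕ.[m+n]∸[m+o]≡n∸o h (toℕ j) (toℕ i)) (vertex-Dist (ℕ.+-monoʳ-≤ h (ℕ.<⇒≤ i<j)) (h+i≤d j))
          in mk⇔ (λ D → subst (Dist G (S₂ i) (S₂ j)) (Dist-unique G D₁ D) D₂)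
                 (λ D → subst (Dist G (S₁ i) (S₁ j)) (Dist-unique G D₂ D) D₁)
      where
      S₁ S₂ : Fin h → Fin n
      S₁ i = vertex p (toℕ i)
      S₂ i = vertex p (h + toℕ i)
      h+i≤d : ∀ (i : Fin h) → h + toℕ i ≤ d
      h+i≤d i = s≤s⁻¹ (ℕ.≤-trans (ℕ.≤-reflexive (sym (ℕ.+-suc h (toℕ i)))) (ℕ.≤-trans (ℕ.+-monoʳ-≤ h (toℕ<n i))
        (ℕ.≤-trans (ℕ.≤-reflexive (cong (h +_) (sym (ℕ.+-identityʳ h)))) 2h≤1+d)))
      i≤d : ∀ (i : Fin h) → toℕ i ≤ d
      i≤d i = ℕ.≤-trans (ℕ.m≤n+m (toℕ i) h) (h+i≤d i)

-- Edge counts and exhaustive search over adjacencies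

bit : Bool → ℕ
bit true  = 1
bit false = 0

bit≤1 : ∀ b → bit b ≤ 1
bit≤1 true  = s≤s z≤n
bit≤1 false = z≤n

degree : {A : Set} → (A → Bool) → List A → ℕ
degree p xs = sum (map (bit ∘ p) xs)

edges : {A : Set} → (A → A → Bool) → List A → ℕ
edges g A = degree (uncurry g) (pairsOf A)

degree-++ : {A : Set} (p : A → Bool) (xs ys : List A) → degree p (xs ++ ys) ≡ degree p xs + degree p ys
degree-++ p xs ys = trans (cong sum (map-++ _ xs ys)) (sum-++ (map _ xs) (map _ ys))

degree-map : {A B : Set} (p : B → Bool) (f : A → B) (xs : List A) → degree p (map f xs) ≡ degree (p ∘ f) xs
degree-map p f xs = cong sum (sym (map-∘ xs))

degree-↭ : {A : Set} (p : A → Bool) {xs ys : List A} → xs ↭ ys → degree p xs ≡ degree p ys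
degree-↭ p r = sum-↭ (map⁺ _ r)

degree≤length : {A : Set} (p : A → Bool) (xs : List A) → degree p xs ≤ length xs
degree≤length p []       = z≤n
degree≤length p (x ∷ xs) = ℕ.+-mono-≤ (bit≤1 (p x)) (degree≤length p xs)

degree-not : {A : Set} (p : A → Bool) (xs : List A) → degree (not ∘ p) xs + degree p xs ≡ length xs
degree-not p []       = refl
degree-not p (x ∷ xs) with p x
... | true  = trans (ℕ.+-suc _ _) (cong suc (degree-not p xs))
... | false = cong suc (degree-not p xs)

edges-∷ : {A : Set} (g : A → A → Bool) (x : A) (xs : List A) → edges g (x ∷ xs) ≡ degree (g x) xs + edges g xs
edges-∷ g x xs = trans (degree-++ _ (map (x ,_) xs) (pairsOf xs)) (cong (_+ edges g xs) (degree-map _ (x ,_) xs))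

edges≤ : {A : Set} (g : A → A → Bool) (xs : List A) → edges g xs ≤ length xs C 2
edges≤ g xs = subst (edges g xs ≤_) (length-pairsOf xs) (degree≤length _ (pairsOf xs))

edges-not : {A : Set} (g : A → A → Bool) (xs : List A) → edges (λ x y → not (g x y)) xs + edges g xs ≡ length xs C 2
edges-not g xs = trans (degree-not (uncurry g) (pairsOf xs)) (length-pairsOf xs)

edges-map : {A B : Set} (g : B → B → Bool) (f : A → B) (xs : List A) → edges g (map f xs) ≡ edges (λ x y → g (f x) (f y)) xs
edges-map g f xs = trans (cong (degree (uncurry g)) (pairsOf-map f xs)) (degree-map _ _ (pairsOf xs))

edges-↭ : {A : Set} {g : A → A → Bool} → (∀ x y → g x y ≡ g y x) → {xs ys : List A} → xs ↭ ys → edges g xs ≡ edges g ys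
edges-↭ sy refl = refl
edges-↭ {g = g} sy (prep {xs} {ys} x p) = trans (edges-∷ g x xs) (trans (cong₂ _+_ (degree-↭ (g x) p) (edges-↭ sy p)) (sym (edges-∷ g x ys)))
edges-↭ {g = g} sy (swap {xs} {ys} x y p) = begin
  edges g (x ∷ y ∷ xs)                                        ≡⟨ two x y xs ⟩
  bit (g x y) + degree (g x) xs + (degree (g y) xs + edges g xs) ≡⟨ cong₂ (λ a b → bit (g x y) + degree (g x) xs + (a + b)) (degree-↭ (g y) p) (edges-↭ sy p) ⟩
  bit (g x y) + degree (g x) xs + (degree (g y) ys + edges g ys) ≡⟨ cong₂ (λ a b → bit a + b + (degree (g y) ys + edges g ys)) (sy x y) (degree-↭ (g x) p) ⟩
  bit (g y x) + degree (g x) ys + (degree (g y) ys + edges g ys) ≡⟨ solve 4 (λ a b c d → a :+ b :+ (c :+ d) := a :+ c :+ (b :+ d)) refl (bit (g y x)) (degree (g x) ys) _ _ ⟩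
  bit (g y x) + degree (g y) ys + (degree (g x) ys + edges g ys) ≡⟨ two y x ys ⟨
  edges g (y ∷ x ∷ ys) ∎
  where
  open ≡-Reasoning
  open +-*-Solver
  two : ∀ x y xs → edges g (x ∷ y ∷ xs) ≡ bit (g x y) + degree (g x) xs + (degree (g y) xs + edges g xs)
  two x y xs = trans (edges-∷ g x (y ∷ xs)) (cong (bit (g x y) + degree (g x) xs +_) (edges-∷ g y xs))
edges-↭ sy (Perm.trans p q) = trans (edges-↭ sy p) (edges-↭ sy q)

degree≡0⇒ : {A : Set} (p : A → Bool) (xs : List A) → degree p xs ≡ 0 → All (λ x → p x ≡ false) xs
degree≡0⇒ p []       e = []
degree≡0⇒ p (x ∷ xs) e with p x in q
... | false = q ∷ degree≡0⇒ p xs e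

-- Strategies that ask for adjacencies

data Instr : Set where
  ask : ℕ → ℕ → Instr
  eq  : List ℕ → List ℕ → ℕ → Instr

Answer : Set
Answer = (ℕ × ℕ) × Bool

-- Pairs are looked up in the given order only, since the relation is not assumed symmetric here.
-- Strategies therefore name vertices in increasing order.
find : ℕ → ℕ → List Answer → Maybe Bool
find i j []                  = nothing
find i j (((k , l) , b) ∷ K) = if (i ≡ᵇ k) ∧ (j ≡ᵇ l) then just b else find i j K

count : List Answer → List (ℕ × ℕ) → Maybe ℕ
count K []             = just 0
count K ((i , j) ∷ ps) with find i j K | count K ps
... | just true  | just c = just (suc c)
... | just false | just c = just c
... | _          | _      = nothing

agree : Maybe ℕ → Maybe ℕ → ℕ → Bool
agree (just a) (just c) b = a ≡ᵇ (c + b)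
agree _        _        b = false

-- A branch of the search is closed by an instruction eq A B b if the answers
-- known so far show that A has b more edges than B.
search : List Instr → List Answer → Bool
search []             K = false
search (ask i j ∷ s)  K = search s (((i , j) , true) ∷ K) ∧ search s (((i , j) , false) ∷ K)
search (eq A B b ∷ s) K = agree (count K (pairsOf A)) (count K (pairsOf B)) b ∨ search s K

module _ (h : ℕ → ℕ → Bool) where

  Consistent : List Answer → Set
  Consistent = All (λ ((i , j) , b) → h i j ≡ b)

  -- A question never holds, so the instruction delivered by `search-sound` is always a comparison.
  Holds : Instr → Set
  Holds (ask _ _)  = ⊥
  Holds (eq A B b) = edges h A ≡ edges h B + b

  find-sound : ∀ i j {K b} → Consistent K → find i j K ≡ just b → h i j ≡ b
  find-sound i j {((k , l) , b) ∷ K} (p ∷ ps) e with i ≡ᵇ k in q | j ≡ᵇ l in r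
  ... | true  | true  = trans (cong₂ h (ℕ.≡ᵇ⇒≡ i k (subst T (sym q) _)) (ℕ.≡ᵇ⇒≡ j l (subst T (sym r) _))) (trans p (just-injective e))
  ... | true  | false = find-sound i j ps e
  ... | false | _     = find-sound i j ps e

  count-sound : ∀ {K} ps {c} → Consistent K → count K ps ≡ just c → degree (uncurry h) ps ≡ c
  count-sound []             con refl = refl
  count-sound {K} ((i , j) ∷ ps) con e with find i j K in q | count K ps in r
  count-sound {K} ((i , j) ∷ ps) con refl | just true  | just c = cong₂ (λ b d → bit b + d) (find-sound i j con q) (count-sound ps con r)
  count-sound {K} ((i , j) ∷ ps) con refl | just false | just c = cong₂ (λ b d → bit b + d) (find-sound i j con q) (count-sound ps con r)

  agree-sound : ∀ A B b {K} → Consistent K → agree (count K (pairsOf A)) (count K (pairsOf B)) b ≡ true → edges h A ≡ edges h B + b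
  agree-sound A B b {K} con e with count K (pairsOf A) in q | count K (pairsOf B) in r
  ... | just a | just c = trans (count-sound (pairsOf A) con q)
          (trans (ℕ.≡ᵇ⇒≡ a (c + b) (subst T (sym e) _)) (cong (_+ b) (sym (count-sound (pairsOf B) con r))))

  search-sound : ∀ s {K} → Consistent K → search s K ≡ true → Any Holds s
  search-sound (ask i j ∷ s) {K} con e with h i j in q
  ... | true  = there (search-sound s (q ∷ con) (∧-conicalˡ _ _ e))
  ... | false = there (search-sound s (q ∷ con) (∧-conicalʳ (search s (((i , j) , true) ∷ K)) _ e))
  search-sound (eq A B b ∷ s) {K} con e with agree (count K (pairsOf A)) (count K (pairsOf B)) b in q
  ... | true  = here (agree-sound A B b con q)
  ... | false = there (search-sound s con e)

∈-elements⁺ : ∀ {n} {p : Subset n} {x} → x ∈ₛ p → x ∈ elements p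
∈-elements⁺ {p = inside ∷ p}  here      = here refl
∈-elements⁺ {p = inside ∷ p}  (there i) = there (∈-map⁺ suc (∈-elements⁺ i))
∈-elements⁺ {p = outside ∷ p} (there i) = ∈-map⁺ suc (∈-elements⁺ i)

fromList : ∀ {n} → List (Fin n) → Subset n
fromList []      = Subset.⊥
fromList (x ∷ A) = ⁅ x ⁆ ∪ fromList A

∈-fromList⁺ : ∀ {n} {A : List (Fin n)} {x} → x ∈ A → x ∈ₛ fromList A
∈-fromList⁺ {A = x ∷ A} (here refl) = Subset.x∈p∪q⁺ (inj₁ (Subset.x∈⁅x⁆ x))
∈-fromList⁺ {A = x ∷ A} (there i)   = Subset.x∈p∪q⁺ (inj₂ (∈-fromList⁺ i))

∈-fromList⁻ : ∀ {n} (A : List (Fin n)) {x} → x ∈ₛ fromList A → x ∈ A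
∈-fromList⁻ []      i = ⊥-elim (Subset.∉⊥ i)
∈-fromList⁻ (y ∷ A) i with Subset.x∈p∪q⁻ ⁅ y ⁆ (fromList A) i
... | inj₁ j = here (Subset.x∈⁅y⁆⇒x≡y y j)
... | inj₂ j = there (∈-fromList⁻ A j)

elements-fromList : ∀ {n} {A : List (Fin n)} → Unique A → elements (fromList A) ↭ A
elements-fromList {A = A} u = ∼bag⇒↭ (unique∧set⇒bag (unique-elements (fromList A)) u
  (mk⇔ (∈-fromList⁻ A ∘ ∈-elements⁻ (fromList A)) (∈-elements⁺ ∘ ∈-fromList⁺)))

∣fromList∣ : ∀ {n} {A : List (Fin n)} → Unique A → ∣ fromList A ∣ ≡ length A
∣fromList∣ {A = A} u = trans (sym (length-elements (fromList A))) (↭-length (elements-fromList u))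

-- Disjoint sets spanning equally many edges

EqualPair : {V : Set} → (V → V → Bool) → ℕ → Set
EqualPair g k = ∃[ A ] ∃[ B ] length A ≡ k × length B ≡ k × Unique (A ++ B) × edges g A ≡ edges g B

EqualSets : ℕ → ℕ → Set
EqualSets m k = (g : Fin m → Fin m → Bool) → (∀ x y → g x y ≡ g y x) → EqualPair g k

equalSets-kneser : ∀ m k → 1 ≤ k → suc (k C 2) + 2 * k ≤ m + 1 → EqualSets m k
equalSets-kneser m k 1≤k le g _ = kneser-lists id id k (suc (k C 2)) (edges g) 1≤k le
  λ { A refl → s≤s (edges≤ g A) }

spell : (ℕ → Maybe Bool) → ℕ → List (Maybe Bool)
spell l zero    = []
spell l (suc b) = l b ∷ spell l b

module _ {m} (g : Fin m → Fin m → Bool) (symm : ∀ x y → g x y ≡ g y x) (k : ℕ) where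

  -- A division of the vertices into two sides such that no k-set of one side has as many edges
  -- as a k-set of the other; letter a is the side containing k-sets with a edges.
  record Split : Set₁ where
    field
      Side     : Bool → Fin m → Set
      apart    : ∀ {s x y} → Side s x → Side (not s) y → x ≢ y
      letter   : ℕ → Maybe Bool
      letter⁻  : ∀ {a s} → letter a ≡ just s → ∃[ A ] length A ≡ k × Unique A × All (Side s) A × edges g A ≡ a
      letter⁺  : ∀ {s A} → length A ≡ k → Unique A → All (Side s) A → letter (edges g A) ≡ just s
      unequal  : ¬ EqualPair g k

  -- If the colouring by numbers of edges is proper, every sign vector yields a `Split`. Bounding
  -- the blocks of an abstract split is thus enough, and later arguments need no sign vectors.
  equalPair-zigzag : ∀ L → 1 ≤ k → L + 2 * k ≤ m + 1 →
    ((S : Split) → blocks (spell (Split.letter S) (suc (k C 2))) ≤ L) → EqualPair g k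
  equalPair-zigzag L (s≤s {n = k′} z≤n) le few =
    let F , G , ∣F∣ , ∣G∣ , F⊆∁G , e = zigzag-bound k (suc (k C 2)) L c (s≤s z≤n) le few′ bounded
    in elements F , elements G , trans (length-elements F) ∣F∣ , trans (length-elements G) ∣G∣
     , Unique.++⁺ (unique-elements F) (unique-elements G) (λ (i , j) → Subset.x∈∁p⇒x∉p (F⊆∁G (∈-elements⁻ F i)) (∈-elements⁻ G j)) , e
    where
    c : Subset m → ℕ
    c F = edges g (elements F)
    bounded : ∀ F → ∣ F ∣ ≡ k → c F < suc (k C 2)
    bounded F ∣F∣ = s≤s (subst (λ l → c F ≤ l C 2) (trans (length-elements F) ∣F∣) (edges≤ g (elements F)))
    few′ : ∀ c< proper X → blocks (Zigzag.word k′ (suc (k C 2)) c c< proper (suc (k C 2)) X) ≤ L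
    few′ c< proper X = subst (λ w → blocks w ≤ L) (spell≡word (suc (k C 2))) (few split)
      where
      module Z = Zigzag k′ (suc (k C 2)) c c< proper
      spell≡word : ∀ b → spell (Z.letter X) b ≡ Z.word b X
      spell≡word zero    = refl
      spell≡word (suc b) = cong (Z.letter X b ∷_) (spell≡word b)
      split : Split
      split = record
        { Side = λ s x → x ∈ₛ part s X
        ; apart = λ {s} i j e → Subset.x∈∁p⇒x∉p (part-disjoint s X i) (subst (_∈ₛ part (not s) X) (sym e) j)
        ; letter = Z.letter X
        ; letter⁻ = λ {a} e → let F , F⊆ , ∣F∣ , cF = Z.letter⁻ X a e in
            elements F , trans (length-elements F) ∣F∣ , unique-elements F , All.tabulate (λ i → F⊆ (∈-elements⁻ F i)) , cF
        ; letter⁺ = λ {s} {A} ∣A∣ u A⊆ → Z.letter⁺ X _ (fromList A , (λ i → All.lookup A⊆ (∈-fromList⁻ A i))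
            , trans (∣fromList∣ u) ∣A∣ , edges-↭ symm (elements-fromList u))
        ; unequal = λ (A , B , ∣A∣ , ∣B∣ , u , e) →
            let uA , uB , d = Unique-++⁻ A u in
            proper (fromList A) (fromList B) (trans (∣fromList∣ uA) ∣A∣) (trans (∣fromList∣ uB) ∣B∣)
              (λ i → Subset.x∉p⇒x∈∁p λ j → All.lookup (All.lookup d (∈-fromList⁻ A i)) (∈-fromList⁻ B j) refl)
              (trans (edges-↭ symm (elements-fromList uA)) (trans e (sym (edges-↭ symm (elements-fromList uB)))))
        }

-- Words grow from letter 0 upwards. One more letter adds at most one block, so branches that can no
-- longer reach `b` blocks are cut off, which spares most of the 3^11 words of length eleven.
allWords : (n b : ℕ) → (List (Maybe Bool) → Bool) → List (Maybe Bool) → Bool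
allWords zero    b p w = (blocks w <ᵇ b) ∨ p w
allWords (suc n) b p w = ((blocks w + suc n) <ᵇ b) ∨
  (allWords n b p (nothing ∷ w) ∧ (allWords n b p (just true ∷ w) ∧ allWords n b p (just false ∷ w)))

extend : (ℕ → Maybe Bool) → ℕ → ℕ → List (Maybe Bool)
extend l c zero    = spell l c
extend l c (suc n) = extend l (suc c) n

blocks-extend : ∀ l c n → blocks (extend l c n) ≤ blocks (spell l c) + n
blocks-extend l c zero    = ℕ.≤-reflexive (sym (ℕ.+-identityʳ _))
blocks-extend l c (suc n) = ℕ.≤-trans (blocks-extend l (suc c) n)
  (ℕ.≤-trans (ℕ.+-monoˡ-≤ n (blocks-∷ (l c) (spell l c))) (ℕ.≤-reflexive (sym (ℕ.+-suc (blocks (spell l c)) n))))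

allWords-sound : ∀ n b p l c → allWords n b p (spell l c) ≡ true → b ≤ blocks (extend l c n) → p (extend l c n) ≡ true
allWords-sound zero b p l c e le with blocks (spell l c) <ᵇ b in q
... | true  = ⊥-elim (ℕ.<⇒≱ (ℕ.<ᵇ⇒< _ b (subst T (sym q) _)) le)
... | false = e
allWords-sound (suc n) b p l c e le with (blocks (spell l c) + suc n) <ᵇ b in q
... | true  = ⊥-elim (ℕ.<⇒≱ (ℕ.<ᵇ⇒< _ b (subst T (sym q) _)) (ℕ.≤-trans le (blocks-extend l c (suc n))))
... | false = allWords-sound n b p l (suc c) (choose (l c) e) le
  where
  choose : ∀ x → allWords n b p (nothing ∷ spell l c) ∧ (allWords n b p (just true ∷ spell l c) ∧ allWords n b p (just false ∷ spell l c)) ≡ true →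
           allWords n b p (x ∷ spell l c) ≡ true
  choose nothing e = Bool.∧-conicalˡ _ _ e
  choose (just true) e = Bool.∧-conicalˡ _ _ (Bool.∧-conicalʳ (allWords n b p (nothing ∷ spell l c)) _ e)
  choose (just false) e = Bool.∧-conicalʳ (allWords n b p (just true ∷ spell l c)) _ (Bool.∧-conicalʳ (allWords n b p (nothing ∷ spell l c)) _ e)

complete : {A : Set} (L S : List A) → Unique L → (∀ {x} → x ∈ L → x ∈ S) → ∃[ Z ] S ↭ L ++ Z
complete []      S u h = S , ↭-refl
complete (x ∷ L) S (x∉ ∷ u) h =
  let ys , zs , S≡ = ∈-∃++ (h (here refl))
      S↭ = ↭-trans (↭-reflexive S≡) (shift x ys zs)
      Z , p = complete L (ys ++ zs) u λ {y} i → drop (All.lookup x∉ i) (∈-resp-↭ S↭ (h (there i)))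
  in Z , ↭-trans S↭ (prep x p)
  where
  drop : ∀ {y S} → x ≢ y → y ∈ x ∷ S → y ∈ S
  drop x≢y (here e)  = ⊥-elim (x≢y (sym e))
  drop x≢y (there i) = i

-- The default avoids indices with bounds: strategies use bare numbers as positions, whose range is
-- checked separately by `Balanced` and `Counts`.
at : {V : Set} → V → List V → ℕ → V
at d []       _       = d
at d (x ∷ xs) zero    = x
at d (x ∷ xs) (suc i) = at d xs i

at-∈ : {V : Set} (d : V) (W : List V) {i : ℕ} → i < length W → at d W i ∈ W
at-∈ d (x ∷ W) {zero}  _         = here refl
at-∈ d (x ∷ W) {suc i} (s≤s i<l) = there (at-∈ d W i<l)

at-injective : {V : Set} (d : V) {W : List V} → Unique W → ∀ {i j} → i < length W → j < length W → i ≢ j → at d W i ≢ at d W j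
at-injective d (x∉ ∷ u) {zero}  {zero}  _ _ i≢j _ = i≢j refl
at-injective d {x ∷ W} (x∉ ∷ u) {zero}  {suc j} _ (s≤s j<) _ e = All.lookup x∉ (at-∈ d W j<) e
at-injective d {x ∷ W} (x∉ ∷ u) {suc i} {zero}  (s≤s i<) _ _ e = All.lookup x∉ (at-∈ d W i<) (sym e)
at-injective d (x∉ ∷ u) {suc i} {suc j} (s≤s i<) (s≤s j<) i≢j e = at-injective d u i< j< (i≢j ∘ cong suc) e

unique-at : {V : Set} (d : V) {W : List V} → Unique W → ∀ {A} → Unique A → All (_< length W) A → Unique (map (at d W) A)
unique-at d u []       []       = []
unique-at d u (x∉ ∷ v) (p ∷ ps) = All.map⁺ (All.zipWith (λ (q , x≢y) → at-injective d u p q x≢y) (ps , x∉)) ∷ unique-at d u v ps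

Unique-resp-↭ : {A : Set} {xs ys : List A} → xs ↭ ys → Unique xs → Unique ys
Unique-resp-↭ = AllPairs-resp-↭ (λ p → p ∘ sym)

-- Whichever comparison a search delivers, it is then between disjoint k-sets of valid positions and
-- yields an equal pair. The condition is decided once for a whole strategy.
Balanced : ℕ → ℕ → Instr → Set
Balanced k n (ask _ _)  = ⊤
Balanced k n (eq A B b) = b ≡ 0 × length A ≡ k × length B ≡ k × Unique (A ++ B) × All (_< n) (A ++ B)

balanced? : ∀ k n i → Dec (Balanced k n i)
balanced? k n (ask _ _)  = yes tt
balanced? k n (eq A B b) = b ℕ.≟ 0 ×-dec length A ℕ.≟ k ×-dec length B ℕ.≟ k ×-dec unique? ℕ._≟_ (A ++ B) ×-dec All.all? (ℕ._<? n) (A ++ B)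

-- A comparison with the empty set fixes the number of edges. Here each possible outcome is a k-set
-- whose number of edges is among `bs`, the numbers to be excluded.
Counts : ℕ → ℕ → List ℕ → Instr → Set
Counts k n bs (ask _ _)  = ⊤
Counts k n bs (eq A B b) = B ≡ [] × length A ≡ k × Unique A × All (_< n) A × b ∈ bs

counts? : ∀ k n bs i → Dec (Counts k n bs i)
counts? k n bs (ask _ _)        = yes tt
counts? k n bs (eq A [] b)      = yes refl ×-dec length A ℕ.≟ k ×-dec unique? ℕ._≟_ A ×-dec All.all? (ℕ._<? n) A ×-dec DecMembership._∈?_ ℕ._≟_ b bs
counts? k n bs (eq A (_ ∷ _) b) = no λ ()

module _ {V : Set} (g : V → V → Bool) (d : V) {W : List V} (uW : Unique W) where

  positions : ℕ → ℕ → Bool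
  positions i j = g (at d W i) (at d W j)

  balanced⇒equalPair-within : ∀ {k s} → All (Balanced k (length W)) s → Any (Holds positions) s →
    ∃[ A ] ∃[ B ] length A ≡ k × length B ≡ k × Unique (A ++ B) × All (_∈ W) (A ++ B) × edges g A ≡ edges g B
  balanced⇒equalPair-within {s = eq A B .0 ∷ _} ((refl , ∣A∣ , ∣B∣ , u , W<) ∷ _) (here e) =
    map (at d W) A , map (at d W) B , trans (length-map _ A) ∣A∣ , trans (length-map _ B) ∣B∣
    , subst Unique (map-++ (at d W) A B) (unique-at d uW u W<)
    , subst (All (_∈ W)) (map-++ (at d W) A B) (All.map⁺ (All.map (at-∈ d W) W<))
    , trans (edges-map g (at d W) A) (trans e (trans (ℕ.+-identityʳ _) (sym (edges-map g (at d W) B))))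
  balanced⇒equalPair-within (_ ∷ ps) (there a) = balanced⇒equalPair-within ps a

  balanced⇒equalPair : ∀ {k s} → All (Balanced k (length W)) s → Any (Holds positions) s → EqualPair g k
  balanced⇒equalPair b a = let A , B , ∣A∣ , ∣B∣ , u , _ , e = balanced⇒equalPair-within b a in A , B , ∣A∣ , ∣B∣ , u , e

  counts⇒set : ∀ {k bs s} → All (Counts k (length W) bs) s → Any (Holds positions) s →
    ∃[ A ] length A ≡ k × Unique A × All (_∈ W) A × edges g A ∈ bs
  counts⇒set {bs = bs} {eq A .[] b ∷ _} ((refl , ∣A∣ , u , W< , b∈) ∷ _) (here e) =
    map (at d W) A , trans (length-map _ A) ∣A∣ , unique-at d uW u W< , All.map⁺ (All.map (at-∈ d W) W<)
    , subst (_∈ bs) (trans (sym e) (sym (edges-map g (at d W) A))) b∈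
  counts⇒set (_ ∷ ps) (there a) = counts⇒set ps a

module _ {V : Set} (g : V → V → Bool) where

  edge-front : ∀ zs → edges g zs ≢ 0 → ∃[ x ] ∃[ y ] ∃[ R ] zs ↭ x ∷ y ∷ R × g x y ≡ true
  edge-front []      e = ⊥-elim (e refl)
  edge-front (z ∷ zs) e with degree (g z) zs ℕ.≟ 0
  ... | yes q = let x , y , R , p , a = edge-front zs (λ r → e (trans (edges-∷ g z zs) (cong₂ _+_ q r)))
                in x , y , z ∷ R , ↭-trans (prep z p) (↭-trans (swap z x ↭-refl) (prep x (swap z y ↭-refl))) , a
  ... | no q = let y , R , p , a = neighbour zs q in z , y , R , prep z p , a
    where
    neighbour : ∀ zs → degree (g z) zs ≢ 0 → ∃[ y ] ∃[ R ] zs ↭ y ∷ R × g z y ≡ true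
    neighbour []      q = ⊥-elim (q refl)
    neighbour (y ∷ zs) q with g z y in a
    ... | true  = y , zs , ↭-refl , a
    ... | false = let y′ , R , p , a′ = neighbour zs q in y′ , y ∷ R , ↭-trans (prep y p) (swap y y′ ↭-refl) , a′

  remaining : ∀ {x y e} R → edges g (x ∷ y ∷ R) ≡ suc e → g x y ≡ true →
              degree (uncurry g) (map (x ,_) R ++ pairsOf (y ∷ R)) ≡ e
  remaining {x} {y} R q a = ℕ.suc-injective (trans (cong (λ b → bit b + degree (uncurry g) (map (x ,_) R ++ pairsOf (y ∷ R))) (sym a)) q)

  degree-step : {A : Set} (p : A → Bool) (x : A) (xs : List A) → degree p (x ∷ xs) ≡ 1 →
    (p x ≡ true × All (λ y → p y ≡ false) xs) ⊎ (p x ≡ false × degree p xs ≡ 1)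
  degree-step p x xs e with p x
  ... | true  = inj₁ (refl , degree≡0⇒ p xs (ℕ.suc-injective e))
  ... | false = inj₂ (refl , e)

  degree≡length⇒ : {A : Set} (p : A → Bool) (xs : List A) → degree p xs ≡ length xs → All (λ x → p x ≡ true) xs
  degree≡length⇒ p xs e = All.map (λ q → trans (sym (not-involutive _)) (cong not q))
    (degree≡0⇒ (not ∘ p) xs (ℕ.+-cancelʳ-≡ (degree p xs) _ 0 (trans (degree-not p xs) (sym e))))

two : {A : Set} (xs : List A) → length xs ≡ 2 → ∃[ a ] ∃[ b ] xs ≡ a ∷ b ∷ []
two (a ∷ b ∷ []) _ = a , b , refl

three : {A : Set} (xs : List A) → length xs ≡ 3 → ∃[ a ] ∃[ b ] ∃[ c ] xs ≡ a ∷ b ∷ c ∷ []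
three (a ∷ b ∷ c ∷ []) _ = a , b , c , refl

five : {A : Set} (xs : List A) → length xs ≡ 5 → ∃[ a ] ∃[ b ] ∃[ c ] ∃[ d ] ∃[ e ] xs ≡ a ∷ b ∷ c ∷ d ∷ e ∷ []
five (a ∷ b ∷ c ∷ d ∷ e ∷ []) _ = a , b , c , d , e , refl

digits : ℕ → ℕ → List ℕ
digits zero    c = []
digits (suc k) c = digits k (c / 16) ++ (c % 16 ∷ [])

-- Two hexadecimal digits encode a question, eight digits the comparison of two 4-sets.
decode : ℕ → Instr
decode c = if c <ᵇ 256 then ask (c / 16) (c % 16) else eq (digits 4 (c / 65536)) (digits 4 c) 0

-- Found by a greedy computer search. Vertices 0, …, 3 span the edge 01 only, and 4, …, 7 span the
-- edges 45 and 67 in the first case, 45 and 46 in the second.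
matching-strategy path-strategy : List Instr
matching-strategy = map decode (
  0x08 ∷ 0x18 ∷ 0x28 ∷ 0x01284567 ∷ 0x38 ∷ 0x02384567 ∷ 0x01384567 ∷ 0x12384567 ∷ 0x49 ∷ 0x59 ∷ 0x69 ∷ 
  0x01284569 ∷ 0x02384569 ∷ 0x01234569 ∷ 0x79 ∷ 0x01284579 ∷ 0x01234679 ∷ 0x01235679 ∷ 0x02384579 ∷ 
  0x01234579 ∷ 0x01284679 ∷ 0x02384679 ∷ 0x09 ∷ 0x19 ∷ 0x29 ∷ 0x01294567 ∷ 0x39 ∷ 0x02394567 ∷ 0x01394567 ∷ 
  0x12394567 ∷ 0x89 ∷ 0x02894567 ∷ 0x01894567 ∷ 0x23894567 ∷ 0x34 ∷ 0x35 ∷ 0x01283459 ∷ 0x36 ∷ 0x01293456 ∷ 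
  0x02893456 ∷ 0x01283469 ∷ 0x01283569 ∷ 0x01283456 ∷ 0x37 ∷ 0x01283479 ∷ 0x01293567 ∷ 0x02893567 ∷ 
  0x01283457 ∷ 0x01283467 ∷ 0x01283567 ∷ 0x02893457 ∷ 0x01283579 ∷ 0x01293457 ∷ 0x01283679 ∷ 0x07 ∷ 0x17 ∷ 
  0x01374569 ∷ 0x01793456 ∷ 0x78 ∷ 0x01783469 ∷ 0x01783569 ∷ 0x01783459 ∷ 0x03784569 ∷ 0x07893456 ∷ 
  0x01784569 ∷ 0x01783456 ∷ 0x17893456 ∷ 0x24 ∷ 0x01782349 ∷ 0x26 ∷ 0x01782369 ∷ 0x01792346 ∷ 0x01372469 ∷ 
  0x01782346 ∷ 0x01782469 ∷ 0x01382469 ∷ 0x03782469 ∷ 0x13782469 ∷ 0x48 ∷ 0x01372489 ∷ 0x24893567 ∷ 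
  0x01792348 ∷ 0x23485679 ∷ 0x01234789 ∷ 0x68 ∷ 0x01372689 ∷ 0x24683579 ∷ 0x26893457 ∷ 0x03792468 ∷ 
  0x01234678 ∷ 0x01234689 ∷ 0x01372468 ∷ 0x01793468 ∷ 0x04 ∷ 0x02483569 ∷ 0x02483579 ∷ 0x04783569 ∷ 0x14 ∷ 
  0x01243569 ∷ 0x01243567 ∷ 0x01243689 ∷ [])
path-strategy = map decode (
  0x58 ∷ 0x68 ∷ 0x78 ∷ 0x01235678 ∷ 0x09 ∷ 0x19 ∷ 0x29 ∷ 0x01294567 ∷ 0x01295678 ∷ 0x48 ∷ 0x01294568 ∷ 
  0x01294578 ∷ 0x01234578 ∷ 0x01294678 ∷ 0x39 ∷ 0x01394567 ∷ 0x02394567 ∷ 0x02394568 ∷ 0x12394578 ∷ 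
  0x02395678 ∷ 0x59 ∷ 0x69 ∷ 0x79 ∷ 0x01235679 ∷ 0x08 ∷ 0x18 ∷ 0x28 ∷ 0x01284567 ∷ 0x01285679 ∷ 0x49 ∷ 
  0x01284569 ∷ 0x01284579 ∷ 0x01234579 ∷ 0x01284679 ∷ 0x38 ∷ 0x01384567 ∷ 0x02384567 ∷ 0x02384569 ∷ 
  0x12384579 ∷ 0x02385679 ∷ 0x89 ∷ 0x01894567 ∷ 0x01234789 ∷ 0x02894567 ∷ 0x01234589 ∷ 0x01234689 ∷ 0x04 ∷ 
  0x14 ∷ 0x01485679 ∷ 0x01495678 ∷ 0x34 ∷ 0x03485679 ∷ 0x13495678 ∷ 0x01345678 ∷ 0x01345679 ∷ 0x01345689 ∷ 
  0x01345789 ∷ 0x01346789 ∷ 0x05 ∷ 0x24 ∷ 0x01245678 ∷ 0x23485679 ∷ 0x01245679 ∷ 0x02345789 ∷ 0x02345689 ∷ 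
  0x05891234 ∷ 0x23495678 ∷ 0x26 ∷ 0x01342689 ∷ 0x01382469 ∷ 0x01392468 ∷ 0x36 ∷ 0x05892346 ∷ 0x23465789 ∷ 
  0x01482369 ∷ 0x01492368 ∷ 0x04582369 ∷ 0x23694578 ∷ 0x01892346 ∷ 0x01243689 ∷ 0x35 ∷ 0x03584679 ∷ 
  0x03452689 ∷ 0x37 ∷ 0x01243567 ∷ 0x01283479 ∷ [])

forest-facts : (Bool × Bool × Bool) → List Answer
forest-facts (p , q , r) =
    ((0 , 1) , true) ∷ ((0 , 2) , false) ∷ ((0 , 3) , false) ∷ ((1 , 2) , false) ∷ ((1 , 3) , false) ∷ ((2 , 3) , false)
  ∷ ((4 , 5) , p) ∷ ((4 , 6) , q) ∷ ((4 , 7) , false) ∷ ((5 , 6) , false) ∷ ((5 , 7) , false) ∷ ((6 , 7) , r) ∷ []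

abstract
  matching-search : search matching-strategy (forest-facts (true , false , true)) ≡ true
  matching-search = refl

  path-search : search path-strategy (forest-facts (true , true , false)) ≡ true
  path-search = refl

  matching-balanced : All (Balanced 4 10) matching-strategy
  matching-balanced = from-yes (All.all? (balanced? 4 10) matching-strategy)

  path-balanced : All (Balanced 4 10) path-strategy
  path-balanced = from-yes (All.all? (balanced? 4 10) path-strategy)

module _ {m} (g : Fin m → Fin m → Bool) (symm : ∀ x y → g x y ≡ g y x) where

  canonical-edge : ∀ {A} → length A ≡ 4 → edges g A ≡ 1 →
    ∃[ x ] ∃[ y ] ∃[ a ] ∃[ b ] A ↭ x ∷ y ∷ a ∷ b ∷ [] × g x y ≡ true ×
      All (λ (u , v) → g u v ≡ false) ((x , a) ∷ (x , b) ∷ (y , a) ∷ (y , b) ∷ (a , b) ∷ [])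
  canonical-edge {A} ∣A∣ e with edge-front g A (λ q → case trans (sym q) e of λ ())
  ... | x , y , R , p , q with two R (ℕ.suc-injective (ℕ.suc-injective (trans (sym (↭-length p)) ∣A∣)))
  ...   | a , b , refl = x , y , a , b , p , q ,
    degree≡0⇒ (uncurry g) _ (remaining g (a ∷ b ∷ []) (trans (sym (edges-↭ symm p)) e) q)

  -- r tells the matching xy, ab from the path yxa.
  TwoEdges : Bool → Fin m → Fin m → Fin m → Fin m → Set
  TwoEdges r x y a b = g x y ≡ true × g x a ≡ not r × g x b ≡ false × g y a ≡ false × g y b ≡ false × g a b ≡ r

  -- With `x y` as one edge, the second either meets it, and can be renamed to `x a`, or it is
  -- `a b`.
  canonical-two-edges : ∀ {B} → length B ≡ 4 → edges g B ≡ 2 →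
    ∃[ r ] ∃[ x ] ∃[ y ] ∃[ a ] ∃[ b ] B ↭ x ∷ y ∷ a ∷ b ∷ [] × TwoEdges r x y a b
  canonical-two-edges {B} ∣B∣ e with edge-front g B (λ q → case trans (sym q) e of λ ())
  ... | x , y , R , p , xy with two R (ℕ.suc-injective (ℕ.suc-injective (trans (sym (↭-length p)) ∣B∣)))
  ...   | a , b , refl with degree-step g (uncurry g) (x , a) ((x , b) ∷ (y , a) ∷ (y , b) ∷ (a , b) ∷ []) (remaining g (a ∷ b ∷ []) (trans (sym (edges-↭ symm p)) e) xy)
  ...   | inj₁ (xa , xb ∷ ya ∷ yb ∷ ab ∷ []) = false , x , y , a , b , p , xy , xa , xb , ya , yb , ab
  ...   | inj₂ (xa , q) with degree-step g (uncurry g) (x , b) ((y , a) ∷ (y , b) ∷ (a , b) ∷ []) q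
  ...   | inj₁ (xb , ya ∷ yb ∷ ab ∷ []) = false , x , y , b , a , ↭-trans p (prep x (prep y (swap a b refl))) , xy , xb , xa , yb , ya , trans (symm b a) ab
  ...   | inj₂ (xb , q) with degree-step g (uncurry g) (y , a) ((y , b) ∷ (a , b) ∷ []) q
  ...   | inj₁ (ya , yb ∷ ab ∷ []) = false , y , x , a , b , ↭-trans p (swap x y refl) , trans (symm y x) xy , ya , yb , xa , xb , ab
  ...   | inj₂ (ya , q) with degree-step g (uncurry g) (y , b) ((a , b) ∷ []) q
  ...   | inj₁ (yb , ab ∷ []) = false , y , x , b , a , ↭-trans p (swap x y (swap a b refl)) , trans (symm y x) xy , yb , ya , xb , xa , trans (symm b a) ab
  ...   | inj₂ (yb , q) with degree-step g (uncurry g) (a , b) [] q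
  ...   | inj₁ (ab , []) = true , x , y , a , b , p , xy , xa , xb , ya , yb , ab

  twoMore : (Z : List (Fin m)) → 2 ≤ length Z → ∃[ z ] ∃[ z′ ] ∃[ Z′ ] Z ≡ z ∷ z′ ∷ Z′
  twoMore (z ∷ z′ ∷ Z) _ = z , z′ , Z , refl
  twoMore (_ ∷ []) (s≤s ())

  -- The eight vertices of `A` and `B` do not suffice for the search; together with two further
  -- ones, which `10 ≤ m` supplies, the strategies close every branch.
  equalPair-1-2 : ∀ A B → 10 ≤ m → length A ≡ 4 → length B ≡ 4 → Unique (A ++ B) → edges g A ≡ 1 → edges g B ≡ 2 → EqualPair g 4
  equalPair-1-2 A B 10≤m ∣A∣ ∣B∣ u eA eB
    with canonical-edge {A} ∣A∣ eA | canonical-two-edges {B} ∣B∣ eB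
  ... | x , y , a , b , p , xy , xa ∷ xb ∷ ya ∷ yb ∷ ab ∷ [] | r , x′ , y′ , a′ , b′ , p′ , xy′ , xa′ , xb′ , ya′ , yb′ , ab′
    with complete ((x ∷ y ∷ a ∷ b ∷ []) ++ (x′ ∷ y′ ∷ a′ ∷ b′ ∷ [])) (allFin m) (Unique-resp-↭ (++⁺ p p′) u) (λ _ → ∈-allFin _)
  ... | Z , S↭ with twoMore Z (ℕ.+-cancelˡ-≤ 8 2 (length Z) (subst (10 ≤_) (trans (sym (length-tabulate id)) (↭-length S↭)) 10≤m))
  ...   | z , z′ , Z′ , refl = finish r xy′ xa′ xb′ ya′ yb′ ab′
    where
    W : List (Fin m)
    W = x ∷ y ∷ a ∷ b ∷ x′ ∷ y′ ∷ a′ ∷ b′ ∷ z ∷ z′ ∷ []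
    uW : Unique W
    uW = proj₁ (Unique-++⁻ W (Unique-resp-↭ S↭ (Unique.allFin⁺ m)))
    finish : ∀ r → g x′ y′ ≡ true → g x′ a′ ≡ not r → g x′ b′ ≡ false → g y′ a′ ≡ false → g y′ b′ ≡ false → g a′ b′ ≡ r → EqualPair g 4
    finish true  xy′ xa′ xb′ ya′ yb′ ab′ = balanced⇒equalPair g x uW matching-balanced
      (search-sound (positions g x uW) matching-strategy {K = forest-facts (true , false , true)} (xy ∷ xa ∷ xb ∷ ya ∷ yb ∷ ab ∷ xy′ ∷ xa′ ∷ xb′ ∷ ya′ ∷ yb′ ∷ ab′ ∷ []) matching-search)
    finish false xy′ xa′ xb′ ya′ yb′ ab′ = balanced⇒equalPair g x uW path-balanced
      (search-sound (positions g x uW) path-strategy {K = forest-facts (true , true , false)} (xy ∷ xa ∷ xb ∷ ya ∷ yb ∷ ab ∷ xy′ ∷ xa′ ∷ xb′ ∷ ya′ ∷ yb′ ∷ ab′ ∷ []) path-search)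

-- Exchange arguments within one side

private
  -- Vertex `p` replaces one of the independent vertices 0 to 3. If it has d neighbours among them,
  -- the new sets have d or d - 1 edges; avoiding 1 and 2 leaves only d = 0 and d = 4.
  attach : ℕ → List Instr
  attach p = map (λ a → ask a p) (0 ∷ 1 ∷ 2 ∷ 3 ∷ []) ++
    concatMap (λ A → eq A [] 1 ∷ eq A [] 2 ∷ [])
      ((0 ∷ 1 ∷ 2 ∷ p ∷ []) ∷ (0 ∷ 1 ∷ 3 ∷ p ∷ []) ∷ (0 ∷ 2 ∷ 3 ∷ p ∷ []) ∷ (1 ∷ 2 ∷ 3 ∷ p ∷ []) ∷ [])

  clique-strategy : List Instr
  clique-strategy = attach 4 ++ attach 5 ++ attach 6 ++
    concatMap (λ (p , q) → eq (0 ∷ 1 ∷ p ∷ q ∷ []) [] 1 ∷ eq (0 ∷ 1 ∷ p ∷ q ∷ []) [] 5 ∷ []) ((4 , 5) ∷ (4 , 6) ∷ (5 , 6) ∷ [])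

  clique-facts : List Answer
  clique-facts = map (_, false) (pairsOf (0 ∷ 1 ∷ 2 ∷ 3 ∷ [])) ++ map (_, true) (pairsOf (4 ∷ 5 ∷ 6 ∷ []))

  clique-search : search clique-strategy clique-facts ≡ true
  clique-search = refl

  clique-counts : All (Counts 4 7 (1 ∷ 2 ∷ 4 ∷ 5 ∷ [])) clique-strategy
  clique-counts = from-yes (All.all? (counts? 4 7 (1 ∷ 2 ∷ 4 ∷ 5 ∷ [])) clique-strategy)

module _ {m} (g : Fin m → Fin m → Bool) (symm : ∀ x y → g x y ≡ g y x) (Side : Fin m → Set) where

  open DecMembership {A = Fin m} Fin._≟_ using (_∈?_)

  nonadjacent : ∀ {A x y} → edges g A ≡ 0 → x ∈ A → y ∈ A → x ≢ y → g x y ≡ false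
  nonadjacent {a ∷ A} e (here refl) (here refl) x≢y = ⊥-elim (x≢y refl)
  nonadjacent {a ∷ A} e (here refl) (there j) x≢y = All.lookup (degree≡0⇒ (g a) A (ℕ.m+n≡0⇒m≡0 _ (trans (sym (edges-∷ g a A)) e))) j
  nonadjacent {a ∷ A} e (there i) (here refl) x≢y = trans (symm _ a) (All.lookup (degree≡0⇒ (g a) A (ℕ.m+n≡0⇒m≡0 _ (trans (sym (edges-∷ g a A)) e))) i)
  nonadjacent {a ∷ A} e (there i) (there j) x≢y = nonadjacent (ℕ.m+n≡0⇒n≡0 (degree (g a) A) (trans (sym (edges-∷ g a A)) e)) i j x≢y

  -- The clique `B` shares at most one vertex with the independent set `A`, so it has a triangle
  -- outside `A`. Each vertex of it is joined to none or all of `A`; two of the same kind, with two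
  -- vertices of `A`, span one or five edges.
  no-0-6 : (∀ A → length A ≡ 4 → Unique A → All Side A → edges g A ∉ 1 ∷ 2 ∷ 4 ∷ 5 ∷ []) →
    ∀ A B → length A ≡ 4 → Unique A → All Side A → edges g A ≡ 0 →
            length B ≡ 4 → Unique B → All Side B → edges g B ≡ 6 → ⊥
  no-0-6 none A@(a ∷ b ∷ c ∷ d ∷ []) (w ∷ x ∷ y ∷ z ∷ []) _ uA sA eA _
    ((w≢x ∷ w≢y ∷ w≢z ∷ []) ∷ (x≢y ∷ x≢z ∷ []) ∷ (y≢z ∷ []) ∷ [] ∷ []) (sw ∷ sx ∷ sy ∷ sz ∷ []) eB
    with degree≡length⇒ g (uncurry g) (pairsOf (w ∷ x ∷ y ∷ z ∷ [])) eB
  ... | wx ∷ wy ∷ wz ∷ xy ∷ xz ∷ yz ∷ [] = find-triangle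
    where
    clash : ∀ {u v} → u ∈ A → u ≢ v → g u v ≡ true → v ∉ A
    clash i u≢v uv j = case trans (sym uv) (nonadjacent eA i j u≢v) of λ ()

    triangle-outside : ∀ p q r → p ≢ q → p ≢ r → q ≢ r → Side p → Side q → Side r → p ∉ A → q ∉ A → r ∉ A →
            g p q ≡ true → g p r ≡ true → g q r ≡ true → ⊥
    triangle-outside p q r p≢q p≢r q≢r sp sq sr p∉ q∉ r∉ pq pr qr =
      let uW : Unique (A ++ p ∷ q ∷ r ∷ [])
          uW = Unique.++⁺ uA ((p≢q ∷ p≢r ∷ []) ∷ (q≢r ∷ []) ∷ [] ∷ [])
                 λ { (i , here refl) → p∉ i ; (i , there (here refl)) → q∉ i ; (i , there (there (here refl))) → r∉ i }
          B , ∣B∣ , uB , B⊆ , e = counts⇒set g a uW clique-counts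
            (search-sound (positions g a uW) clique-strategy {K = clique-facts} (facts (degree≡0⇒ (uncurry g) (pairsOf A) eA)) clique-search)
      in none B ∣B∣ uB (All.map (All.lookup (All.++⁺ sA (sp ∷ sq ∷ sr ∷ []))) B⊆) e
      where
      facts : All (λ (x , y) → g x y ≡ false) (pairsOf A) → _
      facts (f₁ ∷ f₂ ∷ f₃ ∷ f₄ ∷ f₅ ∷ f₆ ∷ []) = f₁ ∷ f₂ ∷ f₃ ∷ f₄ ∷ f₅ ∷ f₆ ∷ pq ∷ pr ∷ qr ∷ []

    find-triangle : ⊥
    find-triangle with w ∈? A
    ... | yes i = triangle-outside x y z x≢y x≢z y≢z sx sy sz (clash i w≢x wx) (clash i w≢y wy) (clash i w≢z wz) xy xz yz
    ... | no w∉ with x ∈? A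
    ...   | yes i = triangle-outside w y z w≢y w≢z y≢z sw sy sz w∉ (clash i x≢y xy) (clash i x≢z xz) wy wz yz
    ...   | no x∉ with y ∈? A
    ...     | yes i = triangle-outside w x z w≢x w≢z x≢z sw sx sz w∉ x∉ (clash i y≢z yz) wx wz xz
    ...     | no y∉ = triangle-outside w x y w≢x w≢y x≢y sw sx sy w∉ x∉ y∉ wx wy xy

Forbids : {A : Set} (g : A → A → Bool) (Side : A → Set) → ℕ → List ℕ → Set
Forbids g Side k bs = ∀ A → length A ≡ k → Unique A → All Side A → edges g A ∉ bs

private
  -- Vertex 0 replaces one of the independent vertices 1 to 5. If its degree d into them is between
  -- 1 and 4, both d and d - 1 occur as edge numbers, and one of these is 1 or 3. The outcomes cover
  -- d = 0 and d = 5.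
  join-strategy join-outcomes : List Instr
  join-strategy = map (ask 0) (1 ∷ 2 ∷ 3 ∷ 4 ∷ 5 ∷ []) ++
    concatMap (λ A → eq A [] 1 ∷ eq A [] 3 ∷ [])
      ((0 ∷ 1 ∷ 2 ∷ 3 ∷ 4 ∷ []) ∷ (0 ∷ 1 ∷ 2 ∷ 3 ∷ 5 ∷ []) ∷ (0 ∷ 1 ∷ 2 ∷ 4 ∷ 5 ∷ []) ∷ (0 ∷ 1 ∷ 3 ∷ 4 ∷ 5 ∷ []) ∷ (0 ∷ 2 ∷ 3 ∷ 4 ∷ 5 ∷ []) ∷ [])
  join-outcomes = eq (0 ∷ 1 ∷ 2 ∷ 3 ∷ 4 ∷ 5 ∷ []) [] 0 ∷ eq (0 ∷ 1 ∷ 2 ∷ 3 ∷ 4 ∷ 5 ∷ []) [] 5 ∷ []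

  join-facts : List Answer
  join-facts = map (_, false) (pairsOf (1 ∷ 2 ∷ 3 ∷ 4 ∷ 5 ∷ []))

  join-counts : All (Counts 5 6 (1 ∷ 3 ∷ 5 ∷ [])) join-strategy
  join-counts = from-yes (All.all? (counts? 5 6 (1 ∷ 3 ∷ 5 ∷ [])) join-strategy)

  -- Given the edge 01 and one further edge, dropping an end of the latter among 2, 3, 4 leaves one
  -- edge. The last line lists the other totals, which contradict the total being two.
  drop-strategy : List Instr
  drop-strategy = eq (0 ∷ 1 ∷ 2 ∷ 3 ∷ []) [] 1 ∷ eq (0 ∷ 1 ∷ 2 ∷ 4 ∷ []) [] 1 ∷ eq (0 ∷ 1 ∷ 3 ∷ 4 ∷ []) [] 1 ∷
    map (eq (0 ∷ 1 ∷ 2 ∷ 3 ∷ 4 ∷ []) []) (1 ∷ 3 ∷ 4 ∷ 5 ∷ 6 ∷ 7 ∷ 8 ∷ 9 ∷ 10 ∷ [])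

  drop-questions : List Instr
  drop-questions = map (uncurry ask) ((0 , 2) ∷ (0 , 3) ∷ (0 , 4) ∷ (1 , 2) ∷ (1 , 3) ∷ (1 , 4) ∷ (2 , 3) ∷ (2 , 4) ∷ (3 , 4) ∷ [])

  no-answer : ∀ {h} ps → ¬ Any (Holds h) (map (uncurry ask) ps)
  no-answer (_ ∷ ps) (there i) = no-answer ps i

module _ {m} (g : Fin m → Fin m → Bool) (symm : ∀ x y → g x y ≡ g y x) (Side : Fin m → Set) where

  open DecMembership {A = Fin m} Fin._≟_ using (_∈?_)

  private
    four-with-one-edge : ∀ B → length B ≡ 5 → Unique B → All Side B → edges g B ≡ 2 →
      ∃[ x ] ∃[ y ] ∃[ u ] ∃[ w ] Unique (x ∷ y ∷ u ∷ w ∷ []) × All Side (x ∷ y ∷ u ∷ w ∷ []) × g x y ≡ true ×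
        All (λ (u , v) → g u v ≡ false) ((x , u) ∷ (x , w) ∷ (y , u) ∷ (y , w) ∷ (u , w) ∷ [])
    four-with-one-edge B ∣B∣ uB sB eB with edge-front g B (λ q → case trans (sym q) eB of λ ())
    ... | x , y , R , p , xy with three R (ℕ.suc-injective (ℕ.suc-injective (trans (sym (↭-length p)) ∣B∣)))
    ... | a , b , c , refl with Unique-resp-↭ p uB | All-resp-↭ p sB
    ...   | uW@((x≢y ∷ x≢a ∷ x≢b ∷ x≢c ∷ []) ∷ (y≢a ∷ y≢b ∷ y≢c ∷ []) ∷ (a≢b ∷ a≢c ∷ []) ∷ (b≢c ∷ []) ∷ [] ∷ []) | sx ∷ sy ∷ sa ∷ sb ∷ sc ∷ []
      with Any.++⁻ drop-questions (search-sound (positions g x uW) (drop-questions ++ drop-strategy) {K = ((0 , 1) , true) ∷ []} (xy ∷ []) refl)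
    ... | inj₁ i = ⊥-elim (no-answer _ i)
    ... | inj₂ (here e) = x , y , a , b , (x≢y ∷ x≢a ∷ x≢b ∷ []) ∷ (y≢a ∷ y≢b ∷ []) ∷ (a≢b ∷ []) ∷ [] ∷ [] , sx ∷ sy ∷ sa ∷ sb ∷ []
            , xy , degree≡0⇒ (uncurry g) _ (remaining g (a ∷ b ∷ []) e xy)
    ... | inj₂ (there (here e)) = x , y , a , c , (x≢y ∷ x≢a ∷ x≢c ∷ []) ∷ (y≢a ∷ y≢c ∷ []) ∷ (a≢c ∷ []) ∷ [] ∷ [] , sx ∷ sy ∷ sa ∷ sc ∷ []
            , xy , degree≡0⇒ (uncurry g) _ (remaining g (a ∷ c ∷ []) e xy)
    ... | inj₂ (there (there (here e))) = x , y , b , c , (x≢y ∷ x≢b ∷ x≢c ∷ []) ∷ (y≢b ∷ y≢c ∷ []) ∷ (b≢c ∷ []) ∷ [] ∷ [] , sx ∷ sy ∷ sb ∷ sc ∷ []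
            , xy , degree≡0⇒ (uncurry g) _ (remaining g (b ∷ c ∷ []) e xy)
    ... | inj₂ (there (there (there i))) = ⊥-elim (other (1 ∷ 3 ∷ 4 ∷ 5 ∷ 6 ∷ 7 ∷ 8 ∷ 9 ∷ 10 ∷ []) ((λ ()) ∷ (λ ()) ∷ (λ ()) ∷ (λ ()) ∷ (λ ()) ∷ (λ ()) ∷ (λ ()) ∷ (λ ()) ∷ (λ ()) ∷ []) i)
      where
      other : ∀ bs → All (2 ≢_) bs → ¬ Any (Holds (positions g x uW)) (map (eq (0 ∷ 1 ∷ 2 ∷ 3 ∷ 4 ∷ []) []) bs)
      other (b ∷ bs) (q ∷ _)  (here e)  = q (trans (sym eB) (trans (edges-↭ symm p) e))
      other (b ∷ bs) (_ ∷ qs) (there i) = other bs qs i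

  -- Exchanging one vertex of the independent set A shows that every other vertex of the side is joined
  -- to none or to all of A; deleting a vertex from B leaves four vertices spanning one edge, all of them
  -- joined to all of A, and adding a vertex of A to these gives five edges.
  no-0-2 : Forbids g Side 5 (1 ∷ 3 ∷ 5 ∷ []) →
    ∀ A B → length A ≡ 5 → Unique A → All Side A → edges g A ≡ 0 →
            length B ≡ 5 → Unique B → All Side B → edges g B ≡ 2 → ⊥
  no-0-2 none A@(a ∷ b ∷ c ∷ d ∷ e ∷ []) B _ uA@((a≢b ∷ a≢c ∷ _) ∷ (b≢c ∷ _) ∷ _) sA@(sa ∷ sb ∷ sc ∷ _) eA ∣B∣ uB sB eB
    with degree≡0⇒ (uncurry g) (pairsOf A) eA
  ... | ab ∷ ac ∷ ad ∷ ae ∷ bc ∷ bd ∷ be ∷ cd ∷ ce ∷ de ∷ [] =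
    let x , y , u , w , uW , sW , xy , no-edge = four-with-one-edge B ∣B∣ uB sB eB
    in contradict uW sW xy no-edge
    where
    Zero Full : Fin m → Set
    Zero p = All (λ a → g p a ≡ false) A
    Full p = All (λ a → g p a ≡ true) A

    data Type (p : Fin m) : Set where
      inner : p ∈ A → Type p
      zero  : p ∉ A → Zero p → Type p
      full  : p ∉ A → Full p → Type p

    cons : ∀ {p} → p ∉ A → Unique (p ∷ A)
    cons p∉ = All.tabulate (λ { i refl → p∉ i }) ∷ uA

    degree-part : ∀ p → degree (g p) A ≡ edges g (p ∷ A)
    degree-part p = sym (trans (edges-∷ g p A) (trans (cong (degree (g p) A +_) eA) (ℕ.+-identityʳ _)))

    type : ∀ p → Side p → Type p
    type p sp with p ∈? A
    ... | yes i = inner i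
    ... | no p∉ with Any.++⁻ join-strategy (search-sound (positions g p (cons p∉)) (join-strategy ++ join-outcomes) {K = join-facts}
        (ab ∷ ac ∷ ad ∷ ae ∷ bc ∷ bd ∷ be ∷ cd ∷ ce ∷ de ∷ []) refl)
    ...   | inj₁ i = let D , ∣D∣ , uD , D⊆ , q = counts⇒set g p (cons p∉) join-counts i
                     in ⊥-elim (none D ∣D∣ uD (All.map (All.lookup (sp ∷ sA)) D⊆) q)
    ...   | inj₂ (here q) = zero p∉ (degree≡0⇒ (g p) A (trans (degree-part p) q))
    ...   | inj₂ (there (here q)) = full p∉ (degree≡length⇒ g (g p) A (trans (degree-part p) q))

    pair : ∀ {p q} → p ∉ A → q ∉ A → p ≢ q → Unique (p ∷ q ∷ a ∷ b ∷ c ∷ [])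
    pair p∉ q∉ p≢q = (p≢q ∷ avoids p∉) ∷ avoids q∉ ∷ (a≢b ∷ a≢c ∷ []) ∷ (b≢c ∷ []) ∷ [] ∷ []
      where
      avoids : ∀ {p} → p ∉ A → All (p ≢_) (a ∷ b ∷ c ∷ [])
      avoids p∉ = (λ { refl → p∉ (here refl) }) ∷ (λ { refl → p∉ (there (here refl)) }) ∷ (λ { refl → p∉ (there (there (here refl))) }) ∷ []

    pair-facts : Bool → Bool → List Answer
    pair-facts r s = ((0 , 1) , r) ∷ ((0 , 2) , false) ∷ ((0 , 3) , false) ∷ ((0 , 4) , false) ∷ ((1 , 2) , s) ∷ ((1 , 3) , s) ∷ ((1 , 4) , s)
      ∷ ((2 , 3) , false) ∷ ((2 , 4) , false) ∷ ((3 , 4) , false) ∷ []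

    -- Otherwise `p`, `q` and three vertices of `A` span the single edge `p q`.
    zero-zero : ∀ {p q} → p ≢ q → Side p → Side q → p ∉ A → q ∉ A → Zero p → Zero q → g p q ≢ true
    zero-zero {p} {q} p≢q sp sq p∉ q∉ (pa ∷ pb ∷ pc ∷ _) (qa ∷ qb ∷ qc ∷ _) pq =
      none (p ∷ q ∷ a ∷ b ∷ c ∷ []) refl (pair p∉ q∉ p≢q) (sp ∷ sq ∷ sa ∷ sb ∷ sc ∷ [])
        (here (count-sound (positions g p (pair p∉ q∉ p≢q)) {K = pair-facts true false} (pairsOf (0 ∷ 1 ∷ 2 ∷ 3 ∷ 4 ∷ []))
          (pq ∷ pa ∷ pb ∷ pc ∷ qa ∷ qb ∷ qc ∷ ab ∷ ac ∷ bc ∷ []) refl))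

    -- Otherwise `p`, `q` and three vertices of `A` span exactly the three edges at `q`.
    zero-full : ∀ {p q} → p ≢ q → Side p → Side q → p ∉ A → q ∉ A → Zero p → Full q → g p q ≢ false
    zero-full {p} {q} p≢q sp sq p∉ q∉ (pa ∷ pb ∷ pc ∷ _) (qa ∷ qb ∷ qc ∷ _) pq =
      none (p ∷ q ∷ a ∷ b ∷ c ∷ []) refl (pair p∉ q∉ p≢q) (sp ∷ sq ∷ sa ∷ sb ∷ sc ∷ [])
        (there (here (count-sound (positions g p (pair p∉ q∉ p≢q)) {K = pair-facts false true} (pairsOf (0 ∷ 1 ∷ 2 ∷ 3 ∷ 4 ∷ []))
          (pq ∷ pa ∷ pb ∷ pc ∷ qa ∷ qb ∷ qc ∷ ab ∷ ac ∷ bc ∷ []) refl)))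

    beside-full : ∀ {p q} → p ≢ q → Side p → Side q → p ∉ A → Full p → g p q ≡ false → q ∉ A × Full q
    beside-full {p} {q} p≢q sp sq p∉ fp pq with type q sq
    ... | inner i  = case trans (sym (All.lookup fp i)) pq of λ ()
    ... | zero n z = ⊥-elim (zero-full (p≢q ∘ sym) sq sp n p∉ z fp (trans (symm q p) pq))
    ... | full n f = n , f

    one-full : ∀ {p q} → p ≢ q → Side p → Side q → g p q ≡ true → (p ∉ A × Full p) ⊎ (q ∉ A × Full q)
    one-full {p} {q} p≢q sp sq pq with type p sp | type q sq
    ... | full n f | _        = inj₁ (n , f)
    ... | _        | full n f = inj₂ (n , f)
    ... | inner i  | inner j  = case trans (sym pq) (nonadjacent g symm Side {A = A} eA i j p≢q) of λ ()
    ... | inner i  | zero n z = case trans (sym pq) (trans (symm p q) (All.lookup z i)) of λ ()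
    ... | zero n z | inner j  = case trans (sym pq) (All.lookup z j) of λ ()
    ... | zero n z | zero n′ z′ = ⊥-elim (zero-zero p≢q sp sq n n′ z z′ pq)

    all-full : ∀ {x y u w} → Unique (x ∷ y ∷ u ∷ w ∷ []) → All Side (x ∷ y ∷ u ∷ w ∷ []) → g x y ≡ true → All (λ (u , v) → g u v ≡ false) ((x , u) ∷ (x , w) ∷ (y , u) ∷ (y , w) ∷ (u , w) ∷ []) →
      x ∉ A × Full x → ⊥
    all-full {x} {y} {u} {w} uW@((x≢y ∷ x≢u ∷ x≢w ∷ []) ∷ (y≢u ∷ y≢w ∷ []) ∷ (u≢w ∷ []) ∷ [] ∷ []) (sx ∷ sy ∷ su ∷ sw ∷ []) xy (xu ∷ xw ∷ yu ∷ yw ∷ uw ∷ []) (nx , fx) =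
      let nu , fu = beside-full x≢u sx su nx fx xu
          nw , fw = beside-full x≢w sx sw nx fx xw
          ny , fy = beside-full (y≢u ∘ sym) su sy nu fu (trans (symm u y) yu)
          uV : Unique (a ∷ x ∷ y ∷ u ∷ w ∷ [])
          uV = ((λ { refl → nx (here refl) }) ∷ (λ { refl → ny (here refl) }) ∷ (λ { refl → nu (here refl) }) ∷ (λ { refl → nw (here refl) }) ∷ []) ∷ uW
          to-a : ∀ {p} → Full p → g a p ≡ true
          to-a {p} f = trans (symm a p) (All.head f)
      in none (a ∷ x ∷ y ∷ u ∷ w ∷ []) refl uV (sa ∷ sx ∷ sy ∷ su ∷ sw ∷ [])
        (there (there (here (count-sound (positions g a uV) {K = full-facts} (pairsOf (0 ∷ 1 ∷ 2 ∷ 3 ∷ 4 ∷ []))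
          (to-a fx ∷ to-a fy ∷ to-a fu ∷ to-a fw ∷ xy ∷ xu ∷ xw ∷ yu ∷ yw ∷ uw ∷ []) refl))))
      where
      full-facts : List Answer
      full-facts = ((0 , 1) , true) ∷ ((0 , 2) , true) ∷ ((0 , 3) , true) ∷ ((0 , 4) , true) ∷ ((1 , 2) , true) ∷
        map (_, false) ((1 , 3) ∷ (1 , 4) ∷ (2 , 3) ∷ (2 , 4) ∷ (3 , 4) ∷ [])

    contradict : ∀ {x y u w} → Unique (x ∷ y ∷ u ∷ w ∷ []) → All Side (x ∷ y ∷ u ∷ w ∷ []) → g x y ≡ true → All (λ (u , v) → g u v ≡ false) ((x , u) ∷ (x , w) ∷ (y , u) ∷ (y , w) ∷ (u , w) ∷ []) → ⊥
    contradict {x} {y} uW@((x≢y ∷ x≢u ∷ x≢w ∷ []) ∷ (y≢u ∷ y≢w ∷ []) ∷ rest) sW@(sx ∷ sy ∷ sr) xy no-edge@(xu ∷ xw ∷ yu ∷ yw ∷ uw)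
      with one-full x≢y sx sy xy
    ... | inj₁ f = all-full uW sW xy no-edge f
    ... | inj₂ f = all-full (((x≢y ∘ sym) ∷ y≢u ∷ y≢w ∷ []) ∷ (x≢u ∷ x≢w ∷ []) ∷ rest) (sy ∷ sx ∷ sr) (trans (symm y x) xy) (yu ∷ yw ∷ xu ∷ xw ∷ uw) f

-- Unavoidable patterns in words

private
  -- `spell` begins with the highest letter, hence the reversal.
  letterAt : List (Maybe Bool) → ℕ → Maybe Bool
  letterAt w = at nothing (List.reverse w)

  -- The situations that `equalPair-1-2`, `no-0-6` and `no-0-2` refute. Only the absence from side
  -- `s` is asked of the other letters, since the exchanges stay on that side.
  Pattern4 Pattern5 : (ℕ → Maybe Bool) → Bool → Set
  Pattern4 l s = (l 1 ≡ just s × l 2 ≡ just (not s)) ⊎ (l 5 ≡ just s × l 4 ≡ just (not s)) ⊎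
    (l 0 ≡ just s × l 6 ≡ just s × l 1 ≢ just s × l 2 ≢ just s × l 4 ≢ just s × l 5 ≢ just s)
  Pattern5 l s = (l 0 ≡ just s × l 2 ≡ just s × l 1 ≢ just s × l 3 ≢ just s × l 5 ≢ just s) ⊎
    (l 10 ≡ just s × l 8 ≡ just s × l 9 ≢ just s × l 7 ≢ just s × l 5 ≢ just s)

  _≟ₗ_ : (x y : Maybe Bool) → Dec (x ≡ y)
  _≟ₗ_ = ≡-dec Bool._≟_

  pattern4? : ∀ l s → Dec (Pattern4 l s)
  pattern4? l s = (l 1 ≟ₗ just s ×-dec l 2 ≟ₗ just (not s)) ⊎-dec (l 5 ≟ₗ just s ×-dec l 4 ≟ₗ just (not s)) ⊎-dec
    (l 0 ≟ₗ just s ×-dec l 6 ≟ₗ just s ×-dec ¬? (l 1 ≟ₗ just s) ×-dec ¬? (l 2 ≟ₗ just s) ×-dec ¬? (l 4 ≟ₗ just s) ×-dec ¬? (l 5 ≟ₗ just s))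

  pattern5? : ∀ l s → Dec (Pattern5 l s)
  pattern5? l s = (l 0 ≟ₗ just s ×-dec l 2 ≟ₗ just s ×-dec ¬? (l 1 ≟ₗ just s) ×-dec ¬? (l 3 ≟ₗ just s) ×-dec ¬? (l 5 ≟ₗ just s)) ⊎-dec
    (l 10 ≟ₗ just s ×-dec l 8 ≟ₗ just s ×-dec ¬? (l 9 ≟ₗ just s) ×-dec ¬? (l 7 ≟ₗ just s) ×-dec ¬? (l 5 ≟ₗ just s))

  either? : {P : (ℕ → Maybe Bool) → Bool → Set} → (∀ l s → Dec (P l s)) → ∀ l → Dec (P l true ⊎ P l false)
  either? P? l = P? l true ⊎-dec P? l false

  either : ∀ {P : Bool → Set} → P true ⊎ P false → ∃ P
  either (inj₁ p) = true , p
  either (inj₂ p) = false , p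

  witness : {P : Set} (P? : Dec P) → ⌊ P? ⌋ ≡ true → P
  witness (yes p) _ = p

  -- The words have one letter for each number of edges a k-set can have; the second alternative of a
  -- pattern is the first one for the complementary graph.
  pattern4-unavoidable : ∀ l → 5 ≤ blocks (spell l 7) → ∃ (Pattern4 l)
  pattern4-unavoidable l le = either (witness (either? pattern4? (letterAt (spell l 7)))
    (allWords-sound 7 5 (λ w → ⌊ either? pattern4? (letterAt w) ⌋) l 0 refl le))

  pattern5-unavoidable : ∀ l → 10 ≤ blocks (spell l 11) → ∃ (Pattern5 l)
  pattern5-unavoidable l le = either (witness (either? pattern5? (letterAt (spell l 11)))
    (allWords-sound 11 10 (λ w → ⌊ either? pattern5? (letterAt w) ⌋) l 0 refl le))

complement : {V : Set} → (V → V → Bool) → V → V → Bool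
complement g x y = not (g x y)

edges-complement : ∀ {V : Set} (g : V → V → Bool) A {k e} → length A ≡ k → edges g A ≡ e → edges (complement g) A ≡ k C 2 ∸ e
edges-complement g A refl refl = sym (trans (cong (_∸ edges g A) (sym (edges-not g A))) (ℕ.m+n∸n≡m _ (edges g A)))

edges-complement⁻ : ∀ {V : Set} (g : V → V → Bool) A {k e} → length A ≡ k → edges (complement g) A ≡ e → edges g A ≡ k C 2 ∸ e
edges-complement⁻ g A refl refl = sym (trans (cong (_∸ edges (complement g) A) (sym (edges-not g A))) (ℕ.m+n∸m≡n (edges (complement g) A) _))

equalPair-complement : ∀ {V : Set} (g : V → V → Bool) {k} → EqualPair (complement g) k → EqualPair g k
equalPair-complement g (A , B , ∣A∣ , ∣B∣ , u , e) = A , B , ∣A∣ , ∣B∣ , u ,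
  trans (edges-complement⁻ g A ∣A∣ e) (sym (edges-complement⁻ g B ∣B∣ refl))

-- Here 11 = 3² + 2 is the size of the closed neighbourhood, and 4 = 11 + 1 - 2 · 4 is the number of
-- blocks that can be allowed.
equalSets-4 : EqualSets 11 4
equalSets-4 g symm = equalPair-zigzag g symm 4 4 (s≤s z≤n) ℕ.≤-refl few
  where
  few : (S : Split g symm 4) → blocks (spell (Split.letter S) 7) ≤ 4
  few S = ℕ.≮⇒≥ λ le → let s , p = pattern4-unavoidable letter le in absurd s p
    where
    open Split S
    disjoint : ∀ {s A B} → Unique A → Unique B → All (Side s) A → All (Side (not s)) B → Unique (A ++ B)
    disjoint uA uB sA sB = Unique.++⁺ uA uB λ (i , j) → apart (All.lookup sA i) (All.lookup sB j) refl
    absurd : ∀ s → Pattern4 letter s → ⊥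
    absurd s (inj₁ (l₁ , l₂)) =
      let A , ∣A∣ , uA , sA , eA = letter⁻ l₁ ; B , ∣B∣ , uB , sB , eB = letter⁻ l₂
      in unequal (equalPair-1-2 g symm A B (ℕ.n≤1+n 10) ∣A∣ ∣B∣ (disjoint uA uB sA sB) eA eB)
    absurd s (inj₂ (inj₁ (l₅ , l₄))) =
      let A , ∣A∣ , uA , sA , eA = letter⁻ l₅ ; B , ∣B∣ , uB , sB , eB = letter⁻ l₄
      in unequal (equalPair-complement g (equalPair-1-2 (complement g) (λ x y → cong not (symm x y)) A B (ℕ.n≤1+n 10) ∣A∣ ∣B∣
           (disjoint uA uB sA sB) (edges-complement g A ∣A∣ eA) (edges-complement g B ∣B∣ eB)))
    absurd s (inj₂ (inj₂ (l₀ , l₆ , n₁ , n₂ , n₄ , n₅))) =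
      let A , ∣A∣ , uA , sA , eA = letter⁻ l₀ ; B , ∣B∣ , uB , sB , eB = letter⁻ l₆
      in no-0-6 g symm (Side s) (λ { D ∣D∣ uD sD (here e) → n₁ (subst (λ b → letter b ≡ just s) e (letter⁺ ∣D∣ uD sD))
                                  ; D ∣D∣ uD sD (there (here e)) → n₂ (subst (λ b → letter b ≡ just s) e (letter⁺ ∣D∣ uD sD))
                                  ; D ∣D∣ uD sD (there (there (here e))) → n₄ (subst (λ b → letter b ≡ just s) e (letter⁺ ∣D∣ uD sD))
                                  ; D ∣D∣ uD sD (there (there (there (here e)))) → n₅ (subst (λ b → letter b ≡ just s) e (letter⁺ ∣D∣ uD sD)) })
           A B ∣A∣ uA sA eA ∣B∣ uB sB eB

-- Likewise 18 = 4² + 2, and 9 = 18 + 1 - 2 · 5 blocks can be allowed out of 11 letters.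
equalSets-5 : EqualSets 18 5
equalSets-5 g symm = equalPair-zigzag g symm 5 9 (s≤s z≤n) ℕ.≤-refl few
  where
  few : (S : Split g symm 5) → blocks (spell (Split.letter S) 11) ≤ 9
  few S = ℕ.≮⇒≥ λ le → let s , p = pattern5-unavoidable letter le in absurd s p
    where
    open Split S
    present : ∀ s D {b} → length D ≡ 5 → Unique D → All (Side s) D → edges g D ≡ b → letter b ≡ just s
    present s D ∣D∣ uD sD refl = letter⁺ ∣D∣ uD sD
    absurd : ∀ s → Pattern5 letter s → ⊥
    absurd s (inj₁ (l₀ , l₂ , n₁ , n₃ , n₅)) =
      let A , ∣A∣ , uA , sA , eA = letter⁻ l₀ ; B , ∣B∣ , uB , sB , eB = letter⁻ l₂
      in no-0-2 g symm (Side s)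
           (λ { D ∣D∣ uD sD (here e) → n₁ (present s D ∣D∣ uD sD e)
              ; D ∣D∣ uD sD (there (here e)) → n₃ (present s D ∣D∣ uD sD e)
              ; D ∣D∣ uD sD (there (there (here e))) → n₅ (present s D ∣D∣ uD sD e) })
           A B ∣A∣ uA sA eA ∣B∣ uB sB eB
    absurd s (inj₂ (l₁₀ , l₈ , n₉ , n₇ , n₅)) =
      let A , ∣A∣ , uA , sA , eA = letter⁻ l₁₀ ; B , ∣B∣ , uB , sB , eB = letter⁻ l₈
      in no-0-2 (complement g) (λ x y → cong not (symm x y)) (Side s)
           (λ { D ∣D∣ uD sD (here e) → n₉ (present s D ∣D∣ uD sD (edges-complement⁻ g D ∣D∣ e))
              ; D ∣D∣ uD sD (there (here e)) → n₇ (present s D ∣D∣ uD sD (edges-complement⁻ g D ∣D∣ e))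
              ; D ∣D∣ uD sD (there (there (here e))) → n₅ (present s D ∣D∣ uD sD (edges-complement⁻ g D ∣D∣ e)) })
           A B ∣A∣ uA sA (edges-complement g A ∣A∣ eA) ∣B∣ uB sB (edges-complement g B ∣B∣ eB)

open +-*-Solver using (solve; _:+_; _:*_; _:=_; con)

-- Degrees

∑ : List A → (A → ℕ) → ℕ
∑ xs f = sum (map f xs)

∑-cong : {f g : A → ℕ} → f ≗ g → ∀ xs → ∑ xs f ≡ ∑ xs g
∑-cong h xs = cong sum (map-cong h xs)

∑-+ : (f g : A → ℕ) → ∀ xs → ∑ xs (λ x → f x + g x) ≡ ∑ xs f + ∑ xs g
∑-+ f g []       = refl
∑-+ f g (x ∷ xs) = trans (cong (f x + g x +_) (∑-+ f g xs))
  (solve 4 (λ a b c d → a :+ b :+ (c :+ d) := a :+ c :+ (b :+ d)) refl (f x) (g x) (∑ xs f) (∑ xs g))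

∑-zero : (xs : List A) → ∑ xs (λ _ → 0) ≡ 0
∑-zero []       = refl
∑-zero (x ∷ xs) = ∑-zero xs

∑-swap : (f : A → B → ℕ) → ∀ xs ys → ∑ xs (λ x → ∑ ys (f x)) ≡ ∑ ys (λ y → ∑ xs (λ x → f x y))
∑-swap f []       ys = sym (∑-zero ys)
∑-swap f (x ∷ xs) ys = trans (cong (∑ ys (f x) +_) (∑-swap f xs ys)) (sym (∑-+ (f x) (λ y → ∑ xs (λ x → f x y)) ys))

∑-cartesianProduct : (f : A × B → ℕ) → ∀ xs ys → ∑ (cartesianProduct xs ys) f ≡ ∑ xs (λ x → ∑ ys (λ y → f (x , y)))
∑-cartesianProduct f []       ys = refl
∑-cartesianProduct f (x ∷ xs) ys = trans (cong sum (map-++ f (map (x ,_) ys) (cartesianProduct xs ys)))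
  (trans (sum-++ (map f (map (x ,_) ys)) _) (cong₂ _+_ (cong sum (sym (map-∘ ys))) (∑-cartesianProduct f xs ys)))

exceeds-average : (f : A → ℕ) (c : ℕ) (xs : List A) → length xs * c < ∑ xs f → ∃[ x ] x ∈ xs × c < f x
exceeds-average f c (x ∷ xs) lt with c ℕ.<? f x
... | yes c<fx = x , here refl , c<fx
... | no c≮fx  = let y , i , p = exceeds-average f c xs (ℕ.+-cancelˡ-< c _ _ (ℕ.<-≤-trans lt (ℕ.+-monoˡ-≤ _ (ℕ.≮⇒≥ c≮fx))))
                 in y , there i , p

remove : {x : A} {xs : List A} → x ∈ xs → ∃[ ys ] xs ↭ x ∷ ys
remove {x = x} i = let ys , zs , e = ∈-∃++ i in ys ++ zs , ↭-trans (↭-reflexive e) (shift x ys zs)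

select : (p : A → Bool) → ∀ k xs → k ≤ degree p xs → ∃[ X ] ∃[ R ] xs ↭ X ++ R × length X ≡ k × All (λ x → p x ≡ true) X
select p zero    xs       _  = [] , xs , ↭-refl , refl , []
select p (suc k) (x ∷ xs) le with p x in e
... | true  = let X , R , r , ∣X∣ , h = select p k xs (s≤s⁻¹ le) in x ∷ X , R , prep x r , cong suc ∣X∣ , e ∷ h
... | false = let X , R , r , ∣X∣ , h = select p (suc k) xs le in X , x ∷ R , ↭-trans (prep x r) (↭-sym (shift x X R)) , ∣X∣ , h

select₁ : (p : A → Bool) → ∀ xs → 1 ≤ degree p xs → ∃[ x ] ∃[ R ] xs ↭ x ∷ R × p x ≡ true
select₁ p xs le with select p 1 xs le
... | x ∷ [] , R , r , _ , h ∷ [] = x , R , r , h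

select₂ : (p : A → Bool) → ∀ xs → 2 ≤ degree p xs → ∃[ x ] ∃[ y ] ∃[ R ] xs ↭ x ∷ y ∷ R × p x ≡ true × p y ≡ true
select₂ p xs le with select p 2 xs le
... | x ∷ y ∷ [] , R , r , _ , h ∷ h′ ∷ [] = x , y , R , r , h , h′

pair-front : (g : A → A → Bool) → ∀ xs → (∃[ x ] ∃[ y ] ∃[ R ] xs ↭ x ∷ y ∷ R × g x y ≡ true) ⊎ AllPairs (λ x y → g x y ≡ false) xs
pair-front g xs with edges g xs ℕ.≟ 0
... | no e≢0 = inj₁ (edge-front g xs e≢0)
... | yes e  = inj₂ (go xs e)
  where
  go : ∀ xs → edges g xs ≡ 0 → AllPairs (λ x y → g x y ≡ false) xs
  go []       e = []
  go (x ∷ xs) e = degree≡0⇒ (g x) xs (ℕ.m+n≡0⇒m≡0 _ (trans (sym (edges-∷ g x xs)) e))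
                ∷ go xs (ℕ.m+n≡0⇒n≡0 (degree (g x) xs) (trans (sym (edges-∷ g x xs)) e))

bits-↭ : (bs : List Bool) → bs ↭ replicate (degree id bs) true ++ replicate (degree not bs) false
bits-↭ []           = refl
bits-↭ (true ∷ bs)  = prep true (bits-↭ bs)
bits-↭ (false ∷ bs) = ↭-trans (prep false (bits-↭ bs)) (↭-sym (shift false (replicate (degree id bs) true) _))

same-bits : (bs cs : List Bool) → length bs ≡ length cs → degree id bs ≡ degree id cs → bs ↭ cs
same-bits bs cs l e = ↭-trans (bits-↭ bs) (↭-trans (↭-reflexive (cong₂ (λ i j → replicate i true ++ replicate j false) e
    (ℕ.+-cancelʳ-≡ (degree id bs) _ _ (trans (degree-not id bs) (trans l (trans (sym (degree-not id cs)) (cong (degree not cs +_) (sym e))))))))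
  (↭-sym (bits-↭ cs)))

-- Closed neighbourhoods and dense subgraphs

module _ {n} (G : Graph n) (connected : Connected G) where
  open Metric G connected

  private
    V = Fin n
    _~_ : V → V → Bool
    _~_ = adj G

  Close : V → V → Set
  Close u w = u ~ w ≡ true ⊎ (∃[ z ] u ~ z ≡ true × z ~ w ≡ true)

  dist-close : ∀ {u w} → u ≢ w → Close u w → dist u w ≡ (if u ~ w then 1 else 2)
  dist-close {u} {w} u≢w c with u ~ w in e
  ... | true = sym (dist-unique (step e here , λ { zero _ here → u≢w refl ; (suc _) (s≤s ()) _ }))
  dist-close {u} {w} u≢w (inj₁ ()) | false
  dist-close {u} {w} u≢w (inj₂ (z , a , b)) | false = sym (dist-unique (step a (step b here) , shortest))
    where
    shortest : ∀ m → m < 2 → ¬ Walk G u w m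
    shortest zero          _ here            = u≢w refl
    shortest (suc zero)    _ (step a here)   = case trans (sym a) e of λ ()
    shortest (suc (suc _)) (s≤s (s≤s ())) _

  distances-close : ∀ {S} → Unique S → AllPairs Close S → distances S ≡ map (λ b → if b then 1 else 2) (map (uncurry _~_) (pairsOf S))
  distances-close {S} u c = trans (map-cong-local (All.zipWith (λ (p , q) → dist-close p q) (All-pairsOf u , All-pairsOf c))) (map-∘ (pairsOf S))

  homPair-close : ∀ {h} S T → length S ≡ h → length T ≡ h → Unique (S ++ T) → AllPairs Close S → AllPairs Close T →
    edges _~_ S ≡ edges _~_ T → HasHomPair G h
  homPair-close S T refl ∣T∣ u cS cT e = let uS , uT , _ = Unique-++⁻ S u in homPair S T refl ∣T∣ u
    (↭-trans (↭-reflexive (distances-close uS cS)) (↭-trans (map⁺ _ (same-bits _ _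
        (trans (length-map _ (pairsOf S)) (trans (trans (length-pairsOf S) (trans (cong (λ l → l C 2) (sym ∣T∣)) (sym (length-pairsOf T)))) (sym (length-map _ (pairsOf T)))))
        (trans (degree-map id (uncurry _~_) (pairsOf S)) (trans e (sym (degree-map id (uncurry _~_) (pairsOf T)))))))
      (↭-reflexive (sym (distances-close uT cT)))))

  Star : V → List V → Set
  Star v W = ∀ {x} → x ∈ W → x ≡ v ⊎ v ~ x ≡ true

  star-close : ∀ {v W} → Star v W → ∀ {S} → Unique S → All (_∈ W) S → AllPairs Close S
  star-close st []       []       = []
  star-close {v} {W} st (x∉ ∷ u) (i ∷ is) = All.zipWith (λ (x≢y , j) → close x≢y (st i) (st j)) (x∉ , is) ∷ star-close st u is
    where
    close : ∀ {x y} → x ≢ y → x ≡ v ⊎ v ~ x ≡ true → y ≡ v ⊎ v ~ y ≡ true → Close x y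
    close x≢y (inj₁ refl) (inj₁ refl) = ⊥-elim (x≢y refl)
    close x≢y (inj₁ refl) (inj₂ a)    = inj₁ a
    close {x} x≢y (inj₂ a) (inj₁ refl) = inj₁ (trans (symm G x v) a)
    close {x} x≢y (inj₂ a) (inj₂ b)   = inj₂ (v , trans (symm G x v) a , b)

  neighbourhood : ∀ v X → All (λ x → v ~ x ≡ true) X → Unique X → Star v (v ∷ X) × Unique (v ∷ X)
  neighbourhood v X a u = (λ { (here e) → inj₁ e ; (there i) → inj₂ (All.lookup a i) })
    , All.map (λ { b refl → case trans (sym b) (irrefl G v) of λ () }) a ∷ u

  homPair-star : ∀ {r k} v → EqualSets (suc r) k → r ≤ degree (v ~_) (allFin n) → HasHomPair G k
  homPair-star {r} {k} v equalSets le =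
    let X , R , p , ∣X∣ , a = select (v ~_) r (allFin n) le
    in build X ∣X∣ (neighbourhood v X a (proj₁ (Unique-++⁻ X (Unique-resp-↭ p (Unique.allFin⁺ n)))))
    where
    build : ∀ X → length X ≡ r → Star v (v ∷ X) × Unique (v ∷ X) → HasHomPair G k
    build X refl (st , uW) =
      let f = lookup (v ∷ X)
          S , T , ∣S∣ , ∣T∣ , u , e = equalSets (λ i j → f i ~ f j) (λ i j → symm G (f i) (f j))
          u′ = subst Unique (map-++ f S T) (Unique.map⁺ (lookup-injective uW _ _) u)
          uS , uT , _ = Unique-++⁻ (map f S) u′
      in homPair-close (map f S) (map f T) (trans (length-map f S) ∣S∣) (trans (length-map f T) ∣T∣) u′
           (star-close st uS (All.map⁺ (All.universal (λ i → ∈-lookup i) S)))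
           (star-close st uT (All.map⁺ (All.universal (λ i → ∈-lookup i) T)))
           (trans (edges-map _~_ f S) (trans e (sym (edges-map _~_ f T))))

  total : List V → ℕ
  total L = ∑ L (λ v → degree (v ~_) L)

  total-∷ : ∀ v L → total (v ∷ L) ≡ degree (v ~_) L + degree (v ~_) L + total L
  total-∷ v L = begin
    bit (v ~ v) + degree (v ~_) L + ∑ L (λ u → bit (u ~ v) + degree (u ~_) L)
      ≡⟨ cong₂ (λ b s → bit b + degree (v ~_) L + s) (irrefl G v) (∑-+ (λ u → bit (u ~ v)) _ L) ⟩
    degree (v ~_) L + (∑ L (λ u → bit (u ~ v)) + total L)
      ≡⟨ cong (λ s → degree (v ~_) L + (s + total L)) (∑-cong (λ u → cong bit (symm G u v)) L) ⟩
    degree (v ~_) L + (degree (v ~_) L + total L)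
      ≡⟨ ℕ.+-assoc (degree (v ~_) L) _ _ ⟨
    degree (v ~_) L + degree (v ~_) L + total L ∎
    where open ≡-Reasoning

  total-↭ : ∀ {L M} → L ↭ M → total L ≡ total M
  total-↭ {L} p = trans (∑-cong (λ v → degree-↭ (v ~_) p) L) (sum-↭ (map⁺ _ p))

  total≡2edges : ∀ L → total L ≡ edges _~_ L + edges _~_ L
  total≡2edges []      = refl
  total≡2edges (v ∷ L) = trans (total-∷ v L) (trans (cong (degree (v ~_) L + degree (v ~_) L +_) (total≡2edges L))
    (trans (solve 2 (λ a b → a :+ a :+ (b :+ b) := a :+ b :+ (a :+ b)) refl (degree (v ~_) L) (edges _~_ L))
      (cong (λ s → s + s) (sym (edges-∷ _~_ v L)))))

  handshake : total (allFin n) ≡ 2 * edgeCount G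
  handshake = begin
    ∑ L (λ i → ∑ L (λ j → bit (i ~ j)))                                    ≡⟨ ∑-cong (λ i → ∑-cong (λ j → orient i j) L) L ⟩
    ∑ L (λ i → ∑ L (λ j → f (i , j) + f (j , i)))                          ≡⟨ ∑-cong (λ i → ∑-+ (λ j → f (i , j)) _ L) L ⟩
    ∑ L (λ i → ∑ L (λ j → f (i , j)) + ∑ L (λ j → f (j , i)))              ≡⟨ ∑-+ (λ i → ∑ L (λ j → f (i , j))) _ L ⟩
    ∑ L (λ i → ∑ L (λ j → f (i , j))) + ∑ L (λ i → ∑ L (λ j → f (j , i)))  ≡⟨ cong (∑ L (λ i → ∑ L (λ j → f (i , j))) +_) (∑-swap (λ i j → f (j , i)) L L) ⟩
    ∑ L (λ i → ∑ L (λ j → f (i , j))) + ∑ L (λ i → ∑ L (λ j → f (i , j)))  ≡⟨ cong (λ s → s + s) (∑-cartesianProduct f L L) ⟨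
    edgeCount G + edgeCount G                                              ≡⟨ cong (edgeCount G +_) (ℕ.+-identityʳ _) ⟨
    2 * edgeCount G                                                        ∎
    where
    open ≡-Reasoning
    L = allFin n
    f : V × V → ℕ
    f p = if does (proj₁ p Fin.<? proj₂ p) ∧ (proj₁ p ~ proj₂ p) then 1 else 0
    if-bit : ∀ b → (if b then 1 else 0) ≡ bit b
    if-bit true  = refl
    if-bit false = refl
    orient : ∀ i j → bit (i ~ j) ≡ f (i , j) + f (j , i)
    orient i j with Fin.<-cmp i j
    ... | tri< i<j _ j≮i rewrite dec-true (i Fin.<? j) i<j | dec-false (j Fin.<? i) j≮i = sym (trans (ℕ.+-identityʳ _) (if-bit (i ~ j)))
    ... | tri≈ i≮j refl _ rewrite dec-false (i Fin.<? i) i≮j = cong bit (irrefl G i)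
    ... | tri> i≮j _ j<i rewrite dec-true (j Fin.<? i) j<i | dec-false (i Fin.<? j) i≮j = trans (cong bit (symm G i j)) (sym (if-bit (j ~ i)))

  high-degree : ∀ c → n * c < 2 * edgeCount G → ∃[ v ] c < degree (v ~_) (allFin n)
  high-degree c lt = let v , _ , p = exceeds-average (λ v → degree (v ~_) (allFin n)) c (allFin n)
                           (subst₂ (λ l t → l * c < t) (sym (length-tabulate {n = n} id)) (sym handshake) lt)
                     in v , p

  record Core : Set where
    field
      L       : List V
      unique  : Unique L
      dense   : length L * 4 < total L
      minimum : ∀ {v} → v ∈ L → 3 ≤ degree (v ~_) L

  -- Deleting a vertex of degree at most 2 lowers `length L * 4` by 4 and the degree sum by at most
  -- 4, so the strict inequality survives.
  core : ∀ L → Unique L → length L * 4 < total L → Core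
  core L u lt = go (length L) L refl u lt
    where
    go : ∀ l L → length L ≡ l → Unique L → length L * 4 < total L → Core
    go l L ∣L∣ u lt with All.all? (λ v → 3 ℕ.≤? degree (v ~_) L) L
    ... | yes h = record { L = L ; unique = u ; dense = lt ; minimum = All.lookup h }
    ... | no ¬h with locate (All.¬All⇒Any¬ (λ v → 3 ℕ.≤? degree (v ~_) L) L ¬h)
    ...   | v , i , low with remove i
    ...     | M , p with l | trans (sym (↭-length p)) ∣L∣
    ...       | suc l′ | e = go l′ M (ℕ.suc-injective e) (AllPairs.tail (Unique-resp-↭ p u)) dense
      where
      dv≤2 : degree (v ~_) M ≤ 2
      dv≤2 = ℕ.≤-trans (ℕ.m≤n+m _ (bit (v ~ v))) (ℕ.≤-trans (ℕ.≤-reflexive (sym (degree-↭ (v ~_) p))) (s≤s⁻¹ (ℕ.≰⇒> low)))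
      dense : length M * 4 < total M
      dense = ℕ.+-cancelˡ-< 4 _ _ (begin-strict
        4 + length M * 4              ≡⟨ cong (_* 4) (↭-length p) ⟨
        length L * 4                  <⟨ lt ⟩
        total L                       ≡⟨ trans (total-↭ p) (total-∷ v M) ⟩
        degree (v ~_) M + degree (v ~_) M + total M ≤⟨ ℕ.+-monoˡ-≤ (total M) (ℕ.+-mono-≤ dv≤2 dv≤2) ⟩
        4 + total M                   ∎)
        where open ℕ.≤-Reasoning


-- Two homometric triples

-- In its uses the six numbers are positions: centre and ends of the first cherry, then centre and
-- ends of the second.
sub : {V : Set} (d : V) {W : List V} → Unique W → ∀ is → {True (unique? ℕ._≟_ is)} → {True (All.all? (ℕ._<? length W) is)} → Unique (map (at d W) is)
sub d u is {p} {q} = unique-at d u (toWitness p) (toWitness q)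

private
  -- All ten divisions of six vertices into two triples.
  splits : List Instr
  splits = map (λ (A , B) → eq A B 0)
    ( (0 ∷ 1 ∷ 2 ∷ [] , 3 ∷ 4 ∷ 5 ∷ []) ∷ (0 ∷ 1 ∷ 3 ∷ [] , 2 ∷ 4 ∷ 5 ∷ []) ∷ (0 ∷ 1 ∷ 4 ∷ [] , 2 ∷ 3 ∷ 5 ∷ []) ∷ (0 ∷ 1 ∷ 5 ∷ [] , 2 ∷ 3 ∷ 4 ∷ [])
    ∷ (0 ∷ 2 ∷ 3 ∷ [] , 1 ∷ 4 ∷ 5 ∷ []) ∷ (0 ∷ 2 ∷ 4 ∷ [] , 1 ∷ 3 ∷ 5 ∷ []) ∷ (0 ∷ 2 ∷ 5 ∷ [] , 1 ∷ 3 ∷ 4 ∷ []) ∷ (0 ∷ 3 ∷ 4 ∷ [] , 1 ∷ 2 ∷ 5 ∷ [])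
    ∷ (0 ∷ 3 ∷ 5 ∷ [] , 1 ∷ 2 ∷ 4 ∷ []) ∷ (0 ∷ 4 ∷ 5 ∷ [] , 1 ∷ 2 ∷ 3 ∷ []) ∷ [])

  split-strategy few-edges : List Instr
  split-strategy = map (uncurry ask) (pairsOf (1 ∷ 2 ∷ 3 ∷ 4 ∷ 5 ∷ [])) ++ splits
  few-edges = map (eq (1 ∷ 2 ∷ 3 ∷ 4 ∷ 5 ∷ []) []) (0 ∷ 1 ∷ 2 ∷ 3 ∷ 4 ∷ 5 ∷ 6 ∷ 7 ∷ [])

  split-facts : List Answer
  split-facts = map (λ i → (0 , i) , true) (1 ∷ 2 ∷ 3 ∷ 4 ∷ 5 ∷ [])

  split-balanced : All (Balanced 3 6) split-strategy
  split-balanced = from-yes (All.all? (balanced? 3 6) split-strategy)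

  split-search : search (split-strategy ++ few-edges) split-facts ≡ true
  split-search = refl

module _ {n} (G : Graph n) (connected : Connected G) where

  private
    V = Fin n
    infix 5 _~_
    _~_ : V → V → Bool
    _~_ = adj G

    flip~ : ∀ {x y b} → x ~ y ≡ b → y ~ x ≡ b
    flip~ {x} {y} = trans (symm G y x)

  -- The ends of a cherry are at distance at most 2 through its centre. The last hypothesis says
  -- that both triples are triangles or neither is.
  cherries : ∀ {p q r p′ q′ r′} → Unique (p ∷ q ∷ r ∷ p′ ∷ q′ ∷ r′ ∷ []) →
    p ~ q ≡ true → p ~ r ≡ true → p′ ~ q′ ≡ true → p′ ~ r′ ≡ true → q ~ r ≡ q′ ~ r′ → HasHomPair G 3
  cherries {p} {q} {r} {p′} {q′} {r′} u pq pr pq′ pr′ e =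
    homPair-close G connected (p ∷ q ∷ r ∷ []) (p′ ∷ q′ ∷ r′ ∷ []) refl refl u (close pq pr) (close pq′ pr′)
      (cong₂ (λ b s → bit b + s) (trans pq (sym pq′)) (cong₂ (λ b s → bit b + s) (trans pr (sym pr′)) (cong (λ b → bit b + 0) e)))
    where
    close : ∀ {p q r} → p ~ q ≡ true → p ~ r ≡ true → AllPairs (Close G connected) (p ∷ q ∷ r ∷ [])
    close {p} {q} {r} pq pr = (inj₁ pq ∷ inj₁ pr ∷ []) ∷ (inj₂ (p , flip~ pq , pr) ∷ []) ∷ [] ∷ []

  private module FromCore (C : Core G connected) where

    open Core C

    H : Set
    H = HasHomPair G 3

    module Arranged {M} (L↭M : L ↭ M) where
      uniq : Unique M
      uniq = Unique-resp-↭ L↭M unique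
      mindeg : ∀ {u} → u ∈ M → 3 ≤ degree (u ~_) M
      mindeg i = ℕ.≤-trans (minimum (∈-resp-↭ (↭-sym L↭M) i)) (ℕ.≤-reflexive (degree-↭ _ L↭M))

    not-both : ∀ {b} → not b ≡ false → b ≡ true
    not-both {true} _ = refl

    pull₂ : ∀ (X : List V) y z R → X ++ y ∷ z ∷ R ↭ y ∷ z ∷ X ++ R
    pull₂ X y z R = ↭-trans (shift y X (z ∷ R)) (prep y (shift z X R))

    -- Having no neighbour in `X`, `x` has two neighbours y, z in `R`. The cherry at `x` matches one
    -- at `v` with ends in `X`, unless yz is an edge and `X` independent, or yz is no edge and `X` a
    -- clique.
    module Isolated {v x a b c d : V} {R : List V} (L↭ : L ↭ v ∷ x ∷ a ∷ b ∷ c ∷ d ∷ R)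
      (vx : v ~ x ≡ true) (vX : All (λ y → v ~ y ≡ true) (a ∷ b ∷ c ∷ d ∷ []))
      (xX : All (λ y → x ~ y ≡ false) (a ∷ b ∷ c ∷ d ∷ [])) where

      X : List V
      X = a ∷ b ∷ c ∷ d ∷ []

      outer-degree : 2 ≤ degree (x ~_) R
      outer-degree = go xX (Arranged.mindeg L↭ (there (here refl)))
        where
        go : All (λ y → x ~ y ≡ false) X → 3 ≤ degree (x ~_) (v ∷ x ∷ a ∷ b ∷ c ∷ d ∷ R) → 2 ≤ degree (x ~_) R
        go (xa ∷ xb ∷ xc ∷ xd ∷ []) le rewrite irrefl G x | xa | xb | xc | xd = s≤s⁻¹ (ℕ.≤-trans le (ℕ.+-monoˡ-≤ _ (bit≤1 (x ~ v))))

      module Two {y z R′} (R↭ : R ↭ y ∷ z ∷ R′) (xy : x ~ y ≡ true) (xz : x ~ z ≡ true) where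

        L↭₁ : ∀ {Q} → X ↭ Q → L ↭ v ∷ x ∷ y ∷ z ∷ Q ++ R′
        L↭₁ q = ↭-trans L↭ (prep v (prep x (↭-trans (++⁺ q R↭) (pull₂ _ y z R′))))

        matched : ∀ {p q Q} → X ↭ p ∷ q ∷ Q → y ~ z ≡ p ~ q → H
        matched X↭ e with All-resp-↭ X↭ vX
        ... | vp ∷ vq ∷ _ = cherries (sub v (Arranged.uniq (L↭₁ X↭)) (1 ∷ 2 ∷ 3 ∷ 0 ∷ 4 ∷ 5 ∷ [])) xy xz vp vq e

        uW = Arranged.uniq (L↭₁ ↭-refl)

        -- Two vertices of `X` make an open cherry at `v`, and xyz is a triangle. If `a` is joined
        -- to y or z, an open cherry from `x` to `a` matches the former; otherwise `a` has two
        -- neighbours in `R′`, whose cherry matches one of the two.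
        independent : y ~ z ≡ true → AllPairs (λ p q → p ~ q ≡ false) X → All (λ p → v ~ p ≡ true) X → All (λ p → x ~ p ≡ false) X → H
        independent yz ((ab ∷ ac ∷ ad ∷ []) ∷ (bc ∷ _) ∷ _) (va ∷ vb ∷ vc ∷ _) (xa ∷ _) with a ~ y in ay | a ~ z in az
        ...   | true  | _     = cherries (sub v uW (2 ∷ 1 ∷ 4 ∷ 0 ∷ 5 ∷ 6 ∷ [])) (flip~ xy) (flip~ ay) vb vc (trans xa (sym bc))
        ...   | false | true  = cherries (sub v uW (3 ∷ 1 ∷ 4 ∷ 0 ∷ 5 ∷ 6 ∷ [])) (flip~ xz) (flip~ az) vb vc (trans xa (sym bc))
        ...   | false | false with select₂ (a ~_) R′ (go (Arranged.mindeg (L↭₁ ↭-refl) (there (there (there (there (here refl)))))))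
          where
          go : 3 ≤ degree (a ~_) (v ∷ x ∷ y ∷ z ∷ X ++ R′) → 2 ≤ degree (a ~_) R′
          go le rewrite flip~ xa | ay | az | irrefl G a | ab | ac | ad = s≤s⁻¹ (ℕ.≤-trans le (ℕ.+-monoˡ-≤ _ (bit≤1 (a ~ v))))
        ...     | s , t , R″ , R′↭ , as , at′ = finish (s ~ t) refl
          where
          uW′ : Unique (v ∷ x ∷ y ∷ z ∷ X ++ s ∷ t ∷ R″)
          uW′ = Arranged.uniq (↭-trans (L↭₁ ↭-refl) (prep v (prep x (prep y (prep z (++⁺ˡ X R′↭))))))
          finish : ∀ e → s ~ t ≡ e → H
          finish true  st = cherries (sub v uW′ (1 ∷ 2 ∷ 3 ∷ 4 ∷ 8 ∷ 9 ∷ [])) xy xz as at′ (trans yz (sym st))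
          finish false st = cherries (sub v uW′ (4 ∷ 8 ∷ 9 ∷ 0 ∷ 5 ∷ 6 ∷ [])) as at′ vb vc (trans st (sym bc))

        -- Now `v` offers both kinds: a triangle with two vertices of `X`, an open cherry with `x`
        -- and one vertex of `X`. The cases seek a cherry at `y` that leaves the vertices needed
        -- free; if `v` is joined to `y`, then vxy and three vertices of `X` are triangles.
        clique : y ~ z ≡ false → AllPairs (λ p q → p ~ q ≡ true) X → All (λ p → v ~ p ≡ true) X → All (λ p → x ~ p ≡ false) X → H
        clique yz cl@((ab ∷ _) ∷ (bc ∷ _) ∷ _) (va ∷ vb ∷ _) (xa ∷ _) with v ~ y in vy | 2 ℕ.≤? degree (y ~_) X
        ...   | true | _ = cherries (sub v uW (0 ∷ 1 ∷ 2 ∷ 4 ∷ 5 ∷ 6 ∷ [])) vx vy ab (All.head (All.tail (AllPairs.head cl))) (trans xy (sym bc))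
        ...   | false | yes le with select₂ (y ~_) X le
        ...     | p , q , Q , X↭ , yp , yq with two Q (ℕ.suc-injective (ℕ.suc-injective (sym (↭-length X↭))))
        ...       | r , s , refl with AllPairs-resp-↭ flip~ X↭ cl | All-resp-↭ X↭ vX
        ...         | (pq ∷ _) ∷ _ ∷ (rs ∷ []) ∷ _ | _ ∷ _ ∷ vr ∷ vs ∷ [] =
          cherries (sub v (Arranged.uniq (L↭₁ X↭)) (2 ∷ 4 ∷ 5 ∷ 0 ∷ 6 ∷ 7 ∷ [])) yp yq vr vs (trans pq (sym rs))
        clique yz cl@((ab ∷ _) ∷ _) (va ∷ vb ∷ _) (xa ∷ _) | false | no ¬2 with 1 ℕ.≤? degree (y ~_) X
        ... | yes le with select₁ (y ~_) X le
        ...   | p , Q , X↭ , yp with three Q (ℕ.suc-injective (sym (↭-length X↭)))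
        ...     | q , r , s , refl with AllPairs-resp-↭ flip~ X↭ cl | All-resp-↭ X↭ vX | All-resp-↭ X↭ xX
        ...       | _ ∷ (qr ∷ _) ∷ _ | _ ∷ vq ∷ vr ∷ _ | _ ∷ xq ∷ _ with select₁ (y ~_) R′ (go (Arranged.mindeg (L↭₁ ↭-refl) (there (there (here refl)))))
          where
          go : 3 ≤ degree (y ~_) (v ∷ x ∷ y ∷ z ∷ X ++ R′) → 1 ≤ degree (y ~_) R′
          go le rewrite flip~ vy | flip~ xy | irrefl G y | yz = ℕ.+-cancelˡ-≤ 2 _ _ (ℕ.≤-trans le (s≤s (ℕ.≤-trans (ℕ.≤-reflexive (degree-++ (y ~_) X R′)) (ℕ.+-monoˡ-≤ _ (s≤s⁻¹ (ℕ.≰⇒> ¬2))))))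
        ...         | t , R″ , R′↭ , yt = finish (p ~ t) refl
          where
          uW′ : Unique (v ∷ x ∷ y ∷ z ∷ p ∷ q ∷ r ∷ s ∷ t ∷ R″)
          uW′ = Arranged.uniq (↭-trans (L↭₁ X↭) (prep v (prep x (prep y (prep z (++⁺ˡ (p ∷ q ∷ r ∷ s ∷ []) R′↭))))))
          finish : ∀ e → p ~ t ≡ e → H
          finish true  pt = cherries (sub v uW′ (2 ∷ 4 ∷ 8 ∷ 0 ∷ 5 ∷ 6 ∷ [])) yp yt vq vr (trans pt (sym qr))
          finish false pt = cherries (sub v uW′ (2 ∷ 4 ∷ 8 ∷ 0 ∷ 1 ∷ 5 ∷ [])) yp yt vx vq (trans pt (sym xq))
        clique yz cl@((ab ∷ _) ∷ _) (va ∷ vb ∷ _) (xa ∷ _) | false | no ¬2 | no ¬1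
          with select₂ (y ~_) R′ (go (Arranged.mindeg (L↭₁ ↭-refl) (there (there (here refl)))))
          where
          go : 3 ≤ degree (y ~_) (v ∷ x ∷ y ∷ z ∷ X ++ R′) → 2 ≤ degree (y ~_) R′
          go le rewrite flip~ vy | flip~ xy | irrefl G y | yz = s≤s⁻¹ (ℕ.≤-trans le (s≤s (ℕ.≤-trans (ℕ.≤-reflexive (degree-++ (y ~_) X R′)) (ℕ.+-monoˡ-≤ _ (s≤s⁻¹ (ℕ.≰⇒> ¬1))))))
        ... | s , t , R″ , R′↭ , ys , yt = finish (s ~ t) refl
          where
          uW′ : Unique (v ∷ x ∷ y ∷ z ∷ X ++ s ∷ t ∷ R″)
          uW′ = Arranged.uniq (↭-trans (L↭₁ ↭-refl) (prep v (prep x (prep y (prep z (++⁺ˡ X R′↭))))))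
          finish : ∀ e → s ~ t ≡ e → H
          finish true  st = cherries (sub v uW′ (2 ∷ 8 ∷ 9 ∷ 0 ∷ 4 ∷ 5 ∷ [])) ys yt va vb (trans st (sym ab))
          finish false st = cherries (sub v uW′ (2 ∷ 8 ∷ 9 ∷ 0 ∷ 1 ∷ 4 ∷ [])) ys yt vx va (trans st (sym xa))

      homPair : H
      homPair with select₂ (x ~_) R outer-degree
      ... | y , z , R′ , R↭ , xy , xz = go (y ~ z) refl
        where
        open Two R↭ xy xz
        go : ∀ e → y ~ z ≡ e → H
        go true yz with pair-front _~_ X
        ... | inj₁ (p , q , Q , X↭ , pq) = matched X↭ (trans yz (sym pq))
        ... | inj₂ ind = independent yz ind vX xX
        go false yz with pair-front (λ p q → not (p ~ q)) X
        ... | inj₁ (p , q , Q , X↭ , pq) = matched X↭ (trans yz (sym (trans (sym (not-involutive _)) (cong not pq))))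
        ... | inj₂ cl = clique yz (AllPairs.map not-both cl) vX xX

    module Covered {v a₁ a₂ a₃ a₄ a₅ w : V} {R : List V} (L↭ : L ↭ v ∷ a₁ ∷ a₂ ∷ a₃ ∷ a₄ ∷ a₅ ∷ w ∷ R)
      (vX : All (λ y → v ~ y ≡ true) (a₁ ∷ a₂ ∷ a₃ ∷ a₄ ∷ a₅ ∷ [])) where

      X : List V
      X = a₁ ∷ a₂ ∷ a₃ ∷ a₄ ∷ a₅ ∷ []

      L↭w : ∀ {Q} → X ↭ Q → L ↭ v ∷ w ∷ Q ++ R
      L↭w q = ↭-trans L↭ (prep v (↭-trans (++⁺ʳ (w ∷ R) q) (shift w _ R)))

      clique : AllPairs (λ p q → p ~ q ≡ true) X → All (λ y → v ~ y ≡ true) X → H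
      clique ((ab ∷ _) ∷ _ ∷ (cd ∷ ce ∷ []) ∷ (de ∷ []) ∷ _) (va ∷ vb ∷ _) =
        cherries (sub v (Arranged.uniq (L↭w ↭-refl)) (0 ∷ 2 ∷ 3 ∷ 4 ∷ 5 ∷ 6 ∷ [])) va vb cd ce (trans ab (sym de))

      lonely : AllPairs (λ p q → p ~ q ≡ false) X → degree (a₁ ~_) X ≡ 0
      lonely ((ab ∷ ac ∷ ad ∷ ae ∷ []) ∷ _) rewrite irrefl G a₁ | ab | ac | ad | ae = refl

      module Degrees (X-deg : ∀ {x} → x ∈ X → 1 ≤ degree (x ~_) X) where

        deg-resp : ∀ {Q x} → X ↭ Q → x ∈ Q → 1 ≤ degree (x ~_) Q
        deg-resp X↭ i = ℕ.≤-trans (X-deg (∈-resp-↭ (↭-sym X↭) i)) (ℕ.≤-reflexive (degree-↭ _ X↭))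

        -- The cherry at `w` is matched at `v` unless `X` is independent, which `X-deg` forbids, or
        -- a clique, which together with `v` contains two disjoint triangles.
        two-outside : 2 ≤ degree (w ~_) R → H
        two-outside le with select₂ (w ~_) R le
        ... | s , t , R′ , R↭ , ws , wt = go (s ~ t) refl
          where
          L↭st : ∀ {Q} → X ↭ Q → L ↭ v ∷ w ∷ s ∷ t ∷ Q ++ R′
          L↭st {Q} q = ↭-trans (L↭w q) (prep v (prep w (↭-trans (++⁺ˡ Q R↭) (pull₂ Q s t R′))))
          matched : ∀ {p q Q} → X ↭ p ∷ q ∷ Q → s ~ t ≡ p ~ q → H
          matched X↭ e with All-resp-↭ X↭ vX
          ... | vp ∷ vq ∷ _ = cherries (sub v (Arranged.uniq (L↭st X↭)) (1 ∷ 2 ∷ 3 ∷ 0 ∷ 4 ∷ 5 ∷ [])) ws wt vp vq e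
          go : ∀ e → s ~ t ≡ e → H
          go true st with pair-front _~_ X
          ... | inj₁ (p , q , Q , X↭ , pq) = matched X↭ (trans st (sym pq))
          ... | inj₂ ind = ⊥-elim (ℕ.<⇒≱ (s≤s (ℕ.≤-reflexive (lonely ind))) (X-deg (here refl)))
          go false st with pair-front (λ p q → not (p ~ q)) X
          ... | inj₁ (p , q , Q , X↭ , pq) = matched X↭ (trans st (sym (trans (sym (not-involutive _)) (cong not pq))))
          ... | inj₂ cl = clique (AllPairs.map not-both cl) vX

        -- What `attached` leaves over: wab is a triangle, c, d, e are independent and each is
        -- joined to a or b, by symmetry c to a. Any two of c, d, e make an open cherry at `v`, so
        -- open cherries at a are welcome; missing ones force edges that give triangles. At the very
        -- end w with b, c and a with d, e are both open.
        common : ∀ {a b c d e} → X ↭ a ∷ b ∷ c ∷ d ∷ e ∷ [] → w ~ a ≡ true → w ~ b ≡ true → a ~ b ≡ true →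
          c ~ d ≡ false → c ~ e ≡ false → d ~ e ≡ false →
          (d ~ b ≡ false → d ~ a ≡ true) → (e ~ b ≡ false → e ~ a ≡ true) → c ~ a ≡ true → H
        common {a} {b} {c} {d} {e} X↭ wa wb ab cd ce de nd ne ca with All-resp-↭ X↭ vX
        ... | va ∷ vb ∷ vc ∷ vd ∷ ve ∷ [] = go (w ~ c) refl
          where
          uW : Unique (v ∷ w ∷ a ∷ b ∷ c ∷ d ∷ e ∷ R)
          uW = Arranged.uniq (L↭w X↭)
          go₃ : w ~ e ≡ true → b ~ c ≡ false → d ~ a ≡ true → e ~ a ≡ true → w ~ c ≡ true → H
          go₃ we bc da ea wc = cherries (sub v uW (1 ∷ 3 ∷ 4 ∷ 2 ∷ 5 ∷ 6 ∷ [])) wb wc (flip~ da) (flip~ ea) (trans bc (sym de))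
          go₂ : b ~ d ≡ false → b ~ e ≡ false → w ~ c ≡ true → ∀ i j k → w ~ d ≡ i → b ~ c ≡ j → w ~ e ≡ k → H
          go₂ bd be wc false _     _     wd _  _  = cherries (sub v uW (2 ∷ 1 ∷ 5 ∷ 0 ∷ 4 ∷ 6 ∷ [])) (flip~ wa) (flip~ (nd (flip~ bd))) vc ve (trans wd (sym ce))
          go₂ bd be wc true  true  _     wd bc _  = cherries (sub v uW (1 ∷ 2 ∷ 5 ∷ 0 ∷ 3 ∷ 4 ∷ [])) wa wd vb vc (trans (flip~ (nd (flip~ bd))) (sym bc))
          go₂ bd be wc true  false false wd bc we = cherries (sub v uW (2 ∷ 1 ∷ 6 ∷ 0 ∷ 4 ∷ 5 ∷ [])) (flip~ wa) (flip~ (ne (flip~ be))) vc vd (trans we (sym cd))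
          go₂ bd be wc true  false true  wd bc we = go₃ we bc (nd (flip~ bd)) (ne (flip~ be)) wc
          go₁ : w ~ c ≡ true → ∀ i j → b ~ d ≡ i → b ~ e ≡ j → H
          go₁ wc true  _     bd _  = cherries (sub v uW (1 ∷ 2 ∷ 4 ∷ 0 ∷ 3 ∷ 5 ∷ [])) wa wc vb vd (trans (flip~ ca) (sym bd))
          go₁ wc false true  _  be = cherries (sub v uW (1 ∷ 2 ∷ 4 ∷ 0 ∷ 3 ∷ 6 ∷ [])) wa wc vb ve (trans (flip~ ca) (sym be))
          go₁ wc false false bd be = go₂ bd be wc (w ~ d) (b ~ c) (w ~ e) refl refl refl
          go : ∀ i → w ~ c ≡ i → H
          go false wc = cherries (sub v uW (2 ∷ 1 ∷ 4 ∷ 0 ∷ 5 ∷ 6 ∷ [])) (flip~ wa) (flip~ ca) vd ve (trans wc (sym de))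
          go true  wc = go₁ wc (b ~ d) (b ~ e) refl refl

        -- If `w` is joined to b, the triangle wab matches any edge among c, d, e together with `v`.
        -- If not, the open cherry at a matches any missing edge there, and if none is missing, cde
        -- and vab are triangles.
        attached : ∀ {a b c d e} → X ↭ a ∷ b ∷ c ∷ d ∷ e ∷ [] → w ~ a ≡ true → a ~ b ≡ true → H
        attached {a} {b} {c} {d} {e} X↭ wa ab with All-resp-↭ X↭ vX
        ... | va ∷ vb ∷ vc ∷ vd ∷ ve ∷ [] = go (w ~ b) refl
          where
          uW : Unique (v ∷ w ∷ a ∷ b ∷ c ∷ d ∷ e ∷ R)
          uW = Arranged.uniq (L↭w X↭)
          other : ∀ {x} → x ∈ c ∷ d ∷ e ∷ [] → degree (x ~_) (c ∷ d ∷ e ∷ []) ≡ 0 → ∀ i j → x ~ a ≡ i → x ~ b ≡ j → x ~ a ≡ true ⊎ x ~ b ≡ true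
          other i z true  _     xa _  = inj₁ xa
          other i z false true  _  xb = inj₂ xb
          other {x} i z false false xa xb = ⊥-elim (ℕ.<⇒≱ (s≤s (ℕ.≤-reflexive zero-degree)) (deg-resp X↭ (there (there i))))
            where
            zero-degree : degree (x ~_) (a ∷ b ∷ c ∷ d ∷ e ∷ []) ≡ 0
            zero-degree rewrite xa | xb = z
          linked : c ~ d ≡ false → c ~ e ≡ false → d ~ e ≡ false → ∀ {x} → x ∈ c ∷ d ∷ e ∷ [] → x ~ a ≡ true ⊎ x ~ b ≡ true
          linked cd ce de {x} i = other i (isolated i) (x ~ a) (x ~ b) refl refl
            where
            isolated : ∀ {x} → x ∈ c ∷ d ∷ e ∷ [] → degree (x ~_) (c ∷ d ∷ e ∷ []) ≡ 0
            isolated (here refl) rewrite irrefl G c | cd | ce = refl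
            isolated (there (here refl)) rewrite irrefl G d | flip~ cd | de = refl
            isolated (there (there (here refl))) rewrite irrefl G e | flip~ ce | flip~ de = refl
          otherwise : ∀ {x y z} → x ~ y ≡ true ⊎ x ~ z ≡ true → x ~ z ≡ false → x ~ y ≡ true
          otherwise (inj₁ p) _ = p
          otherwise (inj₂ p) q = case trans (sym p) q of λ ()
          both : w ~ b ≡ true → ∀ i j k → c ~ d ≡ i → c ~ e ≡ j → d ~ e ≡ k → H
          both wb true  _ _ cd _ _ = cherries (sub v uW (1 ∷ 2 ∷ 3 ∷ 0 ∷ 4 ∷ 5 ∷ [])) wa wb vc vd (trans ab (sym cd))
          both wb false true _ _ ce _ = cherries (sub v uW (1 ∷ 2 ∷ 3 ∷ 0 ∷ 4 ∷ 6 ∷ [])) wa wb vc ve (trans ab (sym ce))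
          both wb false false true _ _ de = cherries (sub v uW (1 ∷ 2 ∷ 3 ∷ 0 ∷ 5 ∷ 6 ∷ [])) wa wb vd ve (trans ab (sym de))
          both wb false false false cd ce de with linked cd ce de (here refl) | linked cd ce de (there (here refl)) | linked cd ce de (there (there (here refl)))
          ... | inj₁ ca | ld | le = common X↭ wa wb ab cd ce de (otherwise ld) (otherwise le) ca
          ... | inj₂ cb | ld | le = common (↭-trans X↭ (swap a b refl)) wb wa (flip~ ab) cd ce de (otherwise (Sum.swap ld)) (otherwise (Sum.swap le)) cb
          one : w ~ b ≡ false → ∀ i j k → c ~ d ≡ i → c ~ e ≡ j → d ~ e ≡ k → H
          one wb false _ _ cd _ _ = cherries (sub v uW (2 ∷ 1 ∷ 3 ∷ 0 ∷ 4 ∷ 5 ∷ [])) (flip~ wa) ab vc vd (trans wb (sym cd))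
          one wb true false _ _ ce _ = cherries (sub v uW (2 ∷ 1 ∷ 3 ∷ 0 ∷ 4 ∷ 6 ∷ [])) (flip~ wa) ab vc ve (trans wb (sym ce))
          one wb true true false _ _ de = cherries (sub v uW (2 ∷ 1 ∷ 3 ∷ 0 ∷ 5 ∷ 6 ∷ [])) (flip~ wa) ab vd ve (trans wb (sym de))
          one wb true true true cd ce de = cherries (sub v uW (0 ∷ 2 ∷ 3 ∷ 4 ∷ 5 ∷ 6 ∷ [])) va vb cd ce (trans ab (sym de))
          go : ∀ i → w ~ b ≡ i → H
          go true  wb = both wb (c ~ d) (c ~ e) (d ~ e) refl refl refl
          go false wb = one wb (c ~ d) (c ~ e) (d ~ e) refl refl refl

        homPair-covered : H
        homPair-covered with 2 ℕ.≤? degree (w ~_) R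
        ... | yes le = two-outside le
        ... | no ¬2 with select₁ (w ~_) X (go (Arranged.mindeg (L↭w ↭-refl) (there (here refl))))
          where
          go : 3 ≤ degree (w ~_) (v ∷ w ∷ X ++ R) → 1 ≤ degree (w ~_) X
          go le rewrite irrefl G w = ℕ.+-cancelʳ-≤ 2 1 (degree (w ~_) X) (ℕ.≤-trans le
            (ℕ.≤-trans (ℕ.+-mono-≤ (bit≤1 (w ~ v)) (ℕ.≤-trans (ℕ.≤-reflexive (degree-++ (w ~_) X R)) (ℕ.+-monoʳ-≤ (degree (w ~_) X) (s≤s⁻¹ (ℕ.≰⇒> ¬2)))))
              (ℕ.≤-reflexive (sym (ℕ.+-suc (degree (w ~_) X) 1)))))
        ...   | a , X₁ , X↭ , wa with select₁ (a ~_) X₁ (go (deg-resp X↭ (here refl)))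
          where
          go : 1 ≤ degree (a ~_) (a ∷ X₁) → 1 ≤ degree (a ~_) X₁
          go le rewrite irrefl G a = le
        ...     | b , X₂ , X₁↭ , ab with three X₂ (ℕ.suc-injective (ℕ.suc-injective (sym (↭-length (↭-trans X↭ (prep a X₁↭))))))
        ...       | c , d , e , refl = attached (↭-trans X↭ (prep a X₁↭)) wa ab

    -- Six vertices with degree sum above 24 have at least 13 edges, at most five of them at `v`, so
    -- `X` spans at least 8. The search shows that if no division into triples is equal, `X` spans
    -- at most 7.
    whole : ∀ {v a b c d e} → L ↭ v ∷ a ∷ b ∷ c ∷ d ∷ e ∷ [] → All (λ y → v ~ y ≡ true) (a ∷ b ∷ c ∷ d ∷ e ∷ []) → H
    whole {v} {a} {b} {c} {d} {e} L↭ vX@(va ∷ vb ∷ vc ∷ vd ∷ ve ∷ []) =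
      case Any.++⁻ split-strategy (search-sound (positions _~_ v uW) (split-strategy ++ few-edges) {K = split-facts} (va ∷ vb ∷ vc ∷ vd ∷ ve ∷ []) split-search) of λ
        { (inj₁ i) → let S , T , ∣S∣ , ∣T∣ , u , W⊇ , q = balanced⇒equalPair-within _~_ v uW split-balanced i
                         uS , uT , _ = Unique-++⁻ S u
                         st , _ = neighbourhood G connected v X vX (AllPairs.tail uW)
                     in homPair-close G connected S T ∣S∣ ∣T∣ u (star-close G connected st uS (All.++⁻ˡ S W⊇)) (star-close G connected st uT (All.++⁻ʳ S W⊇)) q
        ; (inj₂ i) → ⊥-elim (few (0 ∷ 1 ∷ 2 ∷ 3 ∷ 4 ∷ 5 ∷ 6 ∷ 7 ∷ []) (from-yes (All.all? (ℕ._≤? 7) (0 ∷ 1 ∷ 2 ∷ 3 ∷ 4 ∷ 5 ∷ 6 ∷ 7 ∷ []))) i) }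
      where
      X : List V
      X = a ∷ b ∷ c ∷ d ∷ e ∷ []
      uW : Unique (v ∷ X)
      uW = Arranged.uniq L↭
      many : 7 < edges _~_ X
      many = ℕ.≰⇒> λ le → ℕ.<⇒≱ dense (begin
        total G connected L                            ≡⟨ trans (total-↭ G connected L↭) (total≡2edges G connected (v ∷ X)) ⟩
        edges _~_ (v ∷ X) + edges _~_ (v ∷ X)          ≤⟨ ℕ.+-mono-≤ (small le) (small le) ⟩
        24                                             ≡⟨ cong (_* 4) (↭-length L↭) ⟨
        length L * 4                                   ∎)
        where
        open ℕ.≤-Reasoning
        small : edges _~_ X ≤ 7 → edges _~_ (v ∷ X) ≤ 12
        small le = ℕ.≤-trans (ℕ.≤-reflexive (edges-∷ _~_ v X)) (ℕ.+-mono-≤ (degree≤length (v ~_) X) le)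
      few : ∀ bs → All (_≤ 7) bs → ¬ Any (Holds (positions _~_ v uW)) (map (eq (1 ∷ 2 ∷ 3 ∷ 4 ∷ 5 ∷ []) []) bs)
      few (b ∷ bs) (p ∷ _)  (here q)  = ℕ.<⇒≱ many (ℕ.≤-trans (ℕ.≤-reflexive q) p)
      few (b ∷ bs) (_ ∷ ps) (there i) = few bs ps i

    -- X consists of five neighbours of v. A vertex of X without neighbours in X has two neighbours
    -- elsewhere, and otherwise any vertex outside v and X gives a cherry or triangle to be matched.
    homPair-core : H
    homPair-core with exceeds-average (λ v → degree (v ~_) L) 4 L dense
    ... | v , v∈L , 4<d with remove v∈L
    ...   | L₁ , L↭₁ with select (v ~_) 5 L₁ (go (ℕ.≤-trans 4<d (ℕ.≤-reflexive (degree-↭ (v ~_) L↭₁))))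
      where
      go : 5 ≤ degree (v ~_) (v ∷ L₁) → 5 ≤ degree (v ~_) L₁
      go le rewrite irrefl G v = le
    ...     | X , R , L₁↭ , ∣X∣ , vX with five X ∣X∣
    ...       | a , b , c , d , e , refl with All.all? (λ x → 1 ℕ.≤? degree (x ~_) X) X
    ...         | yes covered = remaining-vertex R (↭-trans L↭₁ (prep v L₁↭))
      where
      remaining-vertex : ∀ R → L ↭ v ∷ X ++ R → H
      remaining-vertex []      L↭ = whole L↭ vX
      remaining-vertex (w ∷ R) L↭ = Covered.Degrees.homPair-covered L↭ vX (All.lookup covered)
    ...         | no ¬covered with locate (All.¬All⇒Any¬ (λ x → 1 ℕ.≤? degree (x ~_) X) X ¬covered)
    ...           | x , x∈X , low with remove x∈X
    ...             | Y , X↭ with four Y (ℕ.suc-injective (sym (↭-length X↭)))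
      where
      four : (Y : List V) → length Y ≡ 4 → ∃[ a ] ∃[ b ] ∃[ c ] ∃[ d ] Y ≡ a ∷ b ∷ c ∷ d ∷ []
      four (a ∷ b ∷ c ∷ d ∷ []) _ = a , b , c , d , refl
    ...               | p , q , r , s , refl with All-resp-↭ X↭ vX
    ...                 | vx ∷ vY = Isolated.homPair (↭-trans L↭₁ (prep v (↭-trans L₁↭ (++⁺ʳ R X↭)))) vx vY
      (All.tail (degree≡0⇒ (x ~_) (x ∷ p ∷ q ∷ r ∷ s ∷ []) (ℕ.n<1⇒n≡0 (ℕ.≤-trans (s≤s (ℕ.≤-reflexive (sym (degree-↭ (x ~_) X↭)))) (ℕ.≰⇒> low)))))

  homPair-3 : n * 4 < 2 * edgeCount G → HasHomPair G 3
  homPair-3 lt = FromCore.homPair-core (core G connected (allFin n) (Unique.allFin⁺ n)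
    (subst₂ (λ l t → l * 4 < t) (sym (length-tabulate {n = n} id)) (sym (handshake G connected)) lt))

-- The three bounds

suc-C2 : ∀ k → suc k C 2 ≡ k + k C 2
suc-C2 k = trans (sym (nCk+nC[k+1]≡[n+1]C[k+1] k 1)) (cong (_+ k C 2) (nC1≡n k))

-- The binomial coefficient is the product of the `D` factors (N + i)/i, each at most N + 1.
C≤^ : ∀ N D → (N + D) C D ≤ suc N ^ D
C≤^ N       zero    = ℕ.≤-refl
C≤^ zero    (suc D) = ℕ.≤-reflexive (trans (nCn≡1 (suc D)) (sym (ℕ.^-zeroˡ (suc D))))
C≤^ (suc N) (suc D) = begin
  suc (N + suc D) C suc D                       ≡⟨ nCk+nC[k+1]≡[n+1]C[k+1] (N + suc D) D ⟨
  (N + suc D) C D + (N + suc D) C suc D         ≡⟨ cong (λ m → m C D + (N + suc D) C suc D) (ℕ.+-suc N D) ⟩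
  (suc N + D) C D + (N + suc D) C suc D         ≤⟨ ℕ.+-mono-≤ (C≤^ (suc N) D) (C≤^ N (suc D)) ⟩
  suc (suc N) ^ D + suc N * suc N ^ D           ≤⟨ ℕ.+-monoʳ-≤ (suc (suc N) ^ D) (ℕ.*-monoʳ-≤ (suc N) (ℕ.^-monoˡ-≤ D (ℕ.n≤1+n (suc N)))) ⟩
  suc (suc N) ^ D + suc N * suc (suc N) ^ D     ∎
  where open ℕ.≤-Reasoning

*-^ : ∀ k a b → (a * b) ^ k ≡ a ^ k * b ^ k
*-^ zero    a b = refl
*-^ (suc k) a b = trans (cong (a * b *_) (*-^ k a b))
  (solve 4 (λ a b c d → a :* b :* (c :* d) := a :* c :* (b :* d)) refl a b (a ^ k) (b ^ k))

-- With k = 3 + j this is binom(k,2) + 1 ≤ (k - 1)². It is an equality for k = 3 and fails for k =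
-- 2, which is therefore treated apart.
C2-small : ∀ j → suc ((3 + j) C 2) ≤ (2 + j) * (2 + j)
C2-small zero    = ℕ.≤-refl
C2-small (suc j) = begin
  suc ((4 + j) C 2)             ≡⟨ cong suc (suc-C2 (3 + j)) ⟩
  suc (3 + j + (3 + j) C 2)     ≡⟨ ℕ.+-suc (3 + j) ((3 + j) C 2) ⟨
  3 + j + suc ((3 + j) C 2)     ≤⟨ ℕ.+-monoʳ-≤ (3 + j) (C2-small j) ⟩
  3 + j + (2 + j) * (2 + j)     ≤⟨ ℕ.m≤m+n _ (2 + j) ⟩
  3 + j + (2 + j) * (2 + j) + (2 + j) ≡⟨ solve 1 (λ j → con 3 :+ j :+ (con 2 :+ j) :* (con 2 :+ j) :+ (con 2 :+ j) := (con 3 :+ j) :* (con 3 :+ j)) refl j ⟩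
  (3 + j) * (3 + j)             ∎
  where open ℕ.≤-Reasoning

-- With k = 6 + j this is Kneser's condition on (k - 1)² + 2 vertices, an equality for k = 6.
kneser-room : ∀ j → suc ((6 + j) C 2) + 2 * (6 + j) ≤ suc (suc ((5 + j) * (5 + j))) + 1
kneser-room zero    = ℕ.≤-refl
kneser-room (suc j) = begin
  suc ((7 + j) C 2) + 2 * (7 + j)                     ≡⟨ cong (λ c → suc c + 2 * (7 + j)) (suc-C2 (6 + j)) ⟩
  suc (6 + j + (6 + j) C 2) + 2 * (7 + j)             ≡⟨ solve 2 (λ j c → con 1 :+ (con 6 :+ j :+ c) :+ con 2 :* (con 7 :+ j) := con 8 :+ j :+ (con 1 :+ c :+ con 2 :* (con 6 :+ j))) refl j ((6 + j) C 2) ⟩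
  8 + j + (suc ((6 + j) C 2) + 2 * (6 + j))           ≤⟨ ℕ.+-monoʳ-≤ (8 + j) (kneser-room j) ⟩
  8 + j + (suc (suc ((5 + j) * (5 + j))) + 1)         ≤⟨ ℕ.m≤m+n _ (3 + j) ⟩
  8 + j + (suc (suc ((5 + j) * (5 + j))) + 1) + (3 + j) ≡⟨ solve 1 (λ j → con 8 :+ j :+ (con 2 :+ (con 5 :+ j) :* (con 5 :+ j) :+ con 1) :+ (con 3 :+ j) := con 2 :+ (con 6 :+ j) :* (con 6 :+ j) :+ con 1) refl j ⟩
  suc (suc ((6 + j) * (6 + j))) + 1                   ∎
  where open ℕ.≤-Reasoning

m≤m*m*n : ∀ m {n} → 1 ≤ n → m ≤ m * m * n
m≤m*m*n zero    _   = z≤n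
m≤m*m*n (suc m) 1≤n = ℕ.≤-trans (ℕ.≤-reflexive (sym (trans (ℕ.*-identityʳ _) (ℕ.*-identityʳ _))))
  (ℕ.*-mono-≤ (ℕ.*-monoʳ-≤ (suc m) (s≤s (z≤n {m}))) 1≤n)

-- For k ≥ 3, minimality gives n > (2(k - 1))^(2D) = 4^D x with x = (k - 1)^(2D). One copy of x
-- bounds the binomial coefficient and three more bound 2k; the factor 1/2 in the theorem is what
-- provides them.
least-k-fits : ∀ n D k → 5 ≤ n → 1 ≤ D → suc D ^ (2 * D) ≤ n → n ≤ (2 * k) ^ (2 * D) →
  (∀ j → j < k → ¬ n ≤ (2 * j) ^ (2 * D)) → (k C 2 + D) C D + 2 * k < n + 2
least-k-fits n (suc D) 0 5≤n _ _ n≤ _ = ⊥-elim (ℕ.<⇒≱ (ℕ.≤-trans (s≤s z≤n) 5≤n) n≤)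
least-k-fits n D 1 5≤n _ _ _ _ = subst (λ c → c + 2 < n + 2) (sym (nCn≡1 D)) (ℕ.+-monoˡ-< 2 (ℕ.≤-trans (s≤s (s≤s z≤n)) 5≤n))
least-k-fits n 1 2 5≤n _ _ _ _ = ℕ.+-monoˡ-≤ 2 5≤n
-- Minimality is too weak for k = 2; the hypothesis on n gives n ≥ x² with x = 2^D ≥ 4 for the full
-- exponent D, against x + 4.
least-k-fits n (suc (suc D)) 2 5≤n _ le _ _ = begin-strict
  (1 + suc (suc D)) C suc (suc D) + 4   ≤⟨ ℕ.+-monoˡ-≤ 4 (C≤^ 1 (suc (suc D))) ⟩
  x + 4                                 ≤⟨ ℕ.+-monoʳ-≤ x 4≤x ⟩
  x + x                                 <⟨ ℕ.+-monoʳ-< x (ℕ.m<m+n x {2 * x} (ℕ.≤-trans (s≤s z≤n) (ℕ.≤-trans 4≤x (ℕ.m≤m+n x _)))) ⟩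
  4 * x                                 ≤⟨ ℕ.*-monoˡ-≤ x 4≤x ⟩
  x * x                                 ≡⟨ ℕ.^-distribˡ-+-* 2 (suc (suc D)) (suc (suc D)) ⟨
  2 ^ (suc (suc D) + suc (suc D))       ≡⟨ cong (λ m → 2 ^ (suc (suc D) + m)) (ℕ.+-identityʳ (suc (suc D))) ⟨
  2 ^ (2 * suc (suc D))                 ≤⟨ ℕ.^-monoˡ-≤ (2 * suc (suc D)) {2} {suc (suc (suc D))} (s≤s (s≤s z≤n)) ⟩
  suc (suc (suc D)) ^ (2 * suc (suc D)) ≤⟨ le ⟩
  n                                     ≤⟨ ℕ.m≤m+n n 2 ⟩
  n + 2                                 ∎
  where
  open ℕ.≤-Reasoning
  x = 2 ^ suc (suc D)
  4≤x : 4 ≤ x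
  4≤x = ℕ.*-monoʳ-≤ 2 (ℕ.*-monoʳ-≤ 2 (ℕ.m^n>0 2 D))
least-k-fits n D@(suc D′) (suc (suc (suc j))) 5≤n _ _ _ minimal = begin-strict
  ((3 + j) C 2 + D) C D + 2 * (3 + j)  ≤⟨ ℕ.+-monoˡ-≤ (2 * (3 + j)) (ℕ.≤-trans (C≤^ ((3 + j) C 2) D) (ℕ.^-monoˡ-≤ D (C2-small j))) ⟩
  x + 2 * (3 + j)                      ≤⟨ ℕ.m≤m+n _ j ⟩
  x + 2 * (3 + j) + j                  ≡⟨ solve 2 (λ x j → x :+ con 2 :* (con 3 :+ j) :+ j := x :+ con 3 :* (con 2 :+ j)) refl x j ⟩
  x + 3 * (2 + j)                      ≤⟨ ℕ.+-monoʳ-≤ x (ℕ.*-monoʳ-≤ 3 2+j≤x) ⟩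
  4 * x                                ≤⟨ ℕ.*-monoˡ-≤ x (ℕ.≤-trans (ℕ.≤-reflexive (sym (ℕ.*-identityʳ 4))) (ℕ.*-monoʳ-≤ 4 (ℕ.m^n>0 4 D′))) ⟩
  4 ^ D * x                            ≡⟨ power ⟨
  (2 * (2 + j)) ^ (2 * D)              <⟨ ℕ.≰⇒> (minimal (2 + j) ℕ.≤-refl) ⟩
  n                                    ≤⟨ ℕ.m≤m+n n 2 ⟩
  n + 2                                ∎
  where
  open ℕ.≤-Reasoning
  x = ((2 + j) * (2 + j)) ^ D
  2+j≤x : 2 + j ≤ x
  2+j≤x = ℕ.≤-trans (ℕ.m≤m*n (2 + j) (2 + j)) (ℕ.≤-trans (ℕ.≤-reflexive (sym (ℕ.*-identityʳ _)))
    (ℕ.*-monoʳ-≤ ((2 + j) * (2 + j)) (ℕ.m^n>0 ((2 + j) * (2 + j)) D′)))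
  power : (2 * (2 + j)) ^ (2 * D) ≡ 4 ^ D * x
  power = trans (sym (ℕ.^-*-assoc (2 * (2 + j)) 2 D))
    (trans (cong (_^ D) (solve 1 (λ m → con 2 :* m :* (con 2 :* m :* con 1) := con 4 :* (m :* m)) refl (2 + j)))
      (*-^ D 4 ((2 + j) * (2 + j))))

module _ {n} (G : Graph n) where

  homPair-⊔ : ∀ {h k} → HasHomPair G h → HasHomPair G k → HasHomPair G (h ⊔ k)
  homPair-⊔ {h} {k} p q with ℕ.⊔-sel h k
  ... | inj₁ e = subst (HasHomPair G) (sym e) p
  ... | inj₂ e = subst (HasHomPair G) (sym e) q

  homPair-diameter : Connected G → ∀ {d} → Diameter G d → ∃[ h ] HasHomPair G h × d ≤ 2 * h
  homPair-diameter conn {d} (_ , u , v , p , shortest) =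
    ⌈ d /2⌉ , Geodesic.homPair-geodesic G conn p shortest ⌈ d /2⌉ (small d) , large d
    where
    small : ∀ d → 2 * ⌈ d /2⌉ ≤ suc d
    small zero          = z≤n
    small (suc zero)    = ℕ.≤-refl
    small (suc (suc d)) = ℕ.≤-trans (ℕ.≤-reflexive (ℕ.*-suc 2 ⌈ d /2⌉)) (s≤s (s≤s (small d)))
    large : ∀ d → d ≤ 2 * ⌈ d /2⌉
    large zero          = z≤n
    large (suc zero)    = s≤s z≤n
    large (suc (suc d)) = ℕ.≤-trans (s≤s (s≤s (large d))) (ℕ.≤-reflexive (sym (ℕ.*-suc 2 ⌈ d /2⌉)))

  -- For diameter 2 the pairs have two possible distances, and 2 + 4 < n + 2 is where n ≥ 5 enters.
  -- A larger diameter gives a geodesic with four vertices. This settles all cases in which the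
  -- bound on edges is at most 2.
  homPair-2 : Connected G → 5 ≤ n → ∀ {d} → 2 ≤ d → Diameter G d → HasHomPair G 2
  homPair-2 conn 5≤n {suc zero} (s≤s ()) _
  homPair-2 conn 5≤n {suc (suc zero)} _ (diam , _) = homPair-pigeonhole G conn 1 2 diam (s≤s z≤n) (ℕ.+-monoˡ-≤ 2 5≤n)
  homPair-2 conn 5≤n {suc (suc (suc d))} _ (_ , u , v , p , shortest) =
    Geodesic.homPair-geodesic G conn p shortest 2 (s≤s (s≤s (s≤s (s≤s z≤n))))

  homPair-edges : Connected G → 5 ≤ n → ∀ {d} → 2 ≤ d → Diameter G d → ∃[ h ] HasHomPair G h × 2 * edgeCount G ≤ h * h * n
  homPair-edges conn 5≤n 2≤d diam =
    let k , le , minimal = least (λ k → 2 * edgeCount G ℕ.≤? k * k * n) {2 * edgeCount G} (m≤m*m*n (2 * edgeCount G) (ℕ.≤-trans (s≤s z≤n) 5≤n))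
    in cases k le minimal
    where
    above : ∀ {k} → ¬ 2 * edgeCount G ≤ k * k * n → n * (k * k) < 2 * edgeCount G
    above {k} ¬le = subst (_< 2 * edgeCount G) (ℕ.*-comm (k * k) n) (ℕ.≰⇒> ¬le)
    cases : ∀ k → 2 * edgeCount G ≤ k * k * n → (∀ j → j < k → ¬ 2 * edgeCount G ≤ j * j * n) → ∃[ h ] HasHomPair G h × 2 * edgeCount G ≤ h * h * n
    cases 0 le _ = 2 , homPair-2 conn 5≤n 2≤d diam , ℕ.≤-trans le z≤n
    cases 1 le _ = 2 , homPair-2 conn 5≤n 2≤d diam , ℕ.≤-trans le (ℕ.*-monoˡ-≤ n {1} {4} (s≤s z≤n))
    cases 2 le _ = 2 , homPair-2 conn 5≤n 2≤d diam , le
    cases 3 le min = 3 , homPair-3 G conn (above {2} (min 2 ℕ.≤-refl)) , le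
    -- Degree above 3² gives 11 vertices together with the centre; in the next case degree above 4²
    -- gives 18.
    cases 4 le min = let v , deg = high-degree G conn 9 (above {3} (min 3 ℕ.≤-refl)) in 4 , homPair-star G conn v equalSets-4 deg , le
    cases 5 le min = let v , deg = high-degree G conn 16 (above {4} (min 4 ℕ.≤-refl)) in 5 , homPair-star G conn v equalSets-5 deg , le
    cases (suc (suc (suc (suc (suc (suc j)))))) le min =
      let v , deg = high-degree G conn ((5 + j) * (5 + j)) (above {5 + j} (min (5 + j) ℕ.≤-refl))
      in 6 + j , homPair-star G conn v (equalSets-kneser _ (6 + j) (s≤s z≤n) (kneser-room j)) deg , le

-- The bounds are stated without roots: `2 * e ≤ h * h * n` is h ≥ √(2e/n), and
-- `n ≤ (2 * h) ^ (2 * d ∸ 2)` is h ≥ 0.5 n^(1/(2d - 2)). In the condition on k the term 2k is moved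
-- to the left to avoid truncated subtraction.
theorem3 : ∀ {n : ℕ} (G : Graph n) (e d : ℕ) →
    5 ≤ n → 2 ≤ d → Connected G → Diameter G d → edgeCount G ≡ e →
    ((k : ℕ) → ((k C 2) + (d ∸ 1)) C (d ∸ 1) + 2 * k < n + 2 →
    ∃[ h ] (HasHomPair G h × k ≤ h × d ≤ 2 * h × 2 * e ≤ h * h * n))
    × (d ^ (2 * d ∸ 2) ≤ n →
    ∃[ h ] (HasHomPair G h × n ≤ (2 * h) ^ (2 * d ∸ 2) × d ≤ 2 * h × 2 * e ≤ h * h * n))
theorem3 {n} G e zero _ () _ _ _
theorem3 {n} G e d@(suc D) 5≤n 2≤d conn diam refl = part₁ , part₂
  where
  part₁ : (k : ℕ) → ((k C 2) + D) C D + 2 * k < n + 2 → ∃[ h ] (HasHomPair G h × k ≤ h × d ≤ 2 * h × 2 * e ≤ h * h * n)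
  part₁ k small =
    let h₂ , p₂ , d≤ = homPair-diameter G conn diam
        h₃ , p₃ , e≤ = homPair-edges G conn 5≤n 2≤d diam
        h₁ , p₁ , k≤ = many k small
        h = h₁ ⊔ (h₂ ⊔ h₃)
        h₃≤h = ℕ.≤-trans (ℕ.m≤n⊔m h₂ h₃) (ℕ.m≤n⊔m h₁ (h₂ ⊔ h₃))
    in h , homPair-⊔ G p₁ (homPair-⊔ G p₂ p₃)
     , ℕ.≤-trans k≤ (ℕ.m≤m⊔n h₁ (h₂ ⊔ h₃))
     , ℕ.≤-trans d≤ (ℕ.*-monoʳ-≤ 2 (ℕ.≤-trans (ℕ.m≤m⊔n h₂ h₃) (ℕ.m≤n⊔m h₁ (h₂ ⊔ h₃))))
     , ℕ.≤-trans e≤ (ℕ.*-monoˡ-≤ n (ℕ.*-mono-≤ h₃≤h h₃≤h))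
    where
    many : ∀ k → ((k C 2) + D) C D + 2 * k < n + 2 → ∃[ h ] HasHomPair G h × k ≤ h
    many zero    _  = 2 , homPair-2 G conn 5≤n 2≤d diam , z≤n
    many (suc k) lt = suc k , homPair-pigeonhole G conn D (suc k) (proj₁ diam) (s≤s z≤n) lt , ℕ.≤-refl
  exponent : 2 * d ∸ 2 ≡ 2 * D
  exponent = cong (_∸ 2) (ℕ.*-suc 2 D)
  part₂ : d ^ (2 * d ∸ 2) ≤ n → ∃[ h ] (HasHomPair G h × n ≤ (2 * h) ^ (2 * d ∸ 2) × d ≤ 2 * h × 2 * e ≤ h * h * n)
  part₂ le =
    let k , n≤ , minimal = least {P = λ k → n ≤ (2 * k) ^ (2 * D)} (λ k → n ℕ.≤? (2 * k) ^ (2 * D)) {n} n≤power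
        h , p , k≤h , rest = part₁ k (least-k-fits n D k 5≤n (s≤s⁻¹ 2≤d) (subst (λ m → d ^ m ≤ n) exponent le) n≤ minimal)
    in h , p , subst (λ m → n ≤ (2 * h) ^ m) (sym exponent) (ℕ.≤-trans n≤ (ℕ.^-monoˡ-≤ (2 * D) (ℕ.*-monoʳ-≤ 2 k≤h))) , rest
    where
    n≤power : n ≤ (2 * n) ^ (2 * D)
    n≤power = grow (s≤s⁻¹ 2≤d)
      where
      grow : 1 ≤ D → n ≤ (2 * n) ^ (2 * D)
      grow (s≤s {n = D′} _) = ℕ.≤-trans (ℕ.m≤m+n n (n + 0)) (ℕ.m≤m*n (2 * n) ((2 * n) ^ (D′ + suc (D′ + 0))) {{power-nonZero 5≤n}})
        where
        power-nonZero : 5 ≤ n → NonZero ((2 * n) ^ (D′ + suc (D′ + 0)))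
        power-nonZero (s≤s {n = m} _) = ℕ.m^n≢0 (2 * suc m) (D′ + suc (D′ + 0))
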